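{- There is a polynomial-time approximation-preserving reduction that, given an instance of small set vertex expansion (SSVE) with $n$ nodes and $m$ edges, creates an instance of the $k$-route $(s,t)$-cut problem with $O(n^3)$ nodes, $O(mn^2+n^5)$ edges, and $k=O(mn^2)$. Hence, a $\rho(k,m,n)$-approximation algorithm for the $k$-route $(s,t)$-cut problem (on instances with parameter $k$, $m$ edges and $n$ nodes) yields a $\rho\bigl(O(mn^2),\,O(mn^2+n^5),\,O(n^3)\bigr)$-approximation algorithm for SSVE instances with $n$ nodes and $m$ edges.
   Context: SSVE: given a bipartite graph $G=(U\cup V,E)$ and a parameter $0<\alpha\le1$, find a subset $S\subseteq U$ with $|S|\ge\alpha|U|$ minimizing $|\Gamma(S)|$, where $\Gamma(S)$ is the set of neighbors of $S$ in $G$. $k$-route $(s,t)$-cut: given a finite undirected graph $G=(V,E)$ (parallel edges allowed) with nonnegative edge costs (infinite costs allowed), two nodes $s,t\in V$ and an integer $k\ge1$, find a minimum-cost set $F\subseteq E$ such that $(V,E\setminus F)$ contains at most $k-1$ edge-disjoint $s$-$t$ paths. A reduction is approximation-preserving if, for every $\rho\ge1$, any solution to the constructed instance of cost at most $\rho$ times its optimum can be converted in polynomial time into a solution of the original instance of value at most $\rho$ times its optimum. Approximation algorithms run in polynomial time. -}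

module Defs where

open import Data.Bool.Base using (Bool; true; false; if_then_else_)
open import Data.Fin.Base as Fin using (Fin; toℕ)
open import Data.Fin.Subset as Subset using (Subset; ∣_∣; ⋃)
open import Data.Fin.Subset.Properties using (_∈?_)
open import Data.Integer.Base as ℤ using (+_)
open import Data.List.Base as List using (List; []; _∷_; allFin; filter)
open import Data.List.Relation.Binary.Disjoint.Propositional using (Disjoint)
open import Data.List.Relation.Unary.All using (All)
open import Data.List.Relation.Unary.Unique.Propositional using (Unique)
open import Data.Nat.Base as ℕ using (ℕ; zero; suc; _+_; _*_; _∸_; _^_; _≡ᵇ_)
open import Data.Nat.Binary.Base as ℕᵇ using (ℕᵇ; 2[1+_]; 1+[2_])
open import Data.Product.Base using (Σ; Σ-syntax; ∃-syntax; _×_; _,_; proj₁; proj₂; uncurry)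
open import Data.Rational.Base as ℚ using (ℚ; 0ℚ; 1ℚ; ↥_; ↧ₙ_)
open import Data.Sum.Base using (_⊎_)
open import Data.Vec.Base as Vec using (Vec; lookup)
open import Function.Base using (_∘_)
open import Relation.Binary.Construct.Add.Supremum.NonStrict ℚ._≤_ public
  using () renaming (_≤⁺_ to _≤∞_)
open import Relation.Binary.PropositionalEquality.Core using (_≡_; _≢_)
open import Relation.Nullary.Construct.Add.Supremum public using (_⁺; ⊤⁺; [_])

------------------------------------------------------------------------
-- Polynomial time

-- The machine model is a WHILE language over binary trees (N. D. Jones,
-- "Computability and Complexity from a Programming Perspective").
-- Expression evaluation is charged the total size of all the trees it
-- reads or produces, so that running times agree with those of Turing
-- machines up to a polynomial.

infixr 5 _∙_

data Tree : Set where
  nil : Tree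
  _∙_ : Tree → Tree → Tree

size : Tree → ℕ
size nil     = 1
size (a ∙ b) = suc (size a + size b)

data Expr : Set where
  var   : ℕ → Expr
  nil   : Expr
  cons  : Expr → Expr → Expr
  hd tl : Expr → Expr

infix  6 _:=_
infixr 5 _⨾_

data Cmd : Set where
  _:=_              : ℕ → Expr → Cmd
  _⨾_               : Cmd → Cmd → Cmd
  if_then_else′_end : Expr → Cmd → Cmd → Cmd
  while_loop_end    : Expr → Cmd → Cmd

Store : Set
Store = ℕ → Tree

_[_↦_] : Store → ℕ → Tree → Store
(σ [ x ↦ a ]) y = if x ≡ᵇ y then a else σ y

head tail : Tree → Tree
head nil     = nil
head (a ∙ b) = a
tail nil     = nil
tail (a ∙ b) = b

eval : Store → Expr → Tree
eval σ (var x)    = σ x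
eval σ nil        = nil
eval σ (cons d e) = eval σ d ∙ eval σ e
eval σ (hd e)     = head (eval σ e)
eval σ (tl e)     = tail (eval σ e)

evalTime : Store → Expr → ℕ
evalTime σ (var x)    = size (σ x)
evalTime σ nil        = 1
evalTime σ (cons d e) = evalTime σ d + evalTime σ e + size (eval σ (cons d e))
evalTime σ (hd e)     = evalTime σ e + size (eval σ (hd e))
evalTime σ (tl e)     = evalTime σ e + size (eval σ (tl e))

-- ⟨ c , σ ⟩⇓ σ′ within t : run from the store σ, the command c halts in
-- the store σ′ after exactly t time units.  nil counts as false.

data ⟨_,_⟩⇓_within_ : Cmd → Store → Store → ℕ → Set where

  assign : ∀ {σ x e} →
    ⟨ x := e , σ ⟩⇓ σ [ x ↦ eval σ e ] within suc (evalTime σ e)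

  seq : ∀ {σ σ′ σ″ c d t u} →
    ⟨ c , σ ⟩⇓ σ′ within t → ⟨ d , σ′ ⟩⇓ σ″ within u →
    ⟨ c ⨾ d , σ ⟩⇓ σ″ within suc (t + u)

  if-false : ∀ {σ σ′ e c d t} → eval σ e ≡ nil →
    ⟨ d , σ ⟩⇓ σ′ within t →
    ⟨ if e then c else′ d end , σ ⟩⇓ σ′ within suc (evalTime σ e + t)

  if-true : ∀ {σ σ′ e c d t} → eval σ e ≢ nil →
    ⟨ c , σ ⟩⇓ σ′ within t →
    ⟨ if e then c else′ d end , σ ⟩⇓ σ′ within suc (evalTime σ e + t)

  while-false : ∀ {σ e c} → eval σ e ≡ nil →
    ⟨ while e loop c end , σ ⟩⇓ σ within suc (evalTime σ e)

  while-true : ∀ {σ σ′ σ″ e c t u} → eval σ e ≢ nil →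
    ⟨ c , σ ⟩⇓ σ′ within t → ⟨ while e loop c end , σ′ ⟩⇓ σ″ within u →
    ⟨ while e loop c end , σ ⟩⇓ σ″ within suc (evalTime σ e + t + u)

-- Input and output are in variable 0; the other variables start as nil.

initial : Tree → Store
initial a = (λ _ → nil) [ 0 ↦ a ]

record PolyTime {A : Set} {B : A → Set}
                (encA : A → Tree) (encB : ∀ {a} → B a → Tree)
                (f : ∀ a → B a) : Set where
  field
    program : Cmd
    c d     : ℕ
    runs    : ∀ a → ∃[ σ ] ∃[ t ]
                ⟨ program , initial (encA a) ⟩⇓ σ within t
                × σ 0 ≡ encB (f a)
                × t ℕ.≤ c * size (encA a) ^ d

------------------------------------------------------------------------
-- Encodings of data as trees

unary : ℕ → Tree
unary zero    = nil
unary (suc n) = nil ∙ unary n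

encBits : ℕᵇ → Tree
encBits ℕᵇ.zero  = nil
encBits 2[1+ b ] = nil ∙ encBits b
encBits 1+[2 b ] = (nil ∙ nil) ∙ encBits b

binary : ℕ → Tree
binary = encBits ∘ ℕᵇ.fromℕ

-- Only used for nonnegative rationals, so the sign is not recorded.
encℚ : ℚ → Tree
encℚ q = binary ℤ.∣ ↥ q ∣ ∙ binary (↧ₙ q)

encℚ∞ : ℚ ⁺ → Tree
encℚ∞ [ q ] = nil ∙ encℚ q
encℚ∞ ⊤⁺    = nil

encFin : ∀ {n} → Fin n → Tree
encFin = unary ∘ toℕ

encBool : Bool → Tree
encBool false = nil
encBool true  = nil ∙ nil

encVec : ∀ {A : Set} {n} → (A → Tree) → Vec A n → Tree
encVec enc = Vec.foldr′ (λ a t → enc a ∙ t) nil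

encSubset : ∀ {n} → Subset n → Tree
encSubset = encVec encBool

------------------------------------------------------------------------
-- Minimisation problems and approximation

infixl 6 _+∞_
infixl 7 _·∞_

_+∞_ : ℚ ⁺ → ℚ ⁺ → ℚ ⁺
[ p ] +∞ [ q ] = [ p ℚ.+ q ]
[ p ] +∞ ⊤⁺    = ⊤⁺
⊤⁺    +∞ y     = ⊤⁺

-- Only used with a factor ≥ 1.
_·∞_ : ℚ → ℚ ⁺ → ℚ ⁺
q ·∞ [ x ] = [ q ℚ.* x ]
q ·∞ ⊤⁺    = ⊤⁺

-- A real number ρ ≥ 1, given by a set of rational upper bounds
-- (all rationals q ≥ ρ, or all q > ρ).

record Ratio : Set₁ where
  field
    Above     : ℚ → Set
    inhabited : ∃[ q ] Above q
    upward    : ∀ {p q} → p ℚ.≤ q → Above p → Above q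
    ≥1        : ∀ {q} → Above q → 1ℚ ℚ.≤ q

-- x ≤[ ρ ]· y : x is at most ρ times y, for nonnegative y.
_≤[_]·_ : ℚ ⁺ → Ratio → ℚ ⁺ → Set
x ≤[ ρ ]· y = ∀ q → Ratio.Above ρ q → x ≤∞ q ·∞ y

record MinProblem : Set₁ where
  field
    Instance : Set
    Solution : Instance → Set
    value    : ∀ {I} → Solution I → ℚ ⁺
    encI     : Instance → Tree
    encS     : ∀ {I} → Solution I → Tree

  IsOptimum : Instance → ℚ ⁺ → Set
  IsOptimum I o = (Σ[ S ∈ Solution I ] value S ≡ o) × (∀ (S : Solution I) → o ≤∞ value S)

record ApproximationAlgorithm (P : MinProblem) (ρ : MinProblem.Instance P → Ratio) : Set where
  open MinProblem P
  field
    solve     : ∀ I → Solution I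
    polyTime  : PolyTime encI encS solve
    guarantee : ∀ I o → IsOptimum I o → value (solve I) ≤[ ρ I ]· o

record ApproximationPreservingReduction (P Q : MinProblem) : Set₁ where
  private
    module P = MinProblem P
    module Q = MinProblem Q
  field
    reduce         : P.Instance → Q.Instance
    reducePolyTime : PolyTime P.encI Q.encI reduce
    convert         : ∀ I → Q.Solution (reduce I) → P.Solution I
    convertPolyTime : PolyTime {A = Σ[ I ∈ P.Instance ] Q.Solution (reduce I)}
                               (λ (I , F) → P.encI I ∙ Q.encS F) P.encS (uncurry convert)
    preserves : ∀ (ρ : Ratio) I o o′ → P.IsOptimum I o → Q.IsOptimum (reduce I) o′ →
                ∀ F → Q.value F ≤[ ρ ]· o′ → P.value (convert I F) ≤[ ρ ]· o

------------------------------------------------------------------------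
-- Small set vertex expansion

ℕtoℚ : ℕ → ℚ
ℕtoℚ n = + n ℚ./ 1

record SSVEInstance : Set where
  field
    ∣U∣ ∣V∣ : ℕ
    -- the u-th entry is the set of neighbours of u
    adjacency : Vec (Subset ∣V∣) ∣U∣
    α   : ℚ
    0<α : 0ℚ ℚ.< α
    α≤1 : α ℚ.≤ 1ℚ

  nodes edges : ℕ
  nodes = ∣U∣ + ∣V∣
  edges = Vec.sum (Vec.map ∣_∣ adjacency)

  Γ : Subset ∣U∣ → Subset ∣V∣
  Γ S = ⋃ (List.map (lookup adjacency) (filter (_∈? S) (allFin ∣U∣)))

  LargeEnough : Subset ∣U∣ → Set
  LargeEnough S = α ℚ.* ℕtoℚ ∣U∣ ℚ.≤ ℕtoℚ ∣ S ∣

SSVE : MinProblem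
SSVE = record
  { Instance = SSVEInstance
  ; Solution = λ I → Σ (Subset (∣U∣ I)) (LargeEnough I)
  ; value    = λ {I} (S , _) → [ ℕtoℚ ∣ Γ I S ∣ ]
  ; encI     = λ I → encℚ (α I) ∙ unary (∣U∣ I) ∙ unary (∣V∣ I) ∙ encVec encSubset (adjacency I)
  ; encS     = λ (S , _) → encSubset S
  }
  where open SSVEInstance

------------------------------------------------------------------------
-- k-route (s,t)-cut

record Edge (n : ℕ) : Set where
  field
    end₁ end₂ : Fin n
    loopless  : end₁ ≢ end₂
    cost      : ℚ ⁺
    cost≥0    : [ 0ℚ ] ≤∞ cost

record KRouteInstance : Set where
  field
    nodes edges : ℕ
    edge : Vec (Edge nodes) edges
    s t  : Fin nodes
    s≢t  : s ≢ t
    k    : ℕ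
    k≥1  : 1 ℕ.≤ k

  Joins : Fin edges → Fin nodes → Fin nodes → Set
  Joins e u v = (end₁ ≡ u × end₂ ≡ v) ⊎ (end₁ ≡ v × end₂ ≡ u)
    where open Edge (lookup edge e)

  data Walk : Fin nodes → Fin nodes → Set where
    stop : ∀ {u} → Walk u u
    step : ∀ {u v w} (e : Fin edges) → Joins e u v → Walk v w → Walk u w

  visited : ∀ {u v} → Walk u v → List (Fin nodes)
  visited {u} stop         = u ∷ []
  visited {u} (step _ _ p) = u ∷ visited p

  used : ∀ {u v} → Walk u v → List (Fin edges)
  used stop         = []
  used (step e _ p) = e ∷ used p

  IsPath : ∀ {u v} → Walk u v → Set
  IsPath p = Unique (visited p)

  -- j pairwise edge-disjoint s-t paths in (V , E ∖ F)
  record EdgeDisjointPaths (F : Subset edges) (j : ℕ) : Set where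
    field
      path     : Fin j → Walk s t
      isPath   : ∀ i → IsPath (path i)
      avoids   : ∀ i → All (λ e → e Subset.∉ F) (used (path i))
      disjoint : ∀ {i i′} → i ≢ i′ → Disjoint (used (path i)) (used (path i′))

  IsKRouteCut : Subset edges → Set
  IsKRouteCut F = ∀ j → EdgeDisjointPaths F j → j ℕ.≤ k ∸ 1

  totalCost : Subset edges → ℚ ⁺
  totalCost F = List.foldr _+∞_ [ 0ℚ ]
    (List.map (λ e → Edge.cost (lookup edge e)) (filter (_∈? F) (allFin edges)))

encEdge : ∀ {n} → Edge n → Tree
encEdge e = encFin end₁ ∙ encFin end₂ ∙ encℚ∞ cost
  where open Edge e

KRouteCut : MinProblem
KRouteCut = record
  { Instance = KRouteInstance
  ; Solution = λ J → Σ (Subset (edges J)) (IsKRouteCut J)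
  ; value    = λ {J} (F , _) → totalCost J F
  ; encI     = λ J → unary (nodes J) ∙ encVec encEdge (edge J)
                     ∙ encFin (s J) ∙ encFin (t J) ∙ binary (k J)
  ; encS     = λ (F , _) → encSubset F
  }
  where open KRouteInstance

------------------------------------------------------------------------
-- Asymptotics

-- The bound is required wherever g does not vanish.  It cannot be
-- required elsewhere: k ≥ 1, whereas m n² = 0 for a graph without edges.

infix 4 _∈O_

_∈O_ : {A : Set} → (A → ℕ) → (A → ℕ) → Set
f ∈O g = ∃[ C ] ∀ a → 1 ℕ.≤ g a → f a ℕ.≤ C * g a

module Submission where

-- A k-route cut amounts to a set A of vertices containing s but not t, for
-- which one pays all but the k - 1 most expensive edges that leave A.  Join s
-- to every u ∈ U by an edge of cost ∞ and every v ∈ V to t by a bundle of N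
-- edges of cost 1, and simulate an arc from u to v of cost ∞ by the edges sv,
-- vu, ut of cost ∞: unless u ∈ A and v ∉ A, exactly one of them leaves A.
-- For a suitable k, fewer than k edges of cost ∞ leave A if and only if
-- S = A ∩ U is large enough.  The price is N |Γ(S)| up to an error of at most
-- |U| for each bundle.
--
-- This error would spoil the ratios.  Therefore n + 1 such blocks are put in
-- series, and each of them leaves out some v₀ as a guess of an element of Γ(S).
-- If o is the minimum of |Γ(S)|, then the cheapest cut costs at most
-- N (o - 1), whereas a cut that leads to γ neighbours costs at least
-- (N - n) (γ - 1); for γ > o ≥ 1 and N = n³ the quotient of these numbers is
-- at least γ / o.  The case o = 0 is recognised directly.
--
-- No maximum flow is needed to find S from a cut F: it consists of the u whose
-- neighbours other than v₀ have fewer than n edges of their bundles outside F.  If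
-- S is too small in every block, k disjoint paths can be written down.

open import Defs
open import Data.Bool.Base using (Bool; true; false; if_then_else_; not; _∧_; _∨_; T)
open import Data.Bool.Properties using (T-≡; ¬-not)
open import Data.Empty using (⊥; ⊥-elim)
open import Data.Fin.Base as Fin
  using (Fin; zero; suc; toℕ; combine; remQuot; splitAt; _↑ˡ_; _↑ʳ_; inject₁; inject≤; fromℕ)
import Data.Fin.Properties as Finₚ
open import Data.Fin.Subset as Subset using (Subset; ∣_∣; ∁; _∈_; _∉_)
import Data.Fin.Subset.Properties as Subsetₚ
open import Data.Integer.Base as ℤ using (ℤ) renaming (+_ to pos)
import Data.Integer.Properties as ℤₚ
open import Data.List.Base as List using (List; []; _∷_; _++_)
import Data.List.Membership.Propositional as List∈
import Data.List.Membership.Propositional.Properties as List∈ₚ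
import Data.List.Properties as Listₚ
open import Data.List.Relation.Unary.All as All using (All; []; _∷_)
import Data.List.Relation.Unary.All.Properties as Allₚ
open import Data.List.Relation.Unary.Any using (here; there)
open import Data.List.Relation.Unary.Unique.Propositional using (Unique; []; _∷_)
import Data.List.Relation.Unary.Unique.Propositional.Properties as Uniqueₚ
open import Data.Nat.Base
  using (ℕ; zero; suc; pred; _+_; _*_; _∸_; _^_; _⊔_; _≤_; _<_; z≤n; s≤s; _≡ᵇ_; _≤ᵇ_; _<ᵇ_)
open import Data.Nat.Binary.Base as ℕᵇ using (ℕᵇ; 2[1+_]; 1+[2_])
import Data.Nat.Binary.Properties as ℕᵇₚ
open import Data.Nat.Coprimality using (Coprime)
open import Data.Nat.Properties
open import Data.Nat.Tactic.RingSolver using (solve-∀)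
open import Data.Product.Base using (Σ; Σ-syntax; ∃-syntax; _×_; _,_; proj₁; proj₂; uncurry)
open import Data.Rational.Base as ℚ using (ℚ; 0ℚ; 1ℚ)
import Data.Rational.Properties as ℚₚ
import Data.Rational.Unnormalised.Base as ℚᵘ
import Data.Rational.Unnormalised.Properties as ℚᵘₚ
open import Data.Sum.Base using (_⊎_; inj₁; inj₂)
open import Data.Unit.Base using (⊤; tt)
open import Data.Vec.Base as Vec using (Vec; []; _∷_; lookup; tabulate)
import Data.Vec.Properties as Vecₚ
open import Function.Base using (_∘_; id; const)
open import Function.Bundles using (Equivalence)
open import Function.Definitions using (Injective)
import Relation.Binary.Construct.Add.Supremum.NonStrict ℚ._≤_ as Supₚ
open import Relation.Binary.Definitions using (tri<; tri≈; tri>)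
open import Relation.Binary.PropositionalEquality
  using (_≡_; _≢_; refl; sym; trans; cong; cong₂; subst; subst₂; module ≡-Reasoning)
open import Relation.Nullary using (¬_; yes; no; contradiction)
open import Relation.Nullary.Decidable using (decidable-stable)

-- Programs with polynomial running time

-- The value of `k` comes from counting the edges of cost ∞ that leave A in one block. Every pair of
-- a left and a right vertex has its own triple of edges, crossed once by a good A. The edges to
-- left vertices contribute |∁ S|, and direct edges from source to sink contribute the required size
-- of S. The sum is at most n² + n if and only if S is large enough, whence k = n² + n + 1. Triples
-- of nonadjacent pairs are kept but led through two auxiliary nodes, so that k and the numbering of
-- nodes and edges depend on n alone. For the same reason both sides are padded to n vertices; those
-- added to U are isolated, and the required size grows by their number.
--
-- Polynomial time refers to a concrete machine, so the construction and the conversion appear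
-- twice: on `Fin` and `Subset`, where the arguments about graphs take place, and on numbers and
-- lists, as compositions of program combinators. Equations between encodings link the two. Numbers
-- are computed in unary, which is harmless for the sizes but not for α: its numerator and
-- denominator are given in binary and may be exponentially large.

size≥1 : ∀ a → 1 ≤ size a
size≥1 nil     = s≤s z≤n
size≥1 (a ∙ b) = s≤s z≤n

-- A single monomial serves as the bound. Encodings have size at least 1, so lower powers are
-- absorbed by higher ones, and such bounds are closed under sums, products and composition.
record PolyBound {A : Set} (i : A → Tree) (g : A → ℕ) : Set where
  constructor polyBound
  field
    coefficient exponent : ℕ
    bounded : ∀ a → g a ≤ coefficient * size (i a) ^ exponent

open PolyBound

module _ {A : Set} {i : A → Tree} where

  private
    pow≤ : ∀ a {d e} → d ≤ e → size (i a) ^ d ≤ size (i a) ^ e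
    pow≤ a d≤e with size (i a) | size≥1 (i a)
    ... | suc s | _ = ^-monoʳ-≤ (suc s) d≤e

  pb-≤ : {g h : A → ℕ} → (∀ a → h a ≤ g a) → PolyBound i g → PolyBound i h
  pb-≤ h≤g (polyBound c d b) = polyBound c d (λ a → ≤-trans (h≤g a) (b a))

  pb-const : ∀ n → PolyBound i (const n)
  pb-const n = polyBound n 0 (λ a → ≤-reflexive (sym (*-identityʳ n)))

  pb-size : PolyBound i (size ∘ i)
  pb-size = polyBound 1 1 (λ a → ≤-reflexive (sym (trans (*-identityˡ _) (*-identityʳ _))))

  pb-+ : {g h : A → ℕ} → PolyBound i g → PolyBound i h → PolyBound i (λ a → g a + h a)
  pb-+ (polyBound c d b) (polyBound c′ d′ b′) = polyBound (c + c′) (d + d′) λ a →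
    ≤-trans (+-mono-≤ (≤-trans (b a) (*-monoʳ-≤ c (pow≤ a (m≤m+n d d′))))
                      (≤-trans (b′ a) (*-monoʳ-≤ c′ (pow≤ a (m≤n+m d′ d)))))
            (≤-reflexive (sym (*-distribʳ-+ (size (i a) ^ (d + d′)) c c′)))

  pb-* : {g h : A → ℕ} → PolyBound i g → PolyBound i h → PolyBound i (λ a → g a * h a)
  pb-* (polyBound c d b) (polyBound c′ d′ b′) = polyBound (c * c′) (d + d′) λ a →
    ≤-trans (*-mono-≤ (b a) (b′ a)) (≤-reflexive (begin
      (c * s a ^ d) * (c′ * s a ^ d′)   ≡⟨ [m*n]*[o*p]≡[m*o]*[n*p] c _ c′ _ ⟩
      (c * c′) * (s a ^ d * s a ^ d′)   ≡⟨ cong (c * c′ *_) (^-distribˡ-+-* (s a) d d′) ⟨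
      (c * c′) * s a ^ (d + d′)         ∎))
    where open ≡-Reasoning
          s = size ∘ i

  pb-suc : {g : A → ℕ} → PolyBound i g → PolyBound i (suc ∘ g)
  pb-suc p = pb-+ (pb-const 1) p

  pb-^ : {g : A → ℕ} → ∀ d → PolyBound i g → PolyBound i (λ a → g a ^ d)
  pb-^ zero    p = pb-const 1
  pb-^ (suc d) p = pb-* p (pb-^ d p)

  pb-∘ : {j : A → Tree} {g : A → ℕ} → PolyBound i (size ∘ j) → PolyBound j g → PolyBound i g
  pb-∘ p (polyBound c d b) = pb-≤ b (pb-* (pb-const c) (pb-^ d p))

pb-reindex : {A B : Set} {i : A → Tree} {g : A → ℕ} (h : B → A) →
             PolyBound i g → PolyBound (i ∘ h) (g ∘ h)
pb-reindex h (polyBound c d b) = polyBound c d (b ∘ h)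

≡ᵇ-refl : ∀ x → (x ≡ᵇ x) ≡ true
≡ᵇ-refl zero    = refl
≡ᵇ-refl (suc x) = ≡ᵇ-refl x

≢⇒≡ᵇ-false : ∀ x y → x ≢ y → (x ≡ᵇ y) ≡ false
≢⇒≡ᵇ-false zero    zero    x≢y = contradiction refl x≢y
≢⇒≡ᵇ-false zero    (suc y) x≢y = refl
≢⇒≡ᵇ-false (suc x) zero    x≢y = refl
≢⇒≡ᵇ-false (suc x) (suc y) x≢y = ≢⇒≡ᵇ-false x y (x≢y ∘ cong suc)

update-same : ∀ σ x a → (σ [ x ↦ a ]) x ≡ a
update-same σ x a rewrite ≡ᵇ-refl x = refl

update-other : ∀ σ x a {y} → x ≢ y → (σ [ x ↦ a ]) y ≡ σ y
update-other σ x a {y} x≢y rewrite ≢⇒≡ᵇ-false x y x≢y = refl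

size-eval : ∀ σ e → size (eval σ e) ≤ evalTime σ e
size-eval σ (var x)    = ≤-refl
size-eval σ nil        = ≤-refl
size-eval σ (cons d e) = m≤n+m _ (evalTime σ d + evalTime σ e)
size-eval σ (hd e)     = m≤n+m _ (evalTime σ e)
size-eval σ (tl e)     = m≤n+m _ (evalTime σ e)

-- Evaluating an expression is charged at least the size of its value, so a store cannot grow faster
-- than time passes. This makes the output of a polynomial-time program polynomially large, hence a
-- legitimate input for the next one.
size-run : ∀ {c σ σ′ t} → ⟨ c , σ ⟩⇓ σ′ within t → ∀ y → size (σ′ y) ≤ size (σ y) + t
size-run {σ = σ} (assign {x = x} {e}) y with x ≡ᵇ y
... | true  = ≤-trans (size-eval σ e) (≤-trans (n≤1+n _) (m≤n+m _ (size (σ y))))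
... | false = m≤m+n _ _
size-run {σ = σ} (seq {t = t} {u} r s) y = begin
  _                            ≤⟨ size-run s y ⟩
  _ + u                        ≤⟨ +-monoˡ-≤ u (size-run r y) ⟩
  size (σ y) + t + u           ≡⟨ +-assoc (size (σ y)) t u ⟩
  size (σ y) + (t + u)         ≤⟨ +-monoʳ-≤ (size (σ y)) (n≤1+n _) ⟩
  size (σ y) + suc (t + u)     ∎
  where open ≤-Reasoning
size-run {σ = σ} (if-false {t = t} _ r) y = ≤-trans (size-run r y)
  (+-monoʳ-≤ (size (σ y)) (≤-trans (m≤n+m t _) (n≤1+n _)))
size-run {σ = σ} (if-true {t = t} _ r) y = ≤-trans (size-run r y)
  (+-monoʳ-≤ (size (σ y)) (≤-trans (m≤n+m t _) (n≤1+n _)))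
size-run (while-false _) y = m≤m+n _ _
size-run {σ = σ} (while-true {e = e} {t = t} {u} _ r s) y = begin
  _                            ≤⟨ size-run s y ⟩
  _ + u                        ≤⟨ +-monoˡ-≤ u (size-run r y) ⟩
  size (σ y) + t + u           ≡⟨ +-assoc (size (σ y)) t u ⟩
  size (σ y) + (t + u)         ≤⟨ +-monoʳ-≤ (size (σ y)) (+-monoˡ-≤ u (m≤n+m t (evalTime σ e))) ⟩
  size (σ y) + (evalTime σ e + t + u)   ≤⟨ +-monoʳ-≤ (size (σ y)) (n≤1+n _) ⟩
  size (σ y) + suc (evalTime σ e + t + u) ∎
  where open ≤-Reasoning

-- Unlike in PolyTime, the variables other than 0 may have any initial contents,
-- and those from width on are left untouched; they can therefore hold
-- intermediate results of a larger program.

record Poly {A B : Set} (i : A → Tree) (e : B → Tree) (f : A → B) : Set where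
  field
    command : Cmd
    width   : ℕ
    time    : A → ℕ
    timePB  : PolyBound i time
    run     : ∀ a σ → σ 0 ≡ i a → ∃[ σ′ ] ∃[ t ]
                ⟨ command , σ ⟩⇓ σ′ within t × σ′ 0 ≡ e (f a)
                × (∀ y → width ≤ y → σ′ y ≡ σ y) × t ≤ time a

open Poly

module _ {A B : Set} {i : A → Tree} {e : B → Tree} {f : A → B} where

  sizePB : Poly i e f → PolyBound i (size ∘ e ∘ f)
  sizePB p = pb-≤ le (pb-+ pb-size (timePB p))
    where
    le : ∀ a → size (e (f a)) ≤ size (i a) + time p a
    le a with run p a (initial (i a)) refl
    ... | σ′ , t , r , out , _ , t≤ =
      ≤-trans (≤-reflexive (cong size (sym out))) (≤-trans (size-run r 0) (+-monoʳ-≤ (size (i a)) t≤))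

  recode : {C : Set} {e′ : C → Tree} {g : A → C} → (∀ a → e (f a) ≡ e′ (g a)) → Poly i e f → Poly i e′ g
  recode eq p = record
    { command = command p ; width = width p ; time = time p ; timePB = timePB p
    ; run = λ a σ h → let (σ′ , t , r , out , fr , t≤) = run p a σ h
                      in σ′ , t , r , trans out (eq a) , fr , t≤ }

  reindex : {C : Set} (h : C → A) → Poly i e f → Poly (i ∘ h) e (f ∘ h)
  reindex h p = record
    { command = command p ; width = width p ; time = time p ∘ h ; timePB = pb-reindex h (timePB p)
    ; run = run p ∘ h }

  compP : {C : Set} {e′ : C → Tree} {g : A → C} → Poly i e f → Poly (e ∘ f) e′ g → Poly i e′ g
  compP p q = record
    { command = command p ⨾ command q
    ; width   = width p ⊔ width q
    ; time    = λ a → suc (time p a + time q a)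
    ; timePB  = pb-suc (pb-+ (timePB p) (pb-∘ (sizePB p) (timePB q)))
    ; run     = λ a σ h →
        let (σ₁ , t₁ , r₁ , out₁ , fr₁ , t₁≤) = run p a σ h
            (σ₂ , t₂ , r₂ , out₂ , fr₂ , t₂≤) = run q a σ₁ out₁
        in σ₂ , _ , seq r₁ r₂ , out₂
           , (λ y w≤ → trans (fr₂ y (m⊔n≤o⇒n≤o (width p) (width q) w≤)) (fr₁ y (m⊔n≤o⇒m≤o (width p) (width q) w≤)))
           , s≤s (+-mono-≤ t₁≤ t₂≤) }

-- Stands for the encoding of results that are mere trees. Where such a tree encodes something else,
-- `recode` restores the type.
tree : Tree → Tree
tree = id

toPolyTime : {A : Set} {B : A → Set} {encA : A → Tree} {encB : ∀ {a} → B a → Tree} {f : ∀ a → B a} →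
             Poly encA tree (λ a → encB (f a)) → PolyTime encA encB f
toPolyTime {encA = i} p = record
  { program = command p ; c = coefficient (timePB p) ; d = exponent (timePB p)
  ; runs = λ a → let (σ′ , t , r , out , _ , t≤) = run p a (initial (i a)) refl
                 in σ′ , t , r , out , ≤-trans t≤ (bounded (timePB p) a) }

idP : {A : Set} {i : A → Tree} → Poly i i id
idP {i = i} = record
  { command = 0 := var 0 ; width = 1 ; time = λ a → suc (size (i a)) ; timePB = pb-suc pb-size
  ; run = λ a σ h → _ , _ , assign , h
            , (λ { (suc y) _ → refl }) , s≤s (≤-reflexive (cong size h)) }

quoteTree : Tree → Expr
quoteTree nil     = nil
quoteTree (a ∙ b) = cons (quoteTree a) (quoteTree b)

eval-quoteTree : ∀ σ a → eval σ (quoteTree a) ≡ a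
eval-quoteTree σ nil     = refl
eval-quoteTree σ (a ∙ b) = cong₂ _∙_ (eval-quoteTree σ a) (eval-quoteTree σ b)

quoteTime : Tree → ℕ
quoteTime nil     = 1
quoteTime (a ∙ b) = quoteTime a + quoteTime b + size (a ∙ b)

evalTime-quoteTree : ∀ σ a → evalTime σ (quoteTree a) ≡ quoteTime a
evalTime-quoteTree σ nil     = refl
evalTime-quoteTree σ (a ∙ b)
  rewrite evalTime-quoteTree σ a | evalTime-quoteTree σ b
        | eval-quoteTree σ a | eval-quoteTree σ b = refl

constP : {A B : Set} {i : A → Tree} {e : B → Tree} (b : B) → Poly i e (const b)
constP {e = e} b = record
  { command = 0 := quoteTree (e b) ; width = 1 ; time = const (suc (quoteTime (e b)))
  ; timePB = pb-const _
  ; run = λ a σ h → _ , _ , assign , eval-quoteTree σ (e b)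
            , (λ { (suc y) _ → refl }) , s≤s (≤-reflexive (evalTime-quoteTree σ (e b))) }

size-head : ∀ a → size (head a) ≤ size a
size-head nil     = ≤-refl
size-head (a ∙ b) = ≤-trans (m≤m+n _ _) (n≤1+n _)

size-tail : ∀ a → size (tail a) ≤ size a
size-tail nil     = ≤-refl
size-tail (a ∙ b) = ≤-trans (m≤n+m _ (size a)) (n≤1+n _)

module _ {A B : Set} {i : A → Tree} {e : B → Tree} {f : A → B} where

  hdP : Poly i e f → Poly i tree (head ∘ e ∘ f)
  hdP p = compP p record
    { command = 0 := hd (var 0) ; width = 1 ; time = λ a → suc (size (e (f a)) + size (e (f a)))
    ; timePB = pb-suc (pb-+ pb-size pb-size)
    ; run = λ a σ h → _ , _ , assign , cong head h , (λ { (suc y) _ → refl })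
              , s≤s (+-mono-≤ (≤-reflexive (cong size h))
                      (≤-trans (≤-reflexive (cong (size ∘ head) h)) (size-head (e (f a))))) }

  tlP : Poly i e f → Poly i tree (tail ∘ e ∘ f)
  tlP p = compP p record
    { command = 0 := tl (var 0) ; width = 1 ; time = λ a → suc (size (e (f a)) + size (e (f a)))
    ; timePB = pb-suc (pb-+ pb-size pb-size)
    ; run = λ a σ h → _ , _ , assign , cong tail h , (λ { (suc y) _ → refl })
              , s≤s (+-mono-≤ (≤-reflexive (cong size h))
                      (≤-trans (≤-reflexive (cong (size ∘ tail) h)) (size-tail (e (f a))))) }

  pairP : {C : Set} {e′ : C → Tree} {g : A → C} → Poly i e f → Poly i e′ g →
          Poly i tree (λ a → e (f a) ∙ e′ (g a))
  pairP {e′ = e′} {g} p q = record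
    -- `w` keeps the input for the second program and `suc w` the first result. Both lie beyond the
    -- two widths, so neither program touches them.
    { command = w := var 0 ⨾ command p ⨾ suc w := var 0 ⨾ 0 := var w ⨾ command q
                ⨾ 0 := cons (var (suc w)) (var 0)
    ; width   = suc (suc w)
    ; time    = λ a → suc (suc (I a) + suc (time p a + suc (suc (E a) + suc (suc (I a)
                  + suc (time q a + suc (E a + E′ a + suc (E a + E′ a)))))))
    ; timePB  = pb-suc (pb-+ (pb-suc pb-size) (pb-suc (pb-+ (timePB p) (pb-suc (pb-+ (pb-suc pE)
                  (pb-suc (pb-+ (pb-suc pb-size) (pb-suc (pb-+ (timePB q)
                  (pb-suc (pb-+ (pb-+ pE pE′) (pb-suc (pb-+ pE pE′)))))))))))))
    ; run     = run′ }
    where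
    w = suc (width p + width q)
    I = size ∘ i
    E = size ∘ e ∘ f
    E′ = size ∘ e′ ∘ g
    pE = sizePB p
    pE′ = sizePB q
    p≤w : width p ≤ w
    p≤w = ≤-trans (m≤m+n _ _) (n≤1+n _)
    q≤w : width q ≤ w
    q≤w = ≤-trans (m≤n+m _ (width p)) (n≤1+n _)
    run′ : ∀ a σ → σ 0 ≡ i a → _
    run′ a σ h with run p a (σ [ w ↦ σ 0 ]) h
    ... | σ₁ , t₁ , r₁ , out₁ , fr₁ , t₁≤
      with run q a ((σ₁ [ suc w ↦ σ₁ 0 ]) [ 0 ↦ (σ₁ [ suc w ↦ σ₁ 0 ]) w ]) atw
        where
        atw : (σ₁ [ suc w ↦ σ₁ 0 ]) w ≡ i a
        atw = trans (update-other σ₁ (suc w) _ 1+n≢n)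
                    (trans (fr₁ w p≤w) (trans (update-same σ w _) h))
    ... | σ₂ , t₂ , r₂ , out₂ , fr₂ , t₂≤ =
      _ , _ , seq assign (seq r₁ (seq assign (seq assign (seq r₂ assign)))) , cong₂ _∙_ saved out₂ , frame
      , s≤s (+-mono-≤ (s≤s (≤-reflexive (cong size h))) (s≤s (+-mono-≤ t₁≤
          (s≤s (+-mono-≤ (s≤s (≤-reflexive (cong size out₁)))
         (s≤s (+-mono-≤ (s≤s (≤-reflexive (cong size atw′))) (s≤s (+-mono-≤ t₂≤ (s≤s (≤-reflexive
           (cong₂ (λ x y → x + y + suc (x + y)) (cong size saved) (cong size out₂))))))))))))) 
      where
      atw′ : (σ₁ [ suc w ↦ σ₁ 0 ]) w ≡ i a
      atw′ = trans (update-other σ₁ (suc w) _ 1+n≢n)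
                   (trans (fr₁ w p≤w) (trans (update-same σ w _) h))
      saved : σ₂ (suc w) ≡ e (f a)
      saved = trans (fr₂ (suc w) (≤-trans q≤w (n≤1+n _))) (trans (update-same σ₁ (suc w) _) out₁)
      frame : ∀ y → suc (suc w) ≤ y → _
      frame (suc y) 2+w≤ = trans (fr₂ (suc y) (≤-trans q≤w w≤))
        (trans (update-other σ₁ (suc w) (σ₁ 0) (<⇒≢ 2+w≤))
        (trans (fr₁ (suc y) (≤-trans p≤w w≤)) (update-other σ w (σ 0) (<⇒≢ (≤-trans (n≤1+n _) 2+w≤)))))
        where w≤ = ≤-trans (n≤1+n _) (≤-trans (n≤1+n _) 2+w≤)

infixr 5 _⊙_
_⊙_ : {A B C : Set} {i : A → Tree} {e : B → Tree} {e′ : C → Tree} {f : A → B} {g : A → C} →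
      Poly i e f → Poly i e′ g → Poly i tree (λ a → e (f a) ∙ e′ (g a))
_⊙_ = pairP

-- Environments are trees: a new value is paired with the old input. `topP` and `weakenP` below read
-- them like de Bruijn indices.
letP : {A B C : Set} {i : A → Tree} {e : B → Tree} {e′ : C → Tree} {f : A → B} {g : A → C} →
       Poly i e f → Poly (λ a → e (f a) ∙ i a) e′ g → Poly i e′ g
letP p q = compP (pairP p idP) q

module _ {A B : Set} {i : A → Tree} {e : B → Tree} where

  ifP : {b : A → Bool} {f g : A → B} → Poly i encBool b → Poly i e f → Poly i e g →
        Poly i e (λ a → if b a then f a else g a)
  ifP {b} {f} {g} t p q = letP t record
    { command = if hd (var 0) then command p′ else′ command q′ end
    ; width   = width p′ ⊔ width q′
    ; time    = λ a → suc (J a + J a + (time p′ a + time q′ a))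
    ; timePB  = pb-suc (pb-+ (pb-+ pb-size pb-size) (pb-+ (timePB p′) (timePB q′)))
    ; run     = run′ }
    where
    j : A → Tree
    j a = encBool (b a) ∙ i a
    J = size ∘ j
    p′ : Poly j e f
    p′ = compP (tlP {e = j} {f = id} idP) p
    q′ : Poly j e g
    q′ = compP (tlP {e = j} {f = id} idP) q
    test : ∀ a {s} → s ≡ j a → size s + size (head s) ≤ J a + J a
    test a refl = +-monoʳ-≤ (J a) (size-head (j a))
    Outcome : A → Store → Bool → Set
    Outcome a σ c = ∃[ σ′ ] ∃[ t ]
      ⟨ if hd (var 0) then command p′ else′ command q′ end , σ ⟩⇓ σ′ within t
      × σ′ 0 ≡ e (if c then f a else g a) × (∀ y → width p′ ⊔ width q′ ≤ y → σ′ y ≡ σ y)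
      × t ≤ suc (J a + J a + (time p′ a + time q′ a))
    select : ∀ a σ c → σ 0 ≡ j a → head (σ 0) ≡ encBool c → Outcome a σ c
    select a σ true h h′ =
      let (σ′ , t , r , out , fr , t≤) = run p′ a σ h
      in σ′ , _ , if-true (λ n → nil≢ (trans (sym h′) n)) r , out
         , (λ y w≤ → fr y (m⊔n≤o⇒m≤o (width p′) (width q′) w≤))
         , s≤s (+-mono-≤ (test a h) (≤-trans t≤ (m≤m+n _ _)))
      where nil≢ : nil ∙ nil ≢ nil
            nil≢ ()
    select a σ false h h′ =
      let (σ′ , t , r , out , fr , t≤) = run q′ a σ h
      in σ′ , _ , if-false h′ r , out
         , (λ y w≤ → fr y (m⊔n≤o⇒n≤o (width p′) (width q′) w≤))
         , s≤s (+-mono-≤ (test a h) (≤-trans t≤ (m≤n+m _ (time p′ a))))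
    run′ : ∀ a σ → σ 0 ≡ j a → Outcome a σ (b a)
    run′ a σ h = select a σ (b a) h (cong head h)

encList : {X : Set} → (X → Tree) → List X → Tree
encList ex = List.foldr (λ x t → ex x ∙ t) nil

-- The step also sees the rest of the list, whose length later serves as a loop counter.
iter : {X S : Set} → (X → List X → S → S) → List X → S → S
iter st []       s = s
iter st (x ∷ xs) s = iter st xs (st x xs s)

loopInput : {A X S : Set} → (A → Tree) → (X → Tree) → (S → Tree) → A × X × List X × S → Tree
loopInput i ex es (a , x , xs , s) = es s ∙ (encList ex (x ∷ xs) ∙ i a)

module _ {A X S : Set} {i : A → Tree} {ex : X → Tree} {es : S → Tree}
         {L : A → List X} {z : A → S} (st : A → X → List X → S → S) where

  -- A body of polynomial time might square the size of its state, and iterating it would leave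
  -- polynomial time. Each loop therefore comes with an invariant that bounds all its states by a
  -- polynomial in the input.
  record Invariant : Set₁ where
    field
      Inv     : A → List X → S → Set
      bound   : A → ℕ
      boundPB : PolyBound i bound
      start   : ∀ a → Inv a (L a) (z a)
      keep    : ∀ a x xs s → Inv a (x ∷ xs) s → Inv a xs (st a x xs s)
      small   : ∀ a xs s → Inv a xs s → size (es s) ≤ bound a

  module _ (body : Poly (loopInput i ex es) es (λ (a , x , xs , s) → st a x xs s))
           (listP : Poly i (encList ex) L) (initP : Poly i es z) (I : Invariant) where

    open Invariant I

    private
      l₀ i₀ Z W : A → ℕ
      l₀ a = size (encList ex (L a))
      i₀ a = size (i a)
      -- `Z` bounds the tree on which the body runs, and so each of its parts. `W` bounds one round:
      -- the test, packing the input of the body, the body, and the removal of the head of the list.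
      Z a  = suc (bound a + suc (l₀ a + i₀ a))
      W a  = suc (suc (Z a + suc (suc (Z a + (Z a + Z a + Z a) + Z a)
               + suc (coefficient (timePB body) * Z a ^ exponent (timePB body) + suc (Z a + Z a)))))

      -- During the loop variable 0 holds the state, `u` the remaining list and `v` the input.
      v u : ℕ
      v = suc (width body + (width listP + width initP))
      u = suc v

      b≤v : width body ≤ v
      b≤v = ≤-trans (m≤m+n _ _) (n≤1+n _)
      l≤v : width listP ≤ v
      l≤v = ≤-trans (≤-trans (m≤m+n _ (width initP)) (m≤n+m _ (width body))) (n≤1+n _)
      z≤v : width initP ≤ v
      z≤v = ≤-trans (≤-trans (m≤n+m _ (width listP)) (m≤n+m _ (width body))) (n≤1+n _)

      bodyCmd whileCmd : Cmd
      bodyCmd = 0 := cons (var 0) (cons (var u) (var v)) ⨾ (command body ⨾ u := tl (var u))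
      whileCmd = while var u loop bodyCmd end

      module _ (a : A) where

        loopRun : ∀ xs s σ → σ 0 ≡ es s → σ u ≡ encList ex xs → σ v ≡ i a →
          size (encList ex xs) ≤ l₀ a → Inv a xs s →
          ∃[ σ′ ] ∃[ t ] ⟨ whileCmd , σ ⟩⇓ σ′ within t × σ′ 0 ≡ es (iter (st a) xs s)
            × (∀ y → suc u ≤ y → σ′ y ≡ σ y) × t ≤ suc (List.length xs) * W a
        loopRun [] s σ h0 hu hv _ _ = σ , _ , while-false hu , h0 , (λ _ _ → refl)
          , subst (λ x → suc (size x) ≤ 1 * W a) (sym hu) (s≤s (s≤s z≤n))
        loopRun (x ∷ xs) s σ h0 hu hv l≤ inv
          with run body (a , x , xs , s) (σ [ 0 ↦ σ 0 ∙ (σ u ∙ σ v) ])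
                 (cong₂ _∙_ h0 (cong₂ _∙_ hu hv))
        ... | σ₁ , t₁ , r₁ , out₁ , fr₁ , t₁≤
          with loopRun xs (st a x xs s) (σ₁ [ u ↦ tail (σ₁ u) ]) out₁
                 (trans (update-same σ₁ u _) (cong tail (trans (fr₁ u (≤-trans b≤v (n≤1+n _))) hu)))
                 (trans (update-other σ₁ u _ 1+n≢n) (trans (fr₁ v b≤v) hv))
                 (≤-trans (≤-trans (m≤n+m _ (size (ex x))) (n≤1+n _)) l≤)
                 (keep a x xs s inv)
        ... | σ₂ , t₂ , r₂ , out₂ , fr₂ , t₂≤ =
          σ₂ , _ , while-true nonempty (seq assign (seq r₁ assign)) r₂ , out₂ , frame , time≤
          where
          nonempty : σ u ≢ nil
          nonempty eq with () ← trans (sym hu) eq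
          frame : ∀ y → suc u ≤ y → σ₂ y ≡ σ y
          frame (suc y) u<y = trans (fr₂ (suc y) u<y) (trans (update-other σ₁ u _ (<⇒≢ u<y))
            (fr₁ (suc y) (≤-trans b≤v (≤-trans (n≤1+n _) (≤-trans (n≤1+n _) u<y)))))
          s≤Z : size (σ 0) ≤ Z a
          s≤Z = ≤-trans (≤-reflexive (cong size h0)) (≤-trans (small a _ s inv)
                  (≤-trans (m≤m+n _ _) (n≤1+n _)))
          lst : size (σ u) ≤ l₀ a
          lst = ≤-trans (≤-reflexive (cong size hu)) l≤
          li≤Z : suc (size (σ u) + size (σ v)) ≤ Z a
          li≤Z = ≤-trans (s≤s (+-mono-≤ lst (≤-reflexive (cong size hv))))
                   (≤-trans (m≤n+m _ (bound a)) (n≤1+n _))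
          u≤Z : size (σ u) ≤ Z a
          u≤Z = ≤-trans (m≤m+n _ _) (≤-trans (n≤1+n _) li≤Z)
          v≤Z : size (σ v) ≤ Z a
          v≤Z = ≤-trans (m≤n+m _ (size (σ u))) (≤-trans (n≤1+n _) li≤Z)
          all≤Z : suc (size (σ 0) + suc (size (σ u) + size (σ v))) ≤ Z a
          all≤Z = s≤s (+-mono-≤ (≤-trans (≤-reflexive (cong size h0)) (small a _ s inv))
                    (s≤s (+-mono-≤ lst (≤-reflexive (cong size hv)))))
          body≤ : t₁ ≤ coefficient (timePB body) * Z a ^ exponent (timePB body)
          body≤ = ≤-trans t₁≤ (≤-trans (bounded (timePB body) (a , x , xs , s))
            (*-monoʳ-≤ (coefficient (timePB body)) (^-monoˡ-≤ (exponent (timePB body))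
              (≤-trans (≤-reflexive (sym (cong size (cong₂ _∙_ h0 (cong₂ _∙_ hu hv))))) all≤Z))))
          σ₁u : σ₁ u ≡ σ u
          σ₁u = fr₁ u (≤-trans b≤v (n≤1+n _))
          tl≤ : size (σ₁ u) + size (tail (σ₁ u)) ≤ Z a + Z a
          tl≤ = +-mono-≤ (≤-trans (≤-reflexive (cong size σ₁u)) u≤Z)
                  (≤-trans (size-tail (σ₁ u)) (≤-trans (≤-reflexive (cong size σ₁u)) u≤Z))
          time≤ : _ ≤ W a + suc (List.length xs) * W a
          time≤ = +-mono-≤ (≤-trans (n≤1+n _) (s≤s (s≤s (+-mono-≤ u≤Z (s≤s (+-mono-≤
                    (s≤s (+-mono-≤ (+-mono-≤ s≤Z (+-mono-≤ (+-mono-≤ u≤Z v≤Z) li≤Z)) all≤Z))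
                    (s≤s (+-mono-≤ body≤ (s≤s tl≤))))))))) t₂≤

      length≤ : ∀ xs → suc (List.length xs) ≤ size (encList ex xs)
      length≤ []       = s≤s z≤n
      length≤ (x ∷ xs) = s≤s (≤-trans (length≤ xs) (m≤n+m _ (size (ex x))))

      lPB : PolyBound i l₀
      lPB = sizePB listP

      ZPB : PolyBound i Z
      ZPB = pb-suc (pb-+ boundPB (pb-suc (pb-+ lPB pb-size)))

      WPB : PolyBound i W
      WPB = pb-suc (pb-suc (pb-+ ZPB (pb-suc (pb-+ (pb-suc (pb-+ (pb-+ ZPB (pb-+ (pb-+ ZPB ZPB) ZPB)) ZPB))
              (pb-suc (pb-+ (pb-* (pb-const (coefficient (timePB body))) (pb-^ (exponent (timePB body)) ZPB))
                  (pb-suc (pb-+ ZPB ZPB))))))))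

    loopP : Poly i es (λ a → iter (st a) (L a) (z a))
    loopP = record
      { command = v := var 0 ⨾ (command listP ⨾ (u := var 0 ⨾ (0 := var v ⨾ (command initP ⨾ whileCmd))))
      ; width   = suc u
      ; time    = λ a → suc (suc (i₀ a) + suc (time listP a + suc (suc (l₀ a) + suc (suc (i₀ a)
                    + suc (time initP a + l₀ a * W a)))))
      ; timePB  = pb-suc (pb-+ (pb-suc pb-size) (pb-suc (pb-+ (timePB listP) (pb-suc (pb-+ (pb-suc lPB)
                    (pb-suc (pb-+ (pb-suc pb-size) (pb-suc (pb-+ (timePB initP) (pb-* lPB WPB))))))))))
      ; run     = run′ }
      where
      run′ : ∀ a σ → σ 0 ≡ i a → _
      run′ a σ h with run listP a (σ [ v ↦ σ 0 ]) h
      ... | σ₁ , t₁ , r₁ , out₁ , fr₁ , t₁≤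
        with (σ₁ [ u ↦ σ₁ 0 ]) v in eqv
           | trans (update-other σ₁ u (σ₁ 0) {v} 1+n≢n) (trans (fr₁ v l≤v) (trans (update-same σ v (σ 0)) h))
      ... | _ | eqv′
        with run initP a ((σ₁ [ u ↦ σ₁ 0 ]) [ 0 ↦ (σ₁ [ u ↦ σ₁ 0 ]) v ]) (trans eqv eqv′)
      ... | σ₂ , t₂ , r₂ , out₂ , fr₂ , t₂≤
        with loopRun a (L a) (z a) σ₂ out₂
               (trans (fr₂ u (≤-trans z≤v (n≤1+n _))) (trans (update-same σ₁ u _) out₁))
               (trans (fr₂ v z≤v) (trans eqv eqv′)) ≤-refl (start a)
      ... | σ₃ , t₃ , r₃ , out₃ , fr₃ , t₃≤ =
        σ₃ , _ , seq assign (seq r₁ (seq assign (seq assign (seq r₂ r₃)))) , out₃ , frame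
        , s≤s (+-mono-≤ (s≤s (≤-reflexive (cong size h))) (s≤s (+-mono-≤ t₁≤ (s≤s (+-mono-≤
            (s≤s (≤-reflexive (cong size out₁))) (s≤s (+-mono-≤ (s≤s (≤-reflexive (cong size (trans eqv eqv′))))
            (s≤s (+-mono-≤ t₂≤ (≤-trans t₃≤ (*-monoˡ-≤ (W a) (length≤ (L a)))))))))))))
        where
        frame : ∀ y → suc u ≤ y → σ₃ y ≡ σ y
        frame (suc y) u<y = trans (fr₃ (suc y) u<y) (trans (fr₂ (suc y) (≤-trans z≤v w≤))
          (trans (update-other σ₁ u _ (<⇒≢ u<y)) (trans (fr₁ (suc y) (≤-trans l≤v w≤))
          (update-other σ v _ (<⇒≢ (≤-trans (n≤1+n _) u<y))))))
          where w≤ = ≤-trans (n≤1+n _) (≤-trans (n≤1+n _) u<y)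

-- A program that expects its variables other than 0 to be nil can be run in
-- the middle of another one after clearing the variables that it mentions.

varsExpr : Expr → ℕ
varsExpr (var x)    = suc x
varsExpr nil        = 0
varsExpr (cons d e) = varsExpr d ⊔ varsExpr e
varsExpr (hd e)     = varsExpr e
varsExpr (tl e)     = varsExpr e

vars : Cmd → ℕ
vars (x := e)                  = suc x ⊔ varsExpr e
vars (c ⨾ d)                   = vars c ⊔ vars d
vars if e then c else′ d end   = varsExpr e ⊔ (vars c ⊔ vars d)
vars while e loop c end        = varsExpr e ⊔ vars c

module _ (b : ℕ) where

  AgreeBelow : Store → Store → Set
  AgreeBelow σ τ = ∀ y → y < b → σ y ≡ τ y

  eval-agree : ∀ {σ τ} e → varsExpr e ≤ b → AgreeBelow σ τ →
               eval σ e ≡ eval τ e × evalTime σ e ≡ evalTime τ e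
  eval-agree (var x) v≤ ag = ag x v≤ , cong size (ag x v≤)
  eval-agree nil v≤ ag = refl , refl
  eval-agree (cons d e) v≤ ag
    with eval-agree d (m⊔n≤o⇒m≤o _ _ v≤) ag | eval-agree e (m⊔n≤o⇒n≤o (varsExpr d) _ v≤) ag
  ... | p , p′ | q , q′ = cong₂ _∙_ p q , cong₂ _+_ (cong₂ _+_ p′ q′) (cong size (cong₂ _∙_ p q))
  eval-agree (hd e) v≤ ag with eval-agree e v≤ ag
  ... | p , p′ = cong head p , cong₂ _+_ p′ (cong (size ∘ head) p)
  eval-agree (tl e) v≤ ag with eval-agree e v≤ ag
  ... | p , p′ = cong tail p , cong₂ _+_ p′ (cong (size ∘ tail) p)

  -- A command reads and writes only variables that it mentions, and these are all below `b`. The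
  -- same run with the same time is thus available from any store that agrees there, and the rest of
  -- that store survives.
  run-agree : ∀ {c σ σ′ t} τ → ⟨ c , σ ⟩⇓ σ′ within t → vars c ≤ b → AgreeBelow σ τ →
              ∃[ τ′ ] ⟨ c , τ ⟩⇓ τ′ within t × AgreeBelow σ′ τ′ × (∀ y → b ≤ y → τ′ y ≡ τ y)
  run-agree {σ = σ} τ (assign {x = x} {e}) v≤ ag
    with eval-agree e (m⊔n≤o⇒n≤o (suc x) _ v≤) ag
  ... | p , p′ rewrite p′ = _ , assign , ag′ , (λ y b≤ → update-other τ x _ (<⇒≢ (≤-trans x<b b≤)))
    where
    x<b = m⊔n≤o⇒m≤o (suc x) (varsExpr e) v≤
    ag′ : AgreeBelow (σ [ x ↦ eval σ e ]) (τ [ x ↦ eval τ e ])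
    ag′ y y<b with x ≡ᵇ y
    ... | true  = p
    ... | false = ag y y<b
  run-agree {c = c ⨾ d} τ (seq r s) v≤ ag with run-agree τ r (m⊔n≤o⇒m≤o _ _ v≤) ag
  ... | τ₁ , r′ , ag₁ , fr₁ with run-agree τ₁ s (m⊔n≤o⇒n≤o (vars c) _ v≤) ag₁
  ... | τ₂ , s′ , ag₂ , fr₂ = τ₂ , seq r′ s′ , ag₂ , λ y b≤ → trans (fr₂ y b≤) (fr₁ y b≤)
  run-agree τ (if-false {e = e} {c} {d} z r) v≤ ag
    with eval-agree e (m⊔n≤o⇒m≤o _ _ v≤) ag
       | run-agree τ r (m⊔n≤o⇒n≤o (vars c) _ (m⊔n≤o⇒n≤o (varsExpr e) _ v≤)) ag
  ... | p , p′ | τ₁ , r′ , ag₁ , fr₁ rewrite p′ = τ₁ , if-false (trans (sym p) z) r′ , ag₁ , fr₁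
  run-agree τ (if-true {e = e} {c} {d} z r) v≤ ag
    with eval-agree e (m⊔n≤o⇒m≤o _ _ v≤) ag
       | run-agree τ r (m⊔n≤o⇒m≤o (vars c) _ (m⊔n≤o⇒n≤o (varsExpr e) _ v≤)) ag
  ... | p , p′ | τ₁ , r′ , ag₁ , fr₁ rewrite p′ = τ₁ , if-true (z ∘ trans p) r′ , ag₁ , fr₁
  run-agree τ (while-false {e = e} z) v≤ ag
    with eval-agree e (m⊔n≤o⇒m≤o _ _ v≤) ag
  ... | p , p′ rewrite p′ = τ , while-false (trans (sym p) z) , ag , λ _ _ → refl
  run-agree τ (while-true {e = e} {c} z r s) v≤ ag
    with eval-agree e (m⊔n≤o⇒m≤o _ _ v≤) ag | run-agree τ r (m⊔n≤o⇒n≤o (varsExpr e) _ v≤) ag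
  ... | p , p′ | τ₁ , r′ , ag₁ , fr₁ with run-agree τ₁ s v≤ ag₁
  ... | τ₂ , s′ , ag₂ , fr₂ rewrite p′ =
    τ₂ , while-true (z ∘ trans p) r′ s′ , ag₂ , λ y b≤ → trans (fr₂ y b≤) (fr₁ y b≤)

clear : ℕ → Cmd
-- Variable 0 carries the input; assigning it to itself acts as the empty command.
clear zero    = 0 := var 0
clear (suc n) = suc n := nil ⨾ clear n

clear-run : ∀ n σ → ∃[ σ′ ] ⟨ clear n , σ ⟩⇓ σ′ within (suc (size (σ 0)) + n * 3)
            × (∀ y → y < suc n → σ′ y ≡ initial (σ 0) y) × (∀ y → suc n ≤ y → σ′ y ≡ σ y)
clear-run zero σ = σ [ 0 ↦ σ 0 ] , subst (λ t → ⟨ 0 := var 0 , σ ⟩⇓ σ [ 0 ↦ σ 0 ] within t) (sym (+-identityʳ _)) assign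
  , (λ { zero _ → refl ; (suc y) (s≤s ()) }) , (λ { (suc y) _ → refl })
clear-run (suc n) σ with clear-run n (σ [ suc n ↦ nil ])
... | σ′ , r , low , high = σ′
  , subst (λ t → ⟨ suc n := nil ⨾ clear n , σ ⟩⇓ σ′ within t) (rearrange (size (σ 0))) (seq assign r) , low′
  , (λ y n<y → trans (high y (≤-trans (n≤1+n _) n<y)) (update-other σ (suc n) nil (<⇒≢ n<y)))
  where
  rearrange : ∀ s → suc (2 + (suc s + n * 3)) ≡ suc s + suc n * 3
  rearrange s = trans (sym (+-assoc 3 (suc s) (n * 3)))
    (trans (cong (_+ n * 3) (+-comm 3 (suc s))) (+-assoc (suc s) 3 (n * 3)))
  low′ : ∀ y → y < suc (suc n) → σ′ y ≡ initial (σ 0) y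
  low′ y y<2+n with y ≟ suc n
  ... | yes refl = trans (high (suc n) ≤-refl) (update-same σ (suc n) nil)
  ... | no  y≢  = low y (≤∧≢⇒< (≤-pred y<2+n) y≢)

fromPolyTime : {A : Set} {B : A → Set} {encA : A → Tree} {encB : ∀ {a} → B a → Tree} {f : ∀ a → B a} →
               PolyTime encA encB f → Poly encA tree (λ a → encB (f a))
fromPolyTime {A} {encA = i} {encB} {f} p = record
  { command = clear v ⨾ program
  ; width   = suc v
  ; time    = λ a → suc (suc (size (i a)) + v * 3 + c * size (i a) ^ d)
  ; timePB  = pb-suc (pb-+ (pb-+ (pb-suc pb-size) (pb-const _)) (polyBound c d (λ _ → ≤-refl)))
  ; run     = run′ }
  where
  open PolyTime p
  v = vars program
  run′ : ∀ a σ → σ 0 ≡ i a → ∃[ σ′ ] ∃[ t ] ⟨ clear v ⨾ program , σ ⟩⇓ σ′ within t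
         × σ′ 0 ≡ encB (f a) × (∀ y → suc v ≤ y → σ′ y ≡ σ y) × _
  run′ a σ h with clear-run v σ | runs a
  ... | σ₁ , r₁ , low , high | τ , t , r , out , t≤
    with run-agree (suc v) σ₁ r (n≤1+n _)
           (λ y y< → trans (cong (λ x → initial x y) (sym h)) (sym (low y y<)))
  ... | σ₂ , r₂ , ag , fr =
    σ₂ , _ , seq r₁ r₂ , trans (sym (ag 0 (s≤s z≤n))) out , (λ y v<y → trans (fr y v<y) (high y v<y))
    , s≤s (+-mono-≤ (≤-reflexive (cong (λ x → suc (size x) + v * 3) h)) t≤)

-- Computing with lists, numbers and Booleans

-- The gain of a round may depend on the input and on the remaining list, but not on the state.
-- Gains then add up instead of compounding.
record Growth {A X S : Set} (i : A → Tree) (ex : X → Tree) (es : S → Tree)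
              (st : A → X → List X → S → S) : Set where
  field
    gain   : A × X × List X → ℕ
    gainPB : PolyBound (λ (a , x , xs) → encList ex (x ∷ xs) ∙ i a) gain
    grow   : ∀ a x xs s → size (es (st a x xs s)) ≤ size (es s) + gain (a , x , xs)

module _ {A X S : Set} {i : A → Tree} {ex : X → Tree} {es : S → Tree}
         {L : A → List X} {z : A → S} {st : A → X → List X → S → S}
         (listP : Poly i (encList ex) L) (initP : Poly i es z) (G : Growth i ex es st) where

  open Growth G

  additive : Invariant {i = i} {ex} {es} {L} {z} st
  additive = record
    -- A potential: each round still to come is charged `R a`, so the size of the state plus the
    -- outstanding charges never increases.
    { Inv     = λ a xs s → l xs ≤ l (L a) × size (es s) + l xs * R a ≤ size (es (z a)) + l (L a) * R a
    ; bound   = λ a → size (es (z a)) + l (L a) * R a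
    ; boundPB = pb-+ (sizePB initP) (pb-* (sizePB listP) (pb-* (pb-const cg)
        (pb-^ dg (pb-suc (pb-+ (sizePB listP) pb-size)))))
    ; start   = λ a → ≤-refl , ≤-refl
    ; keep    = keep
    ; small   = λ a xs s (_ , h) → ≤-trans (m≤m+n _ _) h }
    where
    l : List X → ℕ
    l xs = size (encList ex xs)
    cg = coefficient gainPB
    dg = exponent gainPB
    R : A → ℕ
    R a = cg * suc (l (L a) + size (i a)) ^ dg
    keep : ∀ a x xs s → _ → _
    keep a x xs s (short , h) = ≤-trans l≤ short , (begin
      size (es (st a x xs s)) + l xs * R a     ≤⟨ +-monoˡ-≤ _ (grow a x xs s) ⟩
      size (es s) + gain (a , x , xs) + l xs * R a   ≤⟨ +-monoˡ-≤ _ (+-monoʳ-≤ (size (es s)) gain≤R) ⟩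
      size (es s) + R a + l xs * R a           ≡⟨ +-assoc (size (es s)) (R a) _ ⟩
      size (es s) + suc (l xs) * R a           ≤⟨ +-monoʳ-≤ (size (es s)) (*-monoˡ-≤ (R a) l<) ⟩
      size (es s) + l (x ∷ xs) * R a           ≤⟨ h ⟩
      size (es (z a)) + l (L a) * R a          ∎)
      where
      open ≤-Reasoning
      l< : suc (l xs) ≤ l (x ∷ xs)
      l< = s≤s (m≤n+m _ (size (ex x)))
      l≤ = ≤-trans (n≤1+n _) l<
      gain≤R : gain (a , x , xs) ≤ R a
      gain≤R = ≤-trans (bounded gainPB (a , x , xs))
        (*-monoʳ-≤ cg (^-monoˡ-≤ dg (s≤s (+-monoˡ-≤ (size (i a)) short))))

module _ {A X S : Set} {i : A → Tree} {ex : X → Tree} {es : S → Tree} where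

  private
    j : A × X × List X × S → Tree
    j = loopInput i ex es

  stateP : Poly j es (λ (a , x , xs , s) → s)
  stateP = recode (λ _ → refl) (hdP (idP {i = j}))

  itemP : Poly j ex (λ (a , x , xs , s) → x)
  itemP = recode (λ _ → refl) (hdP (hdP (tlP (idP {i = j}))))

  restP : Poly j (encList ex) (λ (a , x , xs , s) → xs)
  restP = recode (λ _ → refl) (tlP (hdP (tlP (idP {i = j}))))

  outerP : {B : Set} {e : B → Tree} {f : A → B} → Poly i e f → Poly j e (λ (a , x , xs , s) → f a)
  outerP p = compP (recode {e′ = i} {g = proj₁} (λ _ → refl) (tlP (tlP (idP {i = j})))) (reindex proj₁ p)

weakenP : {A B C : Set} {i : A → Tree} {e : B → Tree} {e′ : C → Tree} {f : A → C} →
          Poly i e′ f → Poly (λ ((a , b) : A × B) → e b ∙ i a) e′ (λ (a , b) → f a)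
weakenP {i = i} {e} p =
  compP (recode {e′ = i} {g = proj₁} (λ _ → refl) (tlP (idP {i = λ (a , b) → e b ∙ i a}))) (reindex proj₁ p)

topP : {A B : Set} {i : A → Tree} {e : B → Tree} → Poly (λ ((a , b) : A × B) → e b ∙ i a) e proj₂
topP {i = i} {e} = recode (λ _ → refl) (hdP (idP {i = λ (a , b) → e b ∙ i a}))

consP : {A X : Set} {i : A → Tree} {ex : X → Tree} {f : A → X} {g : A → List X} →
        Poly i ex f → Poly i (encList ex) g → Poly i (encList ex) (λ a → f a ∷ g a)
consP p q = recode (λ _ → refl) (pairP p q)

iter-reverse : {X : Set} (xs acc : List X) → iter (λ x _ s → x ∷ s) xs acc ≡ List.reverseAcc acc xs
iter-reverse []       acc = refl
iter-reverse (x ∷ xs) acc = iter-reverse xs (x ∷ acc)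

module _ {A X : Set} {i : A → Tree} {ex : X → Tree} where

  reverseAccP : {f g : A → List X} → Poly i (encList ex) f → Poly i (encList ex) g →
                Poly i (encList ex) (λ a → List.reverseAcc (g a) (f a))
  reverseAccP {f} {g} p q = recode (λ a → cong (encList ex) (iter-reverse (f a) (g a)))
    (loopP (λ a x _ s → x ∷ s) (consP itemP stateP) p q (additive p q record
      { gain = λ (a , x , xs) → size (encList ex (x ∷ xs) ∙ i a) ; gainPB = pb-size
      ; grow = λ a x xs s → ≤-trans (≤-reflexive (+-comm (suc (size (ex x))) (size (encList ex s))))
          (+-monoʳ-≤ (size (encList ex s)) (≤-trans (s≤s (m≤m+n _ _)) (≤-trans (m≤m+n _ (size (i a))) (n≤1+n _)))) }))

  reverseP : {f : A → List X} → Poly i (encList ex) f → Poly i (encList ex) (List.reverse ∘ f)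
  reverseP p = reverseAccP p (constP [])

  appendP : {f g : A → List X} → Poly i (encList ex) f → Poly i (encList ex) g →
            Poly i (encList ex) (λ a → f a ++ g a)
  appendP {f} {g} p q = recode (λ a → cong (encList ex) (eq (f a) (g a))) (reverseAccP (reverseP p) q)
    where
    eq : ∀ xs ys → List.reverseAcc ys (List.reverse xs) ≡ xs ++ ys
    eq xs ys = trans (Listₚ.ʳ++-defn (List.reverse xs))
                     (cong (_++ ys) (Listₚ.reverse-involutive xs))

  dropHeadP : {f : A → List X} → Poly i (encList ex) f → Poly i (encList ex) (List.drop 1 ∘ f)
  dropHeadP {f} p = recode (λ a → eq (f a)) (tlP p)
    where
    eq : ∀ xs → tail (encList ex xs) ≡ encList ex (List.drop 1 xs)
    eq []       = refl
    eq (x ∷ xs) = refl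

headOr : {X : Set} → X → List X → X
headOr d []      = d
headOr d (x ∷ _) = x

-- The default has to be encoded as `nil`, since that is what the machine returns as the head of
-- `nil`.
headOrP : {A X : Set} {i : A → Tree} {ex : X → Tree} {f : A → List X} (d : X) → ex d ≡ nil →
          Poly i (encList ex) f → Poly i ex (headOr d ∘ f)
headOrP {ex = ex} {f} d d≡ p = recode (λ a → eq (f a)) (hdP p)
  where
  eq : ∀ xs → head (encList ex xs) ≡ ex (headOr d xs)
  eq []       = sym d≡
  eq (x ∷ xs) = refl

size-append : {X : Set} (ex : X → Tree) (xs ys : List X) →
              size (encList ex (xs ++ ys)) ≤ size (encList ex ys) + size (encList ex xs)
size-append ex []       ys = m≤m+n _ 1
size-append ex (x ∷ xs) ys = ≤-trans (s≤s (+-monoʳ-≤ (size (ex x)) (size-append ex xs ys)))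
  (≤-reflexive (rearrange (size (ex x)) (size (encList ex ys)) _))
  where
  rearrange : ∀ a b c → suc (a + (b + c)) ≡ b + suc (a + c)
  rearrange a b c = trans (cong suc (trans (sym (+-assoc a b c)) (trans (cong (_+ c) (+-comm a b)) (+-assoc b a c))))
                          (sym (+-suc b (a + c)))

-- Counting down makes the index equal to the length of the remaining list of units. It also makes
-- the result a right fold over `upTo`, so that lists built by prepending come out in increasing
-- order.
downTo : {S : Set} → (ℕ → S → S) → ℕ → S → S
downTo st zero    s = s
downTo st (suc m) s = downTo st m (st m s)

encUnits : List ⊤ → Tree
encUnits = encList (const nil)

unary-units : ∀ n → encUnits (List.replicate n tt) ≡ unary n
unary-units zero    = refl
unary-units (suc n) = cong (nil ∙_) (unary-units n)

units-unary : ∀ us → encUnits us ≡ unary (List.length us)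
units-unary []       = refl
units-unary (_ ∷ us) = cong (nil ∙_) (units-unary us)

iter-units : {S : Set} (st : ℕ → S → S) → ∀ n s →
             iter (λ _ us → st (List.length us)) (List.replicate n tt) s ≡ downTo st n s
iter-units st zero    s = refl
iter-units st (suc n) s rewrite Listₚ.length-replicate n {x = tt} = iter-units st n (st n s)

counterInput : {A S : Set} → (A → Tree) → (S → Tree) → A × ℕ × S → Tree
counterInput i es (a , m , s) = es s ∙ (unary m ∙ i a)

module _ {A S : Set} {i : A → Tree} {es : S → Tree} where

  downToP : {st : A → ℕ → S → S} {n : A → ℕ} {z : A → S} {g : A × ℕ → ℕ} →
    Poly (counterInput i es) es (λ (a , m , s) → st a m s) →
    PolyBound (λ (a , m) → unary m ∙ i a) g →
    (∀ a m s → size (es (st a m s)) ≤ size (es s) + g (a , m)) →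
    Poly i unary n → Poly i es z → Poly i es (λ a → downTo (st a) (n a) (z a))
  downToP {st} {n} {z} {g} body gPB grow nP zP =
    recode (λ a → cong es (iter-units (st a) (n a) (z a)))
      (loopP st′ body′ unitsP zP (additive unitsP zP record
        { gain   = λ (a , _ , us) → g (a , List.length us)
        ; gainPB = pb-∘ (pb-≤ smaller pb-size) (pb-reindex (λ (a , _ , us) → a , List.length us) gPB)
        ; grow   = λ a _ us s → grow a (List.length us) s }))
    where
    st′ : A → ⊤ → List ⊤ → S → S
    st′ a _ us s = st a (List.length us) s
    unitsP : Poly i encUnits (λ a → List.replicate (n a) tt)
    unitsP = recode (λ a → sym (unary-units (n a))) nP
    smaller : ((a , _ , us) : A × ⊤ × List ⊤) →
              size (unary (List.length us) ∙ i a) ≤ size (encUnits (tt ∷ us) ∙ i a)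
    smaller (a , _ , us) = s≤s (+-monoˡ-≤ (size (i a))
      (≤-trans (≤-reflexive (cong size (sym (units-unary us)))) (≤-trans (n≤1+n _) (n≤1+n _))))
    j : A × ⊤ × List ⊤ × S → Tree
    j = loopInput i (const nil) es
    body′ : Poly j es (λ (a , x , us , s) → st′ a x us s)
    body′ = compP
      (recode {e′ = counterInput i es} {g = λ (a , _ , us , s) → a , List.length us , s}
              (λ (a , _ , us , s) → cong (λ t → es s ∙ (t ∙ i a)) (units-unary us))
              (stateP {i = i} {const nil} {es} ⊙ restP {i = i} {const nil} {es} ⊙ outerP idP))
      (reindex (λ (a , _ , us , s) → a , List.length us , s) body)

  accP : Poly (counterInput i es) es (λ (a , m , s) → s)
  accP = recode (λ _ → refl) (hdP (idP {i = counterInput i es}))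

  outsideP : {B : Set} {e : B → Tree} {f : A × ℕ → B} →
             Poly (λ (a , m) → unary m ∙ i a) e f → Poly (counterInput i es) e (λ (a , m , s) → f (a , m))
  outsideP p = compP
    (recode {e′ = λ (a , m) → unary m ∙ i a} {g = λ (a , m , s) → a , m}
            (λ _ → refl) (tlP (idP {i = counterInput i es})))
    (reindex (λ (a , m , s) → a , m) p)

module _ {A : Set} {i : A → Tree} where

  sucP : {f : A → ℕ} → Poly i unary f → Poly i unary (suc ∘ f)
  sucP p = recode (λ _ → refl) (constP {e = tree} nil ⊙ p)

  predP : {f : A → ℕ} → Poly i unary f → Poly i unary (pred ∘ f)
  predP {f} p = recode (λ a → eq (f a)) (tlP p)
    where
    eq : ∀ n → tail (unary n) ≡ unary (pred n)
    eq zero    = refl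
    eq (suc n) = refl

size-unary-+ : ∀ m n → size (unary (m + n)) ≤ size (unary n) + size (unary m)
size-unary-+ zero    n = m≤m+n _ 1
size-unary-+ (suc m) n = ≤-trans (s≤s (s≤s (size-unary-+ m n)))
  (≤-reflexive (sym (trans (+-suc (size (unary n)) _) (cong suc (+-suc (size (unary n)) _)))))

size-unary-pred : ∀ n → size (unary (pred n)) ≤ size (unary n)
size-unary-pred zero    = ≤-refl
size-unary-pred (suc n) = ≤-trans (n≤1+n _) (n≤1+n _)

size-drop : {X : Set} (ex : X → Tree) (xs : List X) → size (encList ex (List.drop 1 xs)) ≤ size (encList ex xs)
size-drop ex []       = ≤-refl
size-drop ex (x ∷ xs) = ≤-trans (m≤n+m _ (size (ex x))) (n≤1+n _)

module _ {A : Set} {i : A → Tree} where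

  addP : {f g : A → ℕ} → Poly i unary f → Poly i unary g → Poly i unary (λ a → f a + g a)
  addP {f} {g} p q = recode (λ a → cong unary (eq (f a) (g a)))
    (downToP (sucP accP) (pb-const 2) (λ a m s → ≤-reflexive (+-comm 2 (size (unary s)))) p q)
    where
    eq : ∀ m n → downTo (λ _ → suc) m n ≡ m + n
    eq zero    n = refl
    eq (suc m) n = trans (eq m (suc n)) (+-suc m n)

module _ {A : Set} {i : A → Tree} where

  mulP : {f g : A → ℕ} → Poly i unary f → Poly i unary g → Poly i unary (λ a → f a * g a)
  mulP {f} {g} p q = recode (λ a → cong unary (trans (eq (f a) (g a) 0) (+-identityʳ _)))
    (downToP {g = λ (a , m) → size (unary (g a))} (addP (outsideP (weakenP q)) accP) (sizePB (weakenP q))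
      (λ a m s → size-unary-+ (g a) s) p (constP 0))
    where
    eq : ∀ m n z → downTo (λ _ → n +_) m z ≡ m * n + z
    eq zero    n z = refl
    eq (suc m) n z = trans (eq m n (n + z)) (trans (sym (+-assoc (m * n) n z)) (cong (_+ z) (+-comm (m * n) n)))

  monusP : {f g : A → ℕ} → Poly i unary f → Poly i unary g → Poly i unary (λ a → f a ∸ g a)
  monusP {f} {g} p q = recode (λ a → cong unary (eq (g a) (f a)))
    (downToP (predP accP) (pb-const 0) (λ a m s → ≤-trans (size-unary-pred s) (m≤m+n _ 0)) q p)
    where
    eq : ∀ n m → downTo (λ _ → pred) n m ≡ m ∸ n
    eq zero    m = refl
    eq (suc n) m = trans (eq n (pred m)) (pred∸ m n)
      where
      pred∸ : ∀ m n → pred m ∸ n ≡ m ∸ suc n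
      pred∸ zero    n = 0∸n≡0 n
      pred∸ (suc m) n = refl

  dropP : {X : Set} {ex : X → Tree} {f : A → ℕ} {g : A → List X} → Poly i unary f →
          Poly i (encList ex) g → Poly i (encList ex) (λ a → List.drop (f a) (g a))
  dropP {X} {ex} {f} {g} p q = recode (λ a → cong (encList ex) (eq (f a) (g a)))
    (downToP (dropHeadP accP) (pb-const 0) (λ a m s → ≤-trans (size-drop ex s) (m≤m+n _ 0)) p q)
    where
    eq : ∀ m (xs : List X) → downTo (λ _ → List.drop 1) m xs ≡ List.drop m xs
    eq zero    xs       = refl
    eq (suc m) []       = trans (eq m []) (Listₚ.drop-[] m)
    eq (suc m) (x ∷ xs) = eq m xs

nth : {X : Set} → X → List X → ℕ → X
nth d xs m = headOr d (List.drop m xs)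

nthP : {A X : Set} {i : A → Tree} {ex : X → Tree} {f : A → ℕ} {g : A → List X} (d : X) → ex d ≡ nil →
       Poly i (encList ex) g → Poly i unary f → Poly i ex (λ a → nth d (g a) (f a))
nthP d d≡ q p = headOrP d d≡ (dropP p q)

isNode : Tree → Bool
isNode nil     = false
isNode (_ ∙ _) = true

isNodeP : {A B : Set} {i : A → Tree} {e : B → Tree} {f : A → B} →
          Poly i e f → Poly i encBool (isNode ∘ e ∘ f)
isNodeP {e = e} {f} p = compP p record
  { command = if var 0 then 0 := cons nil nil else′ 0 := nil end ; width = 1
  ; time    = λ a → suc (size (e (f a)) + 6)
  ; timePB  = pb-suc (pb-+ pb-size (pb-const 6))
  ; run     = λ a σ h → test (e (f a)) σ h }
  where
  test : ∀ s σ → σ 0 ≡ s → ∃[ σ′ ] ∃[ t ]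
         ⟨ if var 0 then 0 := cons nil nil else′ 0 := nil end , σ ⟩⇓ σ′ within t
         × σ′ 0 ≡ encBool (isNode s) × (∀ y → 1 ≤ y → σ′ y ≡ σ y) × t ≤ suc (size s + 6)
  test nil     σ h = _ , _ , if-false h assign , refl , (λ { (suc y) _ → refl })
    , s≤s (+-mono-≤ (≤-reflexive (cong size h)) (s≤s (s≤s z≤n)))
  test (u ∙ v) σ h = _ , _ , if-true (λ n → node≢nil (trans (sym h) n)) assign , refl , (λ { (suc y) _ → refl })
    , s≤s (+-mono-≤ (≤-reflexive (cong size h)) ≤-refl)
    where node≢nil : u ∙ v ≢ nil
          node≢nil ()

module _ {A : Set} {i : A → Tree} where

  notP : {f : A → Bool} → Poly i encBool f → Poly i encBool (not ∘ f)
  notP {f} p = recode (λ a → eq (f a)) (ifP p (constP {e = encBool} false) (constP true))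
    where
    eq : ∀ b → encBool (if b then false else true) ≡ encBool (not b)
    eq false = refl
    eq true  = refl

  andP : {f g : A → Bool} → Poly i encBool f → Poly i encBool g → Poly i encBool (λ a → f a ∧ g a)
  andP {f} {g} p q = recode (λ a → eq (f a) (g a)) (ifP p q (constP {e = encBool} false))
    where
    eq : ∀ b c → encBool (if b then c else false) ≡ encBool (b ∧ c)
    eq false c = refl
    eq true  c = refl

  orP : {f g : A → Bool} → Poly i encBool f → Poly i encBool g → Poly i encBool (λ a → f a ∨ g a)
  orP {f} {g} p q = recode (λ a → eq (f a) (g a)) (ifP p (constP {e = encBool} true) q)
    where
    eq : ∀ b c → encBool (if b then true else c) ≡ encBool (b ∨ c)
    eq false c = refl
    eq true  c = refl

  leqP : {f g : A → ℕ} → Poly i unary f → Poly i unary g → Poly i encBool (λ a → f a ≤ᵇ g a)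
  leqP {f} {g} p q = recode (λ a → cong encBool (eq (f a) (g a))) (notP (isNodeP (monusP p q)))
    where
    eq< : ∀ m n → not (isNode (unary (m ∸ n))) ≡ (m <ᵇ suc n)
    eq< zero    n       = cong (not ∘ isNode ∘ unary) (0∸n≡0 n)
    eq< (suc m) zero    = refl
    eq< (suc m) (suc n) = eq< m n
    eq : ∀ m n → not (isNode (unary (m ∸ n))) ≡ (m ≤ᵇ n)
    eq zero    n       = cong (not ∘ isNode ∘ unary) (0∸n≡0 n)
    eq (suc m) zero    = refl
    eq (suc m) (suc n) = eq< m n

  eqP : {f g : A → ℕ} → Poly i unary f → Poly i unary g → Poly i encBool (λ a → f a ≡ᵇ g a)
  eqP {f} {g} p q = recode (λ a → cong encBool (eq (f a) (g a))) (andP (leqP p q) (leqP q p))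
    where
    ≤ᵇ-suc : ∀ m n → (suc m ≤ᵇ suc n) ≡ (m ≤ᵇ n)
    ≤ᵇ-suc zero    n = refl
    ≤ᵇ-suc (suc m) n = refl
    eq : ∀ m n → (m ≤ᵇ n) ∧ (n ≤ᵇ m) ≡ (m ≡ᵇ n)
    eq zero    zero    = refl
    eq zero    (suc n) = refl
    eq (suc m) zero    = refl
    eq (suc m) (suc n) = trans (cong₂ _∧_ (≤ᵇ-suc m n) (≤ᵇ-suc n m)) (eq m n)

module _ {A : Set} {i : A → Tree} where

  private
    j : A × ℕ → Tree
    j (a , m) = unary m ∙ i a

  concatUpToP : {Y : Set} {ey : Y → Tree} {n : A → ℕ} {f : A × ℕ → List Y} → Poly i unary n →
                Poly j (encList ey) f → Poly i (encList ey) (λ a → List.concatMap (λ m → f (a , m)) (List.upTo (n a)))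
  concatUpToP {Y} {ey} {n} {f} nP p = recode (λ a → cong (encList ey) (trans (eq (λ m → f (a , m)) (n a) [])
      (Listₚ.++-identityʳ _)))
    (downToP {g = λ am → size (encList ey (f am))} (appendP (outsideP p) accP) (sizePB p)
      (λ a m s → size-append ey (f (a , m)) s) nP (constP []))
    where
    open ≡-Reasoning
    eq : ∀ (h : ℕ → List Y) n acc → downTo (λ m s → h m ++ s) n acc ≡ List.concatMap h (List.upTo n) ++ acc
    eq h zero    acc = refl
    eq h (suc n) acc = begin
      downTo (λ m s → h m ++ s) n (h n ++ acc)                   ≡⟨ eq h n _ ⟩
      List.concatMap h (List.upTo n) ++ (h n ++ acc)
          ≡⟨ Listₚ.++-assoc (List.concatMap h (List.upTo n)) (h n) acc ⟨
      (List.concatMap h (List.upTo n) ++ h n) ++ acc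
          ≡⟨ cong (λ x → (List.concatMap h (List.upTo n) ++ x) ++ acc) (Listₚ.++-identityʳ (h n)) ⟨
      (List.concatMap h (List.upTo n) ++ (h n ++ [])) ++ acc
          ≡⟨ cong (_++ acc) (Listₚ.concatMap-++ h (List.upTo n) (n ∷ [])) ⟨
      List.concatMap h (List.upTo n List.∷ʳ n) ++ acc
          ≡⟨ cong (λ x → List.concatMap h x ++ acc) (Listₚ.upTo-∷ʳ n) ⟩
      List.concatMap h (List.upTo (suc n)) ++ acc                ∎

  mapUpToP : {Y : Set} {ey : Y → Tree} {n : A → ℕ} {f : A × ℕ → Y} → Poly i unary n →
             Poly j ey f → Poly i (encList ey) (λ a → List.map (λ m → f (a , m)) (List.upTo (n a)))
  mapUpToP {Y} {ey} {n} {f} nP p =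
    recode (λ a → cong (encList ey) (eq (λ m → f (a , m)) (List.upTo (n a))))
      (concatUpToP nP (consP p (constP [])))
    where
    eq : ∀ (h : ℕ → Y) ms → List.concatMap (λ m → h m ∷ []) ms ≡ List.map h ms
    eq h []       = refl
    eq h (m ∷ ms) = cong (h m ∷_) (eq h ms)

-- Binary numbers

encPair : {B C : Set} → (B → Tree) → (C → Tree) → B × C → Tree
encPair e e′ (b , c) = e b ∙ e′ c

module _ {A B C : Set} {i : A → Tree} {e : B → Tree} {e′ : C → Tree} where

  _⊗_ : {f : A → B} {g : A → C} → Poly i e f → Poly i e′ g → Poly i (encPair e e′) (λ a → f a , g a)
  p ⊗ q = recode (λ _ → refl) (pairP p q)

  fstP : {f : A → B × C} → Poly i (encPair e e′) f → Poly i e (proj₁ ∘ f)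
  fstP p = recode (λ _ → refl) (hdP p)

  sndP : {f : A → B × C} → Poly i (encPair e e′) f → Poly i e′ (proj₂ ∘ f)
  sndP p = recode (λ _ → refl) (tlP p)

  infixr 4 _⊗_

times : {S : Set} → (S → S) → ℕ → S → S
times f = downTo (λ _ → f)

times-comm : {S : Set} (f : S → S) → ∀ n s → times f n (f s) ≡ f (times f n s)
times-comm f zero    s = refl
times-comm f (suc n) s = times-comm f n (f s)

halfStep : Bool × ℕ → Bool × ℕ
halfStep (b , h) = not b , (if b then suc h else h)

halve : ℕ → Bool × ℕ
halve n = times halfStep n (false , 0)

bit : Bool → ℕ
bit b = if b then 1 else 0

unhalve : Bool × ℕ → ℕ
unhalve (b , h) = bit b + (h + h)

unhalve-halve : ∀ n → unhalve (halve n) ≡ n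
unhalve-halve zero    = refl
unhalve-halve (suc n) = begin
  unhalve (times halfStep n (halfStep (false , 0)))   ≡⟨ cong unhalve (times-comm halfStep n (false , 0)) ⟩
  unhalve (halfStep (halve n))                        ≡⟨ unhalve-step (halve n) ⟩
  suc (unhalve (halve n))                             ≡⟨ cong suc (unhalve-halve n) ⟩
  suc n                                               ∎
  where
  open ≡-Reasoning
  unhalve-step : ∀ s → unhalve (halfStep s) ≡ suc (unhalve s)
  unhalve-step (false , h) = refl
  unhalve-step (true  , h) = cong suc (+-suc h h)

half≤ : ∀ n → proj₂ (halve n) ≤ n
half≤ n = ≤-trans (≤-trans (m≤m+n h h) (m≤n+m (h + h) (bit (proj₁ (halve n)))))
                  (≤-reflexive (unhalve-halve n))
  where h = proj₂ (halve n)

size-unary : ∀ n → size (unary n) ≡ suc (n + n)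
size-unary zero    = refl
size-unary (suc n) = cong (2 +_) (trans (size-unary n) (sym (+-suc n n)))

size-unary-≤ : ∀ {m n} → m ≤ n → size (unary m) ≤ size (unary n)
size-unary-≤ {m} {n} m≤n rewrite size-unary m | size-unary n = s≤s (+-mono-≤ m≤n m≤n)

halveP : {A : Set} {i : A → Tree} {f : A → ℕ} → Poly i unary f → Poly i (encPair encBool unary) (halve ∘ f)
halveP {i = i} p = downToP (notP (fstP state) ⊗ ifP (fstP state) (sucP (sndP state)) (sndP state))
  (pb-const 4) (λ a m s → grow s) p (constP (false , 0))
  where
  state : Poly (counterInput i (encPair encBool unary)) (encPair encBool unary) _
  state = accP {i = i} {es = encPair encBool unary}
  grow : ∀ s → size (encPair encBool unary (halfStep s)) ≤ size (encPair encBool unary s) + 4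
  grow (false , h) = s≤s (≤-trans (≤-reflexive (+-comm 3 (size (unary h))))
    (≤-trans (+-monoʳ-≤ (size (unary h)) (n≤1+n 3)) (n≤1+n _)))
  grow (true  , h) = s≤s (m≤m+n _ 4)

bits : ℕᵇ → List Bool
bits ℕᵇ.zero  = []
bits 2[1+ b ] = false ∷ bits b
bits 1+[2 b ] = true ∷ bits b

encBits≡ : ∀ b → encList encBool (bits b) ≡ encBits b
encBits≡ ℕᵇ.zero  = refl
encBits≡ 2[1+ b ] = cong (nil ∙_) (encBits≡ b)
encBits≡ 1+[2 b ] = cong ((nil ∙ nil) ∙_) (encBits≡ b)

-- Binary digits by repeated halving: n + 1 has first digit 1 or 2
-- according as n is even or odd, and the others represent ⌊n/2⌋.

digits : ℕ → ℕ → List Bool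
digits w       zero    = []
digits zero    (suc n) = []
digits (suc w) (suc n) = not (proj₁ (halve n)) ∷ digits w (proj₂ (halve n))

value : List Bool → ℕ
value []       = 0
value (d ∷ ds) = (if d then 1 else 2) + (value ds + value ds)

value-digits : ∀ w n → n ≤ w → value (digits w n) ≡ n
value-digits w       zero    _         = refl
value-digits (suc w) (suc n) (s≤s n≤w) =
  trans (cong (λ v → (if not (proj₁ (halve n)) then 1 else 2) + (v + v))
              (value-digits w (proj₂ (halve n)) (≤-trans (half≤ n) n≤w)))
        (trans (lemma (halve n)) (cong suc (unhalve-halve n)))
  where
  lemma : ∀ s → (if not (proj₁ s) then 1 else 2) + (proj₂ s + proj₂ s) ≡ suc (unhalve s)
  lemma (false , h) = refl
  lemma (true  , h) = refl

value-bits : ∀ b → value (bits b) ≡ ℕᵇ.toℕ b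
value-bits ℕᵇ.zero  = refl
value-bits 2[1+ b ] rewrite value-bits b = lemma (ℕᵇ.toℕ b)
  where lemma : ∀ n → 2 + (n + n) ≡ 2 * suc n
        lemma = solve-∀
value-bits 1+[2 b ] rewrite value-bits b = lemma (ℕᵇ.toℕ b)
  where lemma : ∀ n → 1 + (n + n) ≡ suc (2 * n)
        lemma = solve-∀

fromBits : List Bool → ℕᵇ
fromBits []           = ℕᵇ.zero
fromBits (false ∷ ds) = 2[1+ fromBits ds ]
fromBits (true ∷ ds)  = 1+[2 fromBits ds ]

bits-fromBits : ∀ ds → bits (fromBits ds) ≡ ds
bits-fromBits []           = refl
bits-fromBits (false ∷ ds) = cong (false ∷_) (bits-fromBits ds)
bits-fromBits (true ∷ ds)  = cong (true ∷_) (bits-fromBits ds)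

-- Numeration with the digits 1 and 2 is unique, so it suffices that `digits n n` has the value `n`.
digits-binary : ∀ n → encList encBool (digits n n) ≡ binary n
digits-binary n = begin
  encList encBool ds                        ≡⟨ cong (encList encBool) (bits-fromBits ds) ⟨
  encList encBool (bits (fromBits ds))      ≡⟨ encBits≡ (fromBits ds) ⟩
  encBits (fromBits ds)                     ≡⟨ cong encBits (ℕᵇₚ.fromℕ-toℕ (fromBits ds)) ⟨
  binary (ℕᵇ.toℕ (fromBits ds))             ≡⟨ cong binary (value-bits (fromBits ds)) ⟨
  binary (value (bits (fromBits ds)))       ≡⟨ cong (binary ∘ value) (bits-fromBits ds) ⟩
  binary (value ds)                         ≡⟨ cong binary (value-digits n n ≤-refl) ⟩
  binary n                                  ∎
  where
  open ≡-Reasoning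
  ds = digits n n

binary-bits : ∀ n → binary n ≡ encList encBool (bits (ℕᵇ.fromℕ n))
binary-bits n = sym (encBits≡ (ℕᵇ.fromℕ n))

value-binary : ∀ n → value (bits (ℕᵇ.fromℕ n)) ≡ n
value-binary n = trans (value-bits (ℕᵇ.fromℕ n)) (ℕᵇₚ.toℕ-fromℕ n)

-- The iterative form of `digits`, which produces the digits in reverse order. It idles at 0, so any
-- number of rounds from `n` on gives the same result.
digitStep : ℕ × List Bool → ℕ × List Bool
digitStep (n , ds) =
  if isNode (unary n) then (proj₂ (halve (pred n)) , not (proj₁ (halve (pred n))) ∷ ds) else (n , ds)

times-digitStep : ∀ w n ds → n ≤ w →
  List.reverse (proj₂ (times digitStep w (n , ds))) ≡ List.reverse ds ++ digits w n
times-digitStep zero    zero    ds _ = sym (Listₚ.++-identityʳ _)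
times-digitStep (suc w) zero    ds _ = times-digitStep w zero ds z≤n
times-digitStep (suc w) (suc n) ds (s≤s n≤w) = begin
  _                                              ≡⟨ times-digitStep w h (d ∷ ds) (≤-trans (half≤ n) n≤w) ⟩
  List.reverse (d ∷ ds) ++ digits w h            ≡⟨ cong (_++ digits w h) (Listₚ.unfold-reverse d ds) ⟩
  (List.reverse ds List.∷ʳ d) ++ digits w h      ≡⟨ Listₚ.++-assoc (List.reverse ds) (d ∷ []) (digits w h) ⟩
  List.reverse ds ++ (d ∷ digits w h)            ∎
  where
  open ≡-Reasoning
  d = not (proj₁ (halve n))
  h = proj₂ (halve n)

size-encBool≤ : ∀ b → size (encBool b) ≤ 3
size-encBool≤ false = s≤s z≤n
size-encBool≤ true  = ≤-refl

binaryP : {A : Set} {i : A → Tree} {f : A → ℕ} → Poly i unary f → Poly i binary f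
binaryP {i = i} {f} p = recode (λ a → trans (cong (encList encBool) (times-digitStep (f a) (f a) [] ≤-refl))
    (digits-binary (f a)))
  (reverseP (sndP (downToP
    (ifP (isNodeP (fstP state)) (sndP half ⊗ consP (notP (fstP half)) (sndP state)) state)
    (pb-const 4) (λ a m s → grow s) p (p ⊗ constP []))))
  where
  es : ℕ × List Bool → Tree
  es = encPair unary (encList encBool)
  state : Poly (counterInput i es) es _
  state = accP {i = i} {es = es}
  half : Poly (counterInput i es) (encPair encBool unary) (λ (_ , _ , n , ds) → halve (pred n))
  half = halveP (predP (fstP state))
  grow : ∀ s → size (es (digitStep s)) ≤ size (es s) + 4
  grow (zero  , ds) = m≤m+n _ 4
  grow (suc n , ds) = s≤s (begin
    size (unary h) + suc (size (encBool d) + D)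
        ≤⟨ +-mono-≤ (size-unary-≤ (≤-trans (half≤ n) (n≤1+n n))) (s≤s (+-monoˡ-≤ D (size-encBool≤ d))) ⟩
    size (unary (suc n)) + (4 + D)                 ≡⟨ cong (size (unary (suc n)) +_) (+-comm 4 D) ⟩
    size (unary (suc n)) + (D + 4)                 ≡⟨ +-assoc (size (unary (suc n))) D 4 ⟨
    size (unary (suc n)) + D + 4                   ∎)
    where
    open ≤-Reasoning
    h = proj₂ (halve n)
    d = not (proj₁ (halve n))
    D = size (encList encBool ds)

-- Deciding p u ≤ q v for unary u, v without forming the products: compare
-- from the least significant digit on, with carries c and d on either side.

digitTimes : List Bool → ℕ → ℕ
digitTimes ds u = if isNode (encList encBool ds) then (if headOr false ds then u else u + u) else 0

Carries : Set
Carries = (List Bool × List Bool) × (ℕ × ℕ)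

module _ (u v : ℕ) where

  Compare : Carries → Set
  Compare ((ps , qs) , (c , d)) = value ps * u + c ≤ value qs * v + d

  -- In 2x + (b + 2h) ≤ 2y + (b′ + 2h′) the bits matter only for b = 1 and b′ = 0, where parity
  -- turns the inequality into x + h + 1 ≤ y + h′. Otherwise it is equivalent to x + h ≤ y + h′.
  nextCarries : Bool × ℕ → Bool × ℕ → ℕ × ℕ
  nextCarries (b , h) (b′ , h′) = (if b ∧ not b′ then suc h else h) , h′

  compareStep : Carries → Carries
  compareStep ((ps , qs) , (c , d)) =
    (List.drop 1 ps , List.drop 1 qs) , nextCarries (halve (digitTimes ps u + c)) (halve (digitTimes qs v + d))

  value-step : ∀ ps u c → value ps * u + c
             ≡ (value (List.drop 1 ps) * u + value (List.drop 1 ps) * u) + unhalve (halve (digitTimes ps u + c))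
  value-step ps u c rewrite unhalve-halve (digitTimes ps u + c) = digit ps
    where
    digit : ∀ ps → value ps * u + c
          ≡ (value (List.drop 1 ps) * u + value (List.drop 1 ps) * u) + (digitTimes ps u + c)
    digit []           = refl
    digit (true ∷ ps)  = lemma (value ps) u c
      where lemma : ∀ x u c → (1 + (x + x)) * u + c ≡ (x * u + x * u) + (u + c)
            lemma = solve-∀
    digit (false ∷ ps) = lemma (value ps) u c
      where lemma : ∀ x u c → (2 + (x + x)) * u + c ≡ (x * u + x * u) + ((u + u) + c)
            lemma = solve-∀

  ⌊⌋-cancel : ∀ {x y} b → x + x ≤ bit b + (y + y) → x ≤ y
  ⌊⌋-cancel {zero}          b le = z≤n
  ⌊⌋-cancel {suc x} {zero}  false ()
  ⌊⌋-cancel {suc x} {zero}  true  (s≤s le) with () ← subst (_≤ 0) (+-suc x x) le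
  ⌊⌋-cancel {suc x} {suc y} b le = s≤s (⌊⌋-cancel b (≤-pred (≤-pred
    (subst₂ _≤_ (cong suc (+-suc x x)) (shift b) le))))
    where
    shift : ∀ b → bit b + (suc y + suc y) ≡ suc (suc (bit b + (y + y)))
    shift false = cong suc (+-suc y y)
    shift true  = cong (2 +_) (+-suc y y)

  halves-to : ∀ x y s s′ → (x + x) + unhalve s ≤ (y + y) + unhalve s′ →
              x + proj₁ (nextCarries s s′) ≤ y + proj₂ (nextCarries s s′)
  halves-to x y (b , h) (b′ , h′) le = go b b′ le
    where
    re : ∀ x h k → (x + x) + (k + (h + h)) ≡ k + ((x + h) + (x + h))
    re = solve-∀
    re′ : ∀ x h → suc ((x + suc h) + (x + h)) ≡ (x + suc h) + (x + suc h)
    re′ = solve-∀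
    re″ : ∀ x h → (x + x) + (1 + (h + h)) ≡ (x + suc h) + (x + h)
    re″ = solve-∀
    go : ∀ b b′ → (x + x) + unhalve (b , h) ≤ (y + y) + unhalve (b′ , h′) →
         x + (if b ∧ not b′ then suc h else h) ≤ y + h′
    go false b′ le = ⌊⌋-cancel b′ (subst₂ _≤_ (re x h 0) (re y h′ (bit b′)) le)
    go true true le = ⌊⌋-cancel false (≤-pred (subst₂ _≤_ (re x h 1) (re y h′ 1) le))
    go true false le = ⌊⌋-cancel true (subst₂ _≤_ (trans (cong suc (re″ x h)) (re′ x h)) (cong suc (re y h′ 0)) (s≤s le))

  halves-from : ∀ x y s s′ → x + proj₁ (nextCarries s s′) ≤ y + proj₂ (nextCarries s s′) →
                (x + x) + unhalve s ≤ (y + y) + unhalve s′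
  halves-from x y (b , h) (b′ , h′) le = go b b′ le
    where
    re : ∀ x h k → (x + x) + (k + (h + h)) ≡ k + ((x + h) + (x + h))
    re = solve-∀
    re′ : ∀ x h → suc ((x + x) + (1 + (h + h))) ≡ (x + suc h) + (x + suc h)
    re′ = solve-∀
    go : ∀ b b′ → x + (if b ∧ not b′ then suc h else h) ≤ y + h′ →
         (x + x) + unhalve (b , h) ≤ (y + y) + unhalve (b′ , h′)
    go false b′ le = subst₂ _≤_ (sym (re x h 0)) (sym (re y h′ (bit b′))) (≤-trans (+-mono-≤ le le) (m≤n+m _ (bit b′)))
    go true true le = subst₂ _≤_ (sym (re x h 1)) (sym (re y h′ 1)) (s≤s (+-mono-≤ le le))
    go true false le = ≤-trans (n≤1+n _) (subst₂ _≤_ (sym (re′ x h)) (sym (re y h′ 0)) (+-mono-≤ le le))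

  compareStep-to : ∀ s → Compare s → Compare (compareStep s)
  compareStep-to ((ps , qs) , (c , d)) le =
    halves-to (value (List.drop 1 ps) * u) (value (List.drop 1 qs) * v) (halve (digitTimes ps u + c))
        (halve (digitTimes qs v + d)) (subst₂ _≤_ (value-step ps u c) (value-step qs v d) le)

  compareStep-from : ∀ s → Compare (compareStep s) → Compare s
  compareStep-from ((ps , qs) , (c , d)) le =
    subst₂ _≤_ (sym (value-step ps u c)) (sym (value-step qs v d)) (halves-from (value (List.drop 1 ps) * u)
        (value (List.drop 1 qs) * v) (halve (digitTimes ps u + c)) (halve (digitTimes qs v + d)) le)

  compare : List Bool → List Bool → Bool
  -- As many rounds as there are digits altogether exhaust both lists. Rounds on an exhausted list
  -- are harmless, because `compareStep` always yields an equivalent inequality.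
  compare ps qs = let (_ , (c , d)) = times compareStep (List.length (ps ++ qs)) ((ps , qs) , (0 , 0)) in c ≤ᵇ d

  times-lists : ∀ n s → proj₁ (times compareStep n s) ≡ (List.drop n (proj₁ (proj₁ s)) , List.drop n (proj₂ (proj₁ s)))
  times-lists zero    s = refl
  times-lists (suc n) s@((ps , qs) , _) =
    trans (times-lists n (compareStep s)) (cong₂ _,_ (drop-drop ps) (drop-drop qs))
    where
    drop-drop : (xs : List Bool) → List.drop n (List.drop 1 xs) ≡ List.drop (suc n) xs
    drop-drop []       = Listₚ.drop-[] n
    drop-drop (x ∷ xs) = refl

  times-to : ∀ n s → Compare s → Compare (times compareStep n s)
  times-to zero    s le = le
  times-to (suc n) s le = times-to n (compareStep s) (compareStep-to s le)

  times-from : ∀ n s → Compare (times compareStep n s) → Compare s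
  times-from zero    s le = le
  times-from (suc n) s le = compareStep-from s (times-from n (compareStep s) le)

  module _ (ps qs : List Bool) where

    private
      n = List.length (ps ++ qs)
      end = times compareStep n ((ps , qs) , (0 , 0))

      exhausted : proj₁ end ≡ ([] , [])
      exhausted = trans (times-lists n _) (cong₂ _,_
        (Listₚ.drop-all n ps (≤-trans (m≤m+n _ _) (≤-reflexive (sym (Listₚ.length-++ ps)))))
        (Listₚ.drop-all n qs (≤-trans (m≤n+m _ _) (≤-reflexive (sym (Listₚ.length-++ ps))))))

      end≡ : ∀ l → l ≡ ([] , []) → ∀ c d → Compare (l , (c , d)) ≡ (c ≤ d)
      end≡ _ refl c d = refl

    compare-sound : compare ps qs ≡ true → value ps * u ≤ value qs * v
    compare-sound eq = subst₂ _≤_ (+-identityʳ _) (+-identityʳ _)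
      (times-from n ((ps , qs) , (0 , 0)) (subst id (sym (end≡ _ exhausted _ _)) (≤ᵇ⇒≤ _ _ (subst T (sym eq) tt))))

    compare-complete : value ps * u ≤ value qs * v → compare ps qs ≡ true
    compare-complete le = Equivalence.to T-≡ (≤⇒≤ᵇ (subst id (end≡ _ exhausted _ _)
      (times-to n ((ps , qs) , (0 , 0)) (subst₂ _≤_ (sym (+-identityʳ _)) (sym (+-identityʳ _)) le))))

lengthP : {A X : Set} {i : A → Tree} {ex : X → Tree} {f : A → List X} →
          Poly i (encList ex) f → Poly i unary (List.length ∘ f)
lengthP {X = X} {i} {ex} {f} p = recode (λ a → cong unary (trans (eq (f a) 0) (+-identityʳ _)))
  (loopP (λ a x _ s → suc s) (sucP stateP) p (constP 0) (additive p (constP 0) record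
    { gain = const 2 ; gainPB = pb-const 2 ; grow = λ a x xs s → ≤-reflexive (+-comm 2 (size (unary s))) }))
  where
  eq : ∀ (xs : List X) n → iter (λ x _ s → suc s) xs n ≡ List.length xs + n
  eq []       n = refl
  eq (x ∷ xs) n = trans (eq xs (suc n)) (+-suc (List.length xs) n)

compareP : {A : Set} {i : A → Tree} {u v : A → ℕ} {ps qs : A → List Bool} →
           Poly i unary u → Poly i unary v → Poly i (encList encBool) ps → Poly i (encList encBool) qs →
           Poly i encBool (λ a → compare (u a) (v a) (ps a) (qs a))
compareP {A} {i} {u} {v} uP vP pP qP = leqP (fstP (sndP end)) (sndP (sndP end))
  where
  eb = encList encBool
  es : Carries → Tree
  es = encPair (encPair eb eb) (encPair unary unary)
  state : Poly (counterInput i es) es _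
  state = accP {i = i} {es = es}
  out : {B : Set} {e : B → Tree} {f : A → B} → Poly i e f → Poly (counterInput i es) e (f ∘ proj₁)
  out p = outsideP (weakenP p)
  digitTimesP : {A : Set} {i : A → Tree} {ds : A → List Bool} {u : A → ℕ} → Poly i eb ds → Poly i unary u →
                Poly i unary (λ a → digitTimes (ds a) (u a))
  digitTimesP p q = ifP (isNodeP p) (ifP (headOrP {ex = encBool} false refl p) q (addP q q)) (constP 0)
  left = halveP (addP (digitTimesP (fstP (fstP state)) (out uP)) (fstP (sndP state)))
  right = halveP (addP (digitTimesP (sndP (fstP state)) (out vP)) (sndP (sndP state)))
  step = (dropHeadP (fstP (fstP state)) ⊗ dropHeadP (sndP (fstP state)))
         ⊗ (ifP (andP (fstP left) (notP (fstP right))) (sucP (sndP left)) (sndP left) ⊗ sndP right)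
  digit≤ : ∀ ds u → digitTimes ds u ≤ u + u
  digit≤ []           u = z≤n
  digit≤ (true ∷ ds)  u = m≤m+n u u
  digit≤ (false ∷ ds) u = ≤-refl
  half-size : ∀ ds u c x → x ≤ suc (proj₂ (halve (digitTimes ds u + c))) → size (unary x) ≤ size (unary c) + (4 * u + 2)
  half-size ds u c x x≤ = ≤-trans (size-unary-≤ (≤-trans x≤ (s≤s (≤-trans (half≤ _) (+-monoˡ-≤ c (digit≤ ds u))))))
    (≤-reflexive (trans (size-unary (suc ((u + u) + c))) (trans (lemma u c)
        (cong (_+ (4 * u + 2)) (sym (size-unary c))))))
    where lemma : ∀ u c → suc (suc ((u + u) + c) + suc ((u + u) + c)) ≡ suc (c + c) + (4 * u + 2)
          lemma = solve-∀
  carry≤ : ∀ s s′ → proj₁ (nextCarries 0 0 s s′) ≤ suc (proj₂ s)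
  carry≤ (false , h) s′ = n≤1+n h
  carry≤ (true , h) (false , h′) = ≤-refl
  carry≤ (true , h) (true , h′) = n≤1+n h
  -- In one round a carry grows by at most a term linear in `u a` or `v a`, so the carries can be
  -- kept in unary.
  grow : ∀ a s → size (es (compareStep (u a) (v a) s)) ≤ size (es s) + ((4 * u a + 2) + (4 * v a + 2))
  grow a ((ps , qs) , (c , d)) = ≤-trans
    (s≤s (+-mono-≤ (s≤s (+-mono-≤ (size-drop encBool ps) (size-drop encBool qs)))
       (s≤s (+-mono-≤ (half-size ps (u a) c _ (carry≤ (halve (digitTimes ps (u a) + c))
           (halve (digitTimes qs (v a) + d))))
                      (half-size qs (v a) d _ (n≤1+n _))))))
    (≤-reflexive (lemma (size (encPair eb eb (ps , qs))) (size (unary c)) (size (unary d)) (4 * u a + 2) (4 * v a + 2)))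
    where lemma : ∀ p c d x y → suc (p + suc ((c + x) + (d + y))) ≡ suc (p + suc (c + d)) + (x + y)
          lemma = solve-∀
  linear : {f : A → ℕ} → Poly i unary f → PolyBound (λ ((a , m) : A × ℕ) → unary m ∙ i a) (λ (a , m) → 4 * f a + 2)
  linear {f} p = pb-+ (pb-* (pb-const 4) (pb-≤ (λ (a , m) → f≤ (f a)) (sizePB (weakenP {e = unary} p)))) (pb-const 2)
    where f≤ : ∀ n → n ≤ size (unary n)
          f≤ n = ≤-trans (m≤m+n n n) (≤-trans (n≤1+n _) (≤-reflexive (sym (size-unary n))))
  end = downToP {st = λ a _ → compareStep (u a) (v a)} step (pb-+ (linear uP) (linear vP)) (λ a m s → grow a s)
          (lengthP (appendP pP qP)) ((pP ⊗ qP) ⊗ constP (0 , 0))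

-- Subsets and neighbourhoods

∈⇒lookup : ∀ {n} {p : Subset n} {x} → x ∈ p → lookup p x ≡ true
∈⇒lookup = Vecₚ.[]=⇒lookup

lookup⇒∈ : ∀ {n} {p : Subset n} {x} → lookup p x ≡ true → x ∈ p
lookup⇒∈ {p = p} {x} = Vecₚ.lookup⇒[]= x p

enum : ∀ {n} (p : Subset n) → Fin ∣ p ∣ → Fin n
enum (true  ∷ p) zero    = zero
enum (true  ∷ p) (suc x) = suc (enum p x)
enum (false ∷ p) x       = suc (enum p x)

lookup-enum : ∀ {n} (p : Subset n) x → lookup p (enum p x) ≡ true
lookup-enum (true  ∷ p) zero    = refl
lookup-enum (true  ∷ p) (suc x) = lookup-enum p x
lookup-enum (false ∷ p) x       = lookup-enum p x

enum-injective : ∀ {n} (p : Subset n) → Injective _≡_ _≡_ (enum p)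
enum-injective (true  ∷ p) {zero}  {zero}  eq = refl
enum-injective (true  ∷ p) {suc x} {suc y} eq = cong suc (enum-injective p (Finₚ.suc-injective eq))
enum-injective (false ∷ p) eq = enum-injective p (Finₚ.suc-injective eq)

enum-surjective : ∀ {n} (p : Subset n) i → lookup p i ≡ true → ∃[ x ] enum p x ≡ i
enum-surjective (true  ∷ p) zero    eq = zero , refl
enum-surjective (true  ∷ p) (suc i) eq = let (x , e) = enum-surjective p i eq in suc x , cong suc e
enum-surjective (false ∷ p) (suc i) eq = let (x , e) = enum-surjective p i eq in x , cong suc e

-- All cardinalities are compared in this way. The type `E` is arbitrary, so that the two families
-- may be indexed differently and compared as edges, vertices or numbers.
covered⇒≤ : ∀ {E : Set} {j m} (g : Fin j → E) (h : Fin m → E) → Injective _≡_ _≡_ g →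
            (∀ r → ∃[ x ] h x ≡ g r) → j ≤ m
covered⇒≤ g h g-inj cover = Finₚ.injective⇒≤ {f = proj₁ ∘ cover} λ {r} {r′} eq →
  g-inj (trans (sym (proj₂ (cover r))) (trans (cong h eq) (proj₂ (cover r′))))

members⇒≤ : ∀ {n m} (p : Subset n) (h : Fin m → Fin n) → Injective _≡_ _≡_ h →
            (∀ x → lookup p (h x) ≡ true) → m ≤ ∣ p ∣
members⇒≤ p h h-inj h∈ = covered⇒≤ h (enum p) h-inj (λ x → enum-surjective p (h x) (h∈ x))

members≤ : ∀ {n m} (p : Subset n) (h : Fin m → Fin n) →
           (∀ i → lookup p i ≡ true → ∃[ x ] h x ≡ i) → ∣ p ∣ ≤ m
members≤ p h cover = covered⇒≤ (enum p) h (enum-injective p) (λ x → cover (enum p x) (lookup-enum p x))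

lookup-∁ : ∀ {n} (p : Subset n) i → lookup (∁ p) i ≡ not (lookup p i)
lookup-∁ p i = Vecₚ.lookup-map i not p

not-true : ∀ {b} → not b ≡ true → b ≡ false
not-true {false} _ = refl

true≢false : ∀ {b} → b ≡ true → b ≡ false → ⊥
true≢false {true} _ ()
true≢false {false} ()

∣∁∣+∣∣ : ∀ {n} (p : Subset n) → ∣ ∁ p ∣ + ∣ p ∣ ≡ n
∣∁∣+∣∣ []          = refl
∣∁∣+∣∣ (true  ∷ p) = trans (+-suc _ _) (cong suc (∣∁∣+∣∣ p))
∣∁∣+∣∣ (false ∷ p) = cong suc (∣∁∣+∣∣ p)

_⊆ᵇ_ : ∀ {n} → Subset n → Subset n → Bool
[]      ⊆ᵇ []      = true
(x ∷ p) ⊆ᵇ (y ∷ q) = (not x ∨ y) ∧ (p ⊆ᵇ q)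

⊆ᵇ-sound : ∀ {n} (p q : Subset n) → (p ⊆ᵇ q) ≡ true → ∀ i → lookup p i ≡ true → lookup q i ≡ true
⊆ᵇ-sound (true  ∷ p) (true ∷ q) eq zero    _  = refl
⊆ᵇ-sound (true  ∷ p) (true ∷ q) eq (suc i) pi = ⊆ᵇ-sound p q eq i pi
⊆ᵇ-sound (false ∷ p) (y ∷ q)    eq (suc i) pi = ⊆ᵇ-sound p q eq i pi

⊆ᵇ-complete : ∀ {n} (p q : Subset n) → (∀ i → lookup p i ≡ true → lookup q i ≡ true) → (p ⊆ᵇ q) ≡ true
⊆ᵇ-complete []          []      _ = refl
⊆ᵇ-complete (true  ∷ p) (y ∷ q) h rewrite h zero refl = ⊆ᵇ-complete p q (h ∘ suc)
⊆ᵇ-complete (false ∷ p) (y ∷ q) h = ⊆ᵇ-complete p q (h ∘ suc)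

⊈ᵇ-witness : ∀ {n} (p q : Subset n) → (p ⊆ᵇ q) ≡ false → ∃[ i ] lookup p i ≡ true × lookup q i ≡ false
⊈ᵇ-witness [] [] ()
⊈ᵇ-witness (true  ∷ p) (false ∷ q) eq = zero , refl , refl
⊈ᵇ-witness (true  ∷ p) (true ∷ q)  eq = let (i , h) = ⊈ᵇ-witness p q eq in suc i , h
⊈ᵇ-witness (false ∷ p) (y ∷ q)     eq = let (i , h) = ⊈ᵇ-witness p q eq in suc i , h

∣∣-mono : ∀ {n} (p q : Subset n) → (∀ i → lookup p i ≡ true → lookup q i ≡ true) → ∣ p ∣ ≤ ∣ q ∣
∣∣-mono p q h = members⇒≤ q (enum p) (enum-injective p) (λ x → h (enum p x) (lookup-enum p x))

-- The same term as `Γ`, freed from the SSVE instance so that it applies to the padded graph as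
-- well.
neighbours : ∀ {m n} → Vec (Subset n) m → Subset m → Subset n
neighbours {m} adj S = Subset.⋃ (List.map (lookup adj) (List.filter (Subsetₚ._∈? S) (List.allFin m)))

module _ {m n} (adj : Vec (Subset n) m) (S : Subset m) where

  neighbour : ∀ w i → lookup S w ≡ true → lookup (lookup adj w) i ≡ true → lookup (neighbours adj S) i ≡ true
  neighbour w i Sw wi = ∈⇒lookup (∈⋃ _ (List∈ₚ.∈-map⁺ (lookup adj)
    (List∈ₚ.∈-filter⁺ (Subsetₚ._∈? S) (List∈ₚ.∈-allFin w) (lookup⇒∈ Sw))) (lookup⇒∈ wi))
    where
    ∈⋃ : ∀ ps {p} → p List∈.∈ ps → i ∈ p → i ∈ Subset.⋃ ps
    ∈⋃ (p ∷ ps) (here refl) i∈ = Subsetₚ.x∈p∪q⁺ (inj₁ i∈)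
    ∈⋃ (p ∷ ps) (there q∈)  i∈ = Subsetₚ.x∈p∪q⁺ {p = p} (inj₂ (∈⋃ ps q∈ i∈))

  neighbour⁻¹ : ∀ i → lookup (neighbours adj S) i ≡ true →
                ∃[ w ] lookup S w ≡ true × lookup (lookup adj w) i ≡ true
  neighbour⁻¹ i ni with ⋃∋ _ (lookup⇒∈ ni)
    where
    ⋃∋ : ∀ ps → i ∈ Subset.⋃ ps → ∃[ p ] p List∈.∈ ps × i ∈ p
    ⋃∋ []       i∈ = contradiction i∈ Subsetₚ.∉⊥
    ⋃∋ (p ∷ ps) i∈ with Subsetₚ.x∈p∪q⁻ p (Subset.⋃ ps) i∈
    ... | inj₁ i∈p = p , here refl , i∈p
    ... | inj₂ i∈⋃ = let (q , q∈ , i∈q) = ⋃∋ ps i∈⋃ in q , there q∈ , i∈q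
  ... | p , p∈ , i∈p with List∈ₚ.∈-map⁻ (lookup adj) p∈
  ... | w , w∈ , refl = w , ∈⇒lookup (proj₂ (List∈ₚ.∈-filter⁻ (Subsetₚ._∈? S) {xs = List.allFin m} w∈)) , ∈⇒lookup i∈p

-- The k-route instance

-- Between n left and n right vertices, a set S of left vertices with
-- |direct| ≤ |S| and few neighbours is sought.

record Square : Set where
  field
    n      : ℕ
    adj    : Vec (Subset n) n
    direct : Subset n

-- Every pair and every left vertex has its slots whatever the graph is. `ends` decides whether a
-- `pair` or a `slot` takes part or is diverted to the auxiliary nodes, so the numbering of the
-- edges does not depend on the graph.
data Slot (n N : ℕ) : Set where
  bundle : Fin n → Fin N → Slot n N
  unit   : Fin n → Slot n N
  slot   : Fin n → Slot n N
  pair   : Fin n → Fin n → Fin 3 → Slot n N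

slots : ℕ → ℕ → ℕ
slots n N = n * N + (n + (n + n * (n * 3)))

module _ {n N : ℕ} where

  encodeSlot : Slot n N → Fin (slots n N)
  encodeSlot (bundle i c) = combine i c ↑ˡ _
  encodeSlot (unit w)     = (n * N) ↑ʳ (w ↑ˡ _)
  encodeSlot (slot w)     = (n * N) ↑ʳ (n ↑ʳ (w ↑ˡ _))
  encodeSlot (pair w i c) = (n * N) ↑ʳ (n ↑ʳ (n ↑ʳ combine w (combine i c)))

  private
    bundleOf : Fin (n * N) → Slot n N
    bundleOf x = let (i , c) = remQuot N x in bundle i c

    pairOf : Fin (n * (n * 3)) → Slot n N
    pairOf x = let (w , y) = remQuot (n * 3) x ; (i , c) = remQuot 3 y in pair w i c

  decodeSlot : Fin (slots n N) → Slot n N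
  decodeSlot x with splitAt (n * N) x
  ... | inj₁ y = bundleOf y
  ... | inj₂ y with splitAt n y
  ... | inj₁ w = unit w
  ... | inj₂ z with splitAt n z
  ... | inj₁ w = slot w
  ... | inj₂ u = pairOf u

  decode-encode : ∀ sl → decodeSlot (encodeSlot sl) ≡ sl
  decode-encode (bundle i c)
    rewrite Finₚ.splitAt-↑ˡ (n * N) (combine i c) (n + (n + n * (n * 3))) =
    cong (λ (i , c) → bundle i c) (Finₚ.remQuot-combine i c)
  decode-encode (unit w)
    rewrite Finₚ.splitAt-↑ʳ (n * N) (n + (n + n * (n * 3))) (w ↑ˡ (n + n * (n * 3)))
          | Finₚ.splitAt-↑ˡ n w (n + n * (n * 3)) = refl
  decode-encode (slot w)
    rewrite Finₚ.splitAt-↑ʳ (n * N) (n + (n + n * (n * 3))) (n ↑ʳ (w ↑ˡ (n * (n * 3))))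
          | Finₚ.splitAt-↑ʳ n (n + n * (n * 3)) (w ↑ˡ (n * (n * 3)))
          | Finₚ.splitAt-↑ˡ n w (n * (n * 3)) = refl
  decode-encode (pair w i c)
    rewrite Finₚ.splitAt-↑ʳ (n * N) (n + (n + n * (n * 3))) (n ↑ʳ (n ↑ʳ combine w (combine i c)))
          | Finₚ.splitAt-↑ʳ n (n + n * (n * 3)) (n ↑ʳ combine w (combine i c))
          | Finₚ.splitAt-↑ʳ n (n * (n * 3)) (combine w (combine i c)) =
    trans (cong (λ (w , y) → let (i , c) = remQuot 3 y in pair w i c) (Finₚ.remQuot-combine w (combine i c)))
          (cong (λ (i , c) → pair w i c) (Finₚ.remQuot-combine i c))

  encode-decode : ∀ x → encodeSlot (decodeSlot x) ≡ x
  encode-decode x with splitAt (n * N) x | Finₚ.join-splitAt (n * N) (n + (n + n * (n * 3))) x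
  ... | inj₁ y | refl = cong (_↑ˡ _) (Finₚ.combine-remQuot {n} N y)
  ... | inj₂ y | refl with splitAt n y | Finₚ.join-splitAt n (n + n * (n * 3)) y
  ... | inj₁ w | refl = refl
  ... | inj₂ z | refl with splitAt n z | Finₚ.join-splitAt n (n * (n * 3)) z
  ... | inj₁ w | refl = refl
  ... | inj₂ u | refl = cong (λ v → (n * N) ↑ʳ (n ↑ʳ (n ↑ʳ v)))
    (trans (cong (combine (proj₁ (remQuot {n} (n * 3) u))) (Finₚ.combine-remQuot {n} 3 (proj₂ (remQuot {n} (n * 3) u))))
           (Finₚ.combine-remQuot {n} (n * 3) u))

-- The nodes of a block are its source P, the left and right vertices, and two
-- nodes for the edges that should not depend on S.  The sink of block j is the
-- source of block j + 1.

data Local (n : ℕ) : Set where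
  P Z₁ Z₂ : Local n
  L R     : Fin n → Local n

module _ {n : ℕ} where

  encodeLocal : Local n → Fin (3 + (n + n))
  encodeLocal P     = zero
  encodeLocal Z₁    = suc zero
  encodeLocal Z₂    = suc (suc zero)
  encodeLocal (L w) = suc (suc (suc (w ↑ˡ n)))
  encodeLocal (R i) = suc (suc (suc (n ↑ʳ i)))

  decodeLocal : Fin (3 + (n + n)) → Local n
  decodeLocal zero                = P
  decodeLocal (suc zero)          = Z₁
  decodeLocal (suc (suc zero))    = Z₂
  decodeLocal (suc (suc (suc x))) with splitAt n x
  ... | inj₁ w = L w
  ... | inj₂ i = R i

  decode-encodeLocal : ∀ x → decodeLocal (encodeLocal x) ≡ x
  decode-encodeLocal P     = refl
  decode-encodeLocal Z₁    = refl
  decode-encodeLocal Z₂    = refl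
  decode-encodeLocal (L w) rewrite Finₚ.splitAt-↑ˡ n w n = refl
  decode-encodeLocal (R i) rewrite Finₚ.splitAt-↑ʳ n n i = refl

module Construction (Q : Square) where

  open Square Q public

  N : ℕ
  N = n ^ 3

  -- The n + 1 blocks have n + 1 sources, and the final sink is the `P` with block number n + 1; the
  -- other nodes with that number are isolated. Block n leaves out no vertex; with it there is a
  -- block, and `s` differs from `t`, even for n = 0.
  Nd : Set
  Nd = Fin (2 + n) × Local n

  node : Nd → Fin ((2 + n) * (3 + (n + n)))
  node (b , x) = combine b (encodeLocal x)

  unnode : Fin ((2 + n) * (3 + (n + n))) → Nd
  unnode y = let (b , x) = remQuot (3 + (n + n)) y in b , decodeLocal x

  unnode-node : ∀ v → unnode (node v) ≡ v
  unnode-node (b , x) = trans (cong (λ (b , y) → b , decodeLocal y) (Finₚ.remQuot-combine b (encodeLocal x)))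
                              (cong (b ,_) (decode-encodeLocal x))

  node-injective : ∀ {u v} → node u ≡ node v → u ≡ v
  node-injective {u} {v} eq = trans (sym (unnode-node u)) (trans (cong unnode eq) (unnode-node v))

  -- Block j ignores the right vertex j.
  active : Fin (suc n) → Fin n → Fin n → Bool
  active j w i = lookup (lookup adj w) i ∧ not (toℕ i ≡ᵇ toℕ j)

  endsPair : Bool → Fin n → Fin n → Fin 3 → Fin (suc n) → Nd × Nd
  endsPair true  w i zero             j = (inject₁ j , P) , (inject₁ j , R i)
  endsPair true  w i (suc zero)       j = (inject₁ j , R i) , (inject₁ j , L w)
  endsPair true  w i (suc (suc zero)) j = (inject₁ j , L w) , (suc j , P)
  endsPair false w i zero             j = (inject₁ j , P) , (inject₁ j , Z₂)
  endsPair false w i (suc zero)       j = (inject₁ j , Z₂) , (inject₁ j , Z₁)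
  endsPair false w i (suc (suc zero)) j = (inject₁ j , Z₁) , (suc j , P)

  endsSlot : Bool → Fin (suc n) → Nd × Nd
  endsSlot true  j = (inject₁ j , P) , (suc j , P)
  endsSlot false j = (inject₁ j , Z₁) , (inject₁ j , Z₂)

  ends : Fin (suc n) → Slot n N → Nd × Nd
  ends j (bundle i c) = (inject₁ j , R i) , (suc j , P)
  ends j (unit w)     = (inject₁ j , P) , (inject₁ j , L w)
  ends j (slot w)     = endsSlot (lookup direct w) j
  ends j (pair w i c) = endsPair (active j w i) w i c j

  inject₁≢suc : ∀ {m} (j : Fin m) → inject₁ j ≢ suc j
  inject₁≢suc j eq = 1+n≢n (sym (trans (sym (Finₚ.toℕ-inject₁ j)) (cong toℕ eq)))

  local≢ : ∀ {b b′ : Fin (2 + n)} {x y : Local n} → x ≢ y → (b , x) ≢ (b′ , y)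
  local≢ x≢y eq = x≢y (cong proj₂ eq)

  ends-distinct : ∀ j sl → proj₁ (ends j sl) ≢ proj₂ (ends j sl)
  ends-distinct j (bundle i c) = local≢ λ ()
  ends-distinct j (unit w)     = local≢ λ ()
  ends-distinct j (slot w) with lookup direct w
  ... | true  = λ eq → inject₁≢suc j (cong proj₁ eq)
  ... | false = local≢ λ ()
  ends-distinct j (pair w i c) with active j w i | c
  ... | true  | zero           = local≢ λ ()
  ... | true  | suc zero       = local≢ λ ()
  ... | true  | suc (suc zero) = local≢ λ ()
  ... | false | zero           = local≢ λ ()
  ... | false | suc zero       = local≢ λ ()
  ... | false | suc (suc zero) = local≢ λ ()

  costOf : Slot n N → ℚ ⁺
  costOf (bundle i c) = [ 1ℚ ]
  costOf _            = ⊤⁺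

  cost≥0 : ∀ sl → [ 0ℚ ] ≤∞ costOf sl
  cost≥0 (bundle i c) = Supₚ.[ ℚₚ.nonNegative⁻¹ 1ℚ ]
  cost≥0 (unit w)     = [ 0ℚ ] Supₚ.≤⊤⁺
  cost≥0 (slot w)     = [ 0ℚ ] Supₚ.≤⊤⁺
  cost≥0 (pair w i c) = [ 0ℚ ] Supₚ.≤⊤⁺

  size-E : ℕ
  size-E = suc n * slots n N

  index : Fin (suc n) → Slot n N → Fin size-E
  index j sl = combine j (encodeSlot sl)

  unindex : Fin size-E → Fin (suc n) × Slot n N
  unindex e = let (j , x) = remQuot (slots n N) e in j , decodeSlot x

  unindex-index : ∀ j sl → unindex (index j sl) ≡ (j , sl)
  unindex-index j sl = trans (cong (λ (j , x) → j , decodeSlot x) (Finₚ.remQuot-combine j (encodeSlot sl)))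
                             (cong (j ,_) (decode-encode sl))

  index-unindex : ∀ e → uncurry index (unindex e) ≡ e
  index-unindex e = trans (cong (combine (proj₁ (remQuot {suc n} (slots n N) e))) (encode-decode {n} {N} _))
                          (Finₚ.combine-remQuot {suc n} (slots n N) e)

  indexed : ∀ e → ∃[ j ] ∃[ sl ] index j sl ≡ e
  indexed e = proj₁ (unindex e) , proj₂ (unindex e) , index-unindex e

  index-injective : ∀ {j sl j′ sl′} → index j sl ≡ index j′ sl′ → (j , sl) ≡ (j′ , sl′)
  index-injective {j} {sl} {j′} {sl′} eq =
    trans (sym (unindex-index j sl)) (trans (cong unindex eq) (unindex-index j′ sl′))

  edgeAt : Fin (suc n) × Slot n N → Edge ((2 + n) * (3 + (n + n)))
  edgeAt (j , sl) = record
    { end₁ = node (proj₁ (ends j sl)) ; end₂ = node (proj₂ (ends j sl))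
    ; loopless = ends-distinct j sl ∘ node-injective
    ; cost = costOf sl ; cost≥0 = cost≥0 sl }

  -- One edge for each of the n² triples, and n because |∁ S| + |direct| ≤ |∁ S| + |S| = n for a
  -- large set S.
  routes : ℕ
  routes = n * n + n

  instance′ : KRouteInstance
  instance′ = record
    { nodes = (2 + n) * (3 + (n + n)) ; edges = size-E
    ; edge = tabulate (edgeAt ∘ unindex)
    ; s = node (zero , P) ; t = node (fromℕ (suc n) , P)
    ; s≢t = λ eq → zero≢suc (cong proj₁ (node-injective eq))
    ; k = suc routes ; k≥1 = s≤s z≤n }
    where
    zero≢suc : zero ≢ fromℕ (suc n)
    zero≢suc ()

  open KRouteInstance instance′ public using (Walk; stop; step; Joins; visited; used; IsPath;
      EdgeDisjointPaths; IsKRouteCut; totalCost)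

  lookup-edge : ∀ j sl → lookup (KRouteInstance.edge instance′) (index j sl) ≡ edgeAt (j , sl)
  lookup-edge j sl = trans (Vecₚ.lookup∘tabulate (edgeAt ∘ unindex) (index j sl)) (cong edgeAt (unindex-index j sl))

≡ᵇ-true : ∀ {m k} → (m ≡ᵇ k) ≡ true → m ≡ k
≡ᵇ-true {m} {k} eq = ≡ᵇ⇒≡ m k (subst T (sym eq) tt)

≡ᵇ-false : ∀ {m k} → (m ≡ᵇ k) ≡ false → m ≢ k
≡ᵇ-false {m} eq refl = true≢false (Equivalence.to T-≡ (≡⇒≡ᵇ m m refl)) eq

∧-true : ∀ {a b} → a ∧ b ≡ true → a ≡ true × b ≡ true
∧-true {true} {true} _ = refl , refl

∧-intro : ∀ {a b} → a ≡ true → b ≡ true → a ∧ b ≡ true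
∧-intro refl refl = refl

-- A cheap cut from a large set

module Crossing (Q : Square) where

  open Construction Q

  walk-crosses : (σ : Nd → Bool) → ∀ {u v} (p : Walk u v) → σ (unnode u) ≡ true → σ (unnode v) ≡ false →
    ∃[ j ] ∃[ sl ] index j sl List∈.∈ used p × σ (proj₁ (ends j sl)) ≢ σ (proj₂ (ends j sl))
  walk-crosses σ stop σu σv = ⊥-elim (true≢false σu σv)
  walk-crosses σ (step {u} {v} e joins p) σu σw with σ (unnode v) in σv
  ... | true  = let (j , sl , e∈ , c) = walk-crosses σ p σv σw in j , sl , there e∈ , c
  ... | false with indexed e
  ... | j , sl , refl rewrite lookup-edge j sl = j , sl , here refl , differ joins
    where
    differ : _ → σ (proj₁ (ends j sl)) ≢ σ (proj₂ (ends j sl))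
    differ (inj₁ (refl , refl)) eq
      rewrite unnode-node (proj₁ (ends j sl)) | unnode-node (proj₂ (ends j sl)) = true≢false (trans (sym eq) σu) σv
    differ (inj₂ (refl , refl)) eq
      rewrite unnode-node (proj₁ (ends j sl)) | unnode-node (proj₂ (ends j sl)) = true≢false (trans eq σu) σv

  -- Each path crosses from the side of the source to that of the sink, and disjoint paths do so at
  -- different edges. Hence `h` has to enumerate only the crossing edges outside `F`.
  paths≤cut : (σ : Nd → Bool) → σ (zero , P) ≡ true → σ (fromℕ (suc n) , P) ≡ false →
    ∀ F {m r} (h : Fin m → Fin size-E) →
    (∀ j sl → lookup F (index j sl) ≡ false → σ (proj₁ (ends j sl)) ≢ σ (proj₂ (ends j sl)) → ∃[ x ] h x ≡ index j sl) →
    EdgeDisjointPaths F r → r ≤ m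
  paths≤cut σ σs σt F {r = r} h cover D = covered⇒≤ crossed h crossed-injective λ x →
    let (j , sl , e∈ , c) = crossing x in cover j sl (avoided x e∈) c
    where
    open EdgeDisjointPaths D
    crossing : ∀ x → _
    crossing x = walk-crosses σ (path x) (trans (cong σ (unnode-node (zero , P))) σs)
                                         (trans (cong σ (unnode-node (fromℕ (suc n) , P))) σt)
    crossed : Fin r → Fin size-E
    crossed x = let (j , sl , _) = crossing x in index j sl
    avoided : ∀ x {e} → e List∈.∈ used (path x) → lookup F e ≡ false
    avoided x {e} e∈ with lookup F e in eq
    ... | false = refl
    ... | true  = contradiction (lookup⇒∈ eq) (All.lookup (avoids x) e∈)
    crossed-injective : Injective _≡_ _≡_ crossed
    crossed-injective {x} {y} eq with x Finₚ.≟ y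
    ... | yes x≡y = x≡y
    ... | no  x≢y = ⊥-elim (disjoint x≢y
      (proj₁ (proj₂ (proj₂ (crossing x))) , subst (List∈._∈ used (path y)) (sym eq) (proj₁ (proj₂ (proj₂ (crossing y))))))

module Upper (Q : Square) (S : Subset (Square.n Q)) (S-large : ∣ Square.direct Q ∣ ≤ ∣ S ∣)
             (v₀ : Fin (Square.n Q)) (v₀∈ : lookup (neighbours (Square.adj Q) S) v₀ ≡ true) where

  open Construction Q
  open Crossing Q

  Nb rest : Subset n
  Nb   = neighbours adj S
  rest = tabulate (λ i → lookup Nb i ∧ not (toℕ i ≡ᵇ toℕ v₀))

  rest⁻ : ∀ {i} → lookup rest i ≡ true → lookup Nb i ≡ true × not (toℕ i ≡ᵇ toℕ v₀) ≡ true
  rest⁻ {i} eq = ∧-true (trans (sym (Vecₚ.lookup∘tabulate _ i)) eq)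

  rest⁺ : ∀ {i} → lookup Nb i ≡ true → not (toℕ i ≡ᵇ toℕ v₀) ≡ true → lookup rest i ≡ true
  rest⁺ {i} p q = trans (Vecₚ.lookup∘tabulate _ i) (∧-intro p q)

  ∣rest∣< : suc ∣ rest ∣ ≤ ∣ Nb ∣
  ∣rest∣< = members⇒≤ Nb h h-injective h∈
    where
    h : Fin (suc ∣ rest ∣) → Fin n
    h zero    = v₀
    h (suc x) = enum rest x
    enum≢v₀ : ∀ x → enum rest x ≢ v₀
    enum≢v₀ x eq = ≡ᵇ-false (not-true (proj₂ (rest⁻ (lookup-enum rest x)))) (cong toℕ eq)
    h-injective : Injective _≡_ _≡_ h
    h-injective {zero}  {zero}  eq = refl
    h-injective {zero}  {suc y} eq = contradiction (sym eq) (enum≢v₀ y)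
    h-injective {suc x} {zero}  eq = contradiction eq (enum≢v₀ x)
    h-injective {suc x} {suc y} eq = cong suc (enum-injective rest eq)
    h∈ : ∀ x → lookup Nb (h x) ≡ true
    h∈ zero    = v₀∈
    h∈ (suc x) = proj₁ (rest⁻ (lookup-enum rest x))

  inCut : Fin (suc n) × Slot n N → Bool
  inCut (j , bundle i c) = (toℕ j ≡ᵇ toℕ v₀) ∧ lookup rest i
  inCut (j , unit _)     = false
  inCut (j , slot _)     = false
  inCut (j , pair _ _ _) = false

  cut : Subset size-E
  cut = tabulate (inCut ∘ unindex)

  lookup-cut : ∀ j sl → lookup cut (index j sl) ≡ inCut (j , sl)
  lookup-cut j sl = trans (Vecₚ.lookup∘tabulate _ (index j sl)) (cong inCut (unindex-index j sl))

  cut-cheap : ∀ j sl → lookup cut (index j sl) ≡ true → costOf sl ≡ [ 1ℚ ]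
  cut-cheap j (bundle i c) _ = refl
  cut-cheap j (unit _)     eq = ⊥-elim (true≢false eq (lookup-cut j (unit _)))
  cut-cheap j (slot _)     eq = ⊥-elim (true≢false eq (lookup-cut j (slot _)))
  cut-cheap j (pair _ _ _) eq = ⊥-elim (true≢false eq (lookup-cut j (pair _ _ _)))

  j₀ : Fin (suc n)
  j₀ = inject₁ v₀

  at-v₀ : ∀ {j} → toℕ j ≡ toℕ v₀ → j ≡ j₀
  at-v₀ eq = Finₚ.toℕ-injective (trans eq (sym (Finₚ.toℕ-inject₁ v₀)))

  ∣cut∣≤ : ∣ cut ∣ ≤ ∣ rest ∣ * N
  ∣cut∣≤ = members≤ cut h cover
    where
    h : Fin (∣ rest ∣ * N) → Fin size-E
    h x = let (a , c) = remQuot N x in index j₀ (bundle (enum rest a) c)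
    cover′ : ∀ j sl → inCut (j , sl) ≡ true → ∃[ x ] h x ≡ index j sl
    cover′ j (bundle i c) eq with ∧-true {toℕ j ≡ᵇ toℕ v₀} eq
    ... | j≡ , i∈ with enum-surjective rest i i∈
    ... | a , refl rewrite at-v₀ {j} (≡ᵇ-true j≡) =
      combine a c , cong (λ (a , c) → index j₀ (bundle (enum rest a) c)) (Finₚ.remQuot-combine a c)
    cover : ∀ e → lookup cut e ≡ true → ∃[ x ] h x ≡ e
    cover e eq with cover′ (proj₁ (unindex e)) (proj₂ (unindex e)) (trans (sym (Vecₚ.lookup∘tabulate _ e)) eq)
    ... | x , hx = x , trans hx (index-unindex e)

  -- With `Z₁` and `Z₂` both beyond the cut, a diverted triple crosses exactly once, at its first
  -- edge, and a diverted `slot` does not cross.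
  localSide : Local n → Bool
  localSide P     = true
  localSide Z₁    = false
  localSide Z₂    = false
  localSide (L w) = lookup S w
  localSide (R i) = lookup rest i

  side : Nd → Bool
  side (b , x) with <-cmp (toℕ b) (toℕ v₀)
  ... | tri< _ _ _ = true
  ... | tri≈ _ _ _ = localSide x
  ... | tri> _ _ _ = false

  side-before : ∀ {b x} → toℕ b < toℕ v₀ → side (b , x) ≡ true
  side-before {b} lt with <-cmp (toℕ b) (toℕ v₀)
  ... | tri< _ _ _  = refl
  ... | tri≈ ≮ _ _  = contradiction lt ≮
  ... | tri> ≮ _ _  = contradiction lt ≮

  side-at : ∀ {b x} → toℕ b ≡ toℕ v₀ → side (b , x) ≡ localSide x
  side-at {b} eq with <-cmp (toℕ b) (toℕ v₀)
  ... | tri< _ ≢ _  = contradiction eq ≢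
  ... | tri≈ _ _ _  = refl
  ... | tri> _ ≢ _  = contradiction eq ≢

  side-after : ∀ {b x} → toℕ v₀ < toℕ b → side (b , x) ≡ false
  side-after {b} gt with <-cmp (toℕ b) (toℕ v₀)
  ... | tri< _ _ ≯  = contradiction gt ≯
  ... | tri≈ _ _ ≯  = contradiction gt ≯
  ... | tri> _ _ _  = refl

  ends-shape : ∀ j sl → proj₁ (proj₁ (ends j sl)) ≡ inject₁ j
    × (proj₁ (proj₂ (ends j sl)) ≡ inject₁ j ⊎ proj₂ (ends j sl) ≡ (suc j , P))
  ends-shape j (bundle i c) = refl , inj₂ refl
  ends-shape j (unit w)     = refl , inj₁ refl
  ends-shape j (slot w) with lookup direct w
  ... | true  = refl , inj₂ refl
  ... | false = refl , inj₁ refl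
  ends-shape j (pair w i c) with active j w i | c
  ... | true  | zero           = refl , inj₁ refl
  ... | true  | suc zero       = refl , inj₁ refl
  ... | true  | suc (suc zero) = refl , inj₂ refl
  ... | false | zero           = refl , inj₁ refl
  ... | false | suc zero       = refl , inj₁ refl
  ... | false | suc (suc zero) = refl , inj₂ refl

  side-P : ∀ {b} → toℕ b ≤ toℕ v₀ → side (b , P) ≡ true
  side-P {b} b≤ with <-cmp (toℕ b) (toℕ v₀)
  ... | tri< _ _ _ = refl
  ... | tri≈ _ _ _ = refl
  ... | tri> _ _ > = contradiction > (≤⇒≯ b≤)

  -- Other blocks lie on one side altogether. An edge can leave its block only for the source of the
  -- next one, and `side-P` puts the source of block `v₀` on the side of the blocks before it.
  crossing-block : ∀ j sl → side (proj₁ (ends j sl)) ≢ side (proj₂ (ends j sl)) → j ≡ j₀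
  crossing-block j sl differ with <-cmp (toℕ j) (toℕ v₀) | ends j sl | ends-shape j sl
  ... | tri≈ _ eq _ | _ | _ = at-v₀ eq
  ... | tri< lt _ _ | (_ , x) , (_ , y) | refl , inj₁ refl =
    contradiction (trans (side-before lt′) (sym (side-before lt′))) differ
    where lt′ = subst (_< toℕ v₀) (sym (Finₚ.toℕ-inject₁ j)) lt
  ... | tri< lt _ _ | (_ , x) , _ | refl , inj₂ refl =
    contradiction (trans (side-before lt′) (sym (side-P {suc j} lt))) differ
    where lt′ = subst (_< toℕ v₀) (sym (Finₚ.toℕ-inject₁ j)) lt
  ... | tri> _ _ gt | (_ , x) , (_ , y) | refl , inj₁ refl =
    contradiction (trans (side-after gt′) (sym (side-after gt′))) differ
    where gt′ = subst (toℕ v₀ <_) (sym (Finₚ.toℕ-inject₁ j)) gt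
  ... | tri> _ _ gt | (_ , x) , _ | refl , inj₂ refl =
    contradiction (trans (side-after gt′) (sym (side-after {suc j} (≤-trans gt (n≤1+n _))))) differ
    where gt′ = subst (toℕ v₀ <_) (sym (Finₚ.toℕ-inject₁ j)) gt

  here-side : ∀ {x} → side (inject₁ j₀ , x) ≡ localSide x
  here-side = side-at (trans (Finₚ.toℕ-inject₁ j₀) (Finₚ.toℕ-inject₁ v₀))

  next-side : ∀ {x} → side (suc j₀ , x) ≡ false
  next-side = side-after (s≤s (≤-reflexive (sym (Finₚ.toℕ-inject₁ v₀))))

  crossingThird : Bool → Bool → Bool → Fin 3
  crossingThird true  true  r     = suc (suc zero)
  crossingThird true  false true  = suc zero
  crossingThird true  false false = zero
  crossingThird false _     _     = zero

  -- A triple is a path from the side of the source to that of the sink. The sides of its two inner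
  -- nodes tell where it crosses, and three crossings do not occur.
  crosses-at : ∀ w i c → side (proj₁ (ends j₀ (pair w i c))) ≢ side (proj₂ (ends j₀ (pair w i c))) →
               c ≡ crossingThird (active j₀ w i) (lookup S w) (lookup rest i)
  crosses-at w i c differ with active j₀ w i in act
  crosses-at w i zero             differ | false = refl
  crosses-at w i (suc zero)       differ | false = contradiction (trans here-side (sym here-side)) differ
  crosses-at w i (suc (suc zero)) differ | false = contradiction (trans here-side (sym next-side)) differ
  crosses-at w i c differ | true with lookup S w in Sw | lookup rest i in ri
  crosses-at w i zero             differ | true | true  | true  = contradiction
      (trans here-side (sym (trans here-side ri))) differ
  crosses-at w i (suc zero)       differ | true | true  | true  = contradiction
      (trans (trans here-side ri) (sym (trans here-side Sw))) differ
  crosses-at w i (suc (suc zero)) differ | true | true  | r     = refl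
  crosses-at w i zero             differ | true | false | true  = contradiction
      (trans here-side (sym (trans here-side ri))) differ
  crosses-at w i (suc zero)       differ | true | false | true  = refl
  crosses-at w i (suc (suc zero)) differ | true | false | r     = contradiction
      (trans (trans here-side Sw) (sym next-side)) differ
  crosses-at w i zero             differ | true | false | false = refl
  crosses-at w i (suc zero)       differ | true | false | false = contradiction
      (trans (trans here-side ri) (sym (trans here-side Sw))) differ
  -- Here all three edges would cross. But `i` is a neighbour of `w`, which is in `S`, and differs
  -- from `v₀`, so it belongs to `rest`.
  crosses-at w i c                differ | true | true  | false with ∧-true {lookup (lookup adj w) i} act
  ... | wi , i≢ = ⊥-elim (true≢false (rest⁺ (neighbour adj S w i Sw wi)
                    (trans (cong (λ m → not (toℕ i ≡ᵇ m)) (sym (Finₚ.toℕ-inject₁ v₀))) i≢)) ri)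

  crossers : ℕ
  crossers = n * n + (∣ ∁ S ∣ + ∣ direct ∣)

  crosser : Fin crossers → Slot n N
  crosser x with splitAt (n * n) x
  ... | inj₁ y = let (w , i) = remQuot n y in pair w i (crossingThird (active j₀ w i) (lookup S w) (lookup rest i))
  ... | inj₂ y with splitAt ∣ ∁ S ∣ y
  ... | inj₁ u = unit (enum (∁ S) u)
  ... | inj₂ u = slot (enum direct u)

  crosser-covers : ∀ sl → inCut (j₀ , sl) ≡ false → side (proj₁ (ends j₀ sl)) ≢ side (proj₂ (ends j₀ sl)) →
                   ∃[ x ] crosser x ≡ sl
  crosser-covers (bundle i c) out differ =
    contradiction (trans here-side (trans ri (sym next-side))) differ
    where
    ri : lookup rest i ≡ false
    ri with lookup rest i | toℕ j₀ ≡ᵇ toℕ v₀ in eq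
    ... | false | _     = refl
    ... | true  | true  = out
    ... | true  | false = contradiction (Finₚ.toℕ-inject₁ v₀) (≡ᵇ-false eq)
  crosser-covers (unit w) out differ with lookup S w in Sw
  ... | true  = contradiction (trans here-side (sym (trans here-side Sw))) differ
  ... | false with enum-surjective (∁ S) w (trans (lookup-∁ S w) (cong not Sw))
  ... | u , refl = (n * n) ↑ʳ (u ↑ˡ _) , eq
    where
    eq : crosser ((n * n) ↑ʳ (u ↑ˡ ∣ direct ∣)) ≡ unit (enum (∁ S) u)
    eq rewrite Finₚ.splitAt-↑ʳ (n * n) (∣ ∁ S ∣ + ∣ direct ∣) (u ↑ˡ ∣ direct ∣)
             | Finₚ.splitAt-↑ˡ (∣ ∁ S ∣) u (∣ direct ∣) = refl
  crosser-covers (slot w) out differ with lookup direct w in dw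
  ... | false = contradiction (trans here-side (sym here-side)) differ
  ... | true with enum-surjective direct w dw
  ... | u , refl = (n * n) ↑ʳ (∣ ∁ S ∣ ↑ʳ u) , eq
    where
    eq : crosser ((n * n) ↑ʳ (∣ ∁ S ∣ ↑ʳ u)) ≡ slot (enum direct u)
    eq rewrite Finₚ.splitAt-↑ʳ (n * n) (∣ ∁ S ∣ + ∣ direct ∣) (∣ ∁ S ∣ ↑ʳ u)
             | Finₚ.splitAt-↑ʳ (∣ ∁ S ∣) (∣ direct ∣) u = refl
  crosser-covers (pair w i c) out differ = combine w i ↑ˡ _ , eq
    where
    eq : crosser (combine w i ↑ˡ (∣ ∁ S ∣ + ∣ direct ∣)) ≡ pair w i c
    eq rewrite Finₚ.splitAt-↑ˡ (n * n) (combine w i) (∣ ∁ S ∣ + ∣ direct ∣) =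
      trans (cong (λ (w , i) → pair w i (crossingThird (active j₀ w i) (lookup S w) (lookup rest i)))
                  (Finₚ.remQuot-combine w i))
            (cong (pair w i) (sym (crosses-at w i c differ)))

  crossers≤ : crossers ≤ routes
  crossers≤ = +-monoʳ-≤ (n * n) (≤-trans (+-monoʳ-≤ ∣ ∁ S ∣ S-large) (≤-reflexive (∣∁∣+∣∣ S)))

  cut-isCut : IsKRouteCut cut
  cut-isCut r D = ≤-trans (paths≤cut side (side-P {zero} z≤n) side-t cut (index j₀ ∘ crosser) cover D) crossers≤
    where
    side-t : side (fromℕ (suc n) , P) ≡ false
    side-t = side-after (subst (toℕ v₀ <_) (sym (Finₚ.toℕ-fromℕ (suc n))) (≤-trans (Finₚ.toℕ<n v₀) (n≤1+n n)))
    cover : ∀ j sl → lookup cut (index j sl) ≡ false → side (proj₁ (ends j sl)) ≢ side (proj₂ (ends j sl)) →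
            ∃[ x ] index j₀ (crosser x) ≡ index j sl
    cover j sl out differ with crossing-block j sl differ
    ... | refl = let (x , eq) = crosser-covers sl (trans (sym (lookup-cut j₀ sl)) out) differ in x , cong (index j₀) eq

-- Walks composed of one segment per block

module Walks (Q : Square) where

  open Construction Q

  private
    Node : Set
    Node = Fin ((2 + n) * (3 + (n + n)))

  infixr 5 _++ʷ_
  _++ʷ_ : ∀ {u v w} → Walk u v → Walk v w → Walk u w
  stop       ++ʷ q = q
  step e j p ++ʷ q = step e j (p ++ʷ q)

  used-++ : ∀ {u v w} (p : Walk u v) (q : Walk v w) → used (p ++ʷ q) ≡ used p ++ used q
  used-++ stop         q = refl
  used-++ (step e j p) q = cong (e ∷_) (used-++ p q)

  -- Omits the final node, which is also the first node of the next segment and must not be counted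
  -- twice.
  inits : ∀ {u v} → Walk u v → List Node
  inits stop             = []
  inits (step {u} _ _ p) = u ∷ inits p

  visited-++ : ∀ {u v w} (p : Walk u v) (q : Walk v w) → visited (p ++ʷ q) ≡ inits p ++ visited q
  visited-++ stop         q = refl
  visited-++ (step e j p) q = cong (_ ∷_) (visited-++ p q)

  height : Node → ℕ
  height v = toℕ (proj₁ (unnode v))

  chain : ∀ m (B : Fin (suc m) → Node) → (∀ j → Walk (B (inject₁ j)) (B (suc j))) → Walk (B zero) (B (fromℕ m))
  chain zero    B seg = stop
  chain (suc m) B seg = seg zero ++ʷ chain m (B ∘ suc) (seg ∘ suc)

  used-chain : ∀ m B seg {e} → e List∈.∈ used (chain m B seg) → ∃[ j ] e List∈.∈ used (seg j)
  used-chain (suc m) B seg {e} e∈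
    with List∈ₚ.∈-++⁻ (used (seg zero)) (subst (e List∈.∈_) (used-++ (seg zero) (chain m (B ∘ suc) (seg ∘ suc))) e∈)
  ... | inj₁ e∈₀ = zero , e∈₀
  ... | inj₂ e∈₁ = let (j , e∈′) = used-chain m (B ∘ suc) (seg ∘ suc) e∈₁ in suc j , e∈′

  -- Apart from its final node, segment `j` stays at height c + j, so different segments have no
  -- node in common. The offset `c` is there for the induction.
  chain-simple : ∀ m B seg c → (∀ j → Unique (inits (seg j))) →
    (∀ j → All (λ v → height v ≡ c + toℕ j) (inits (seg j))) → height (B (fromℕ m)) ≡ c + m →
    Unique (visited (chain m B seg)) × All (λ v → c ≤ height v) (visited (chain m B seg))
  chain-simple zero    B seg c uniq level stop≡ = ([] ∷ []) , (≤-trans (m≤m+n c 0) (≤-reflexive (sym stop≡)) ∷ [])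
  chain-simple (suc m) B seg c uniq level stop≡
    with chain-simple m (B ∘ suc) (seg ∘ suc) (suc c) (uniq ∘ suc)
           (λ j → All.map (λ eq → trans eq (+-suc c (toℕ j))) (level (suc j))) (trans stop≡ (+-suc c m))
  ... | uniq′ , above
    rewrite visited-++ (seg zero) (chain m (B ∘ suc) (seg ∘ suc)) =
      Uniqueₚ.++⁺ (uniq zero) uniq′ (λ (v∈ , v∈′) → <⇒≢ (All.lookup above v∈′)
        (sym (trans (All.lookup (level zero) v∈) (+-identityʳ c))))
    , Allₚ.++⁺ (All.map (λ eq → ≤-reflexive (sym (trans eq (+-identityʳ c)))) (level zero))
               (All.map (≤-trans (n≤1+n c)) above)

  -- A path through block `j` in terms of local nodes and slots. Simplicity and disjointness can be
  -- read off constructors there, without arithmetic on indices.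
  data Route (j : Fin (suc n)) : Local n → List (Local n) → List (Slot n N) → Set where
    last : ∀ {x} sl → ends j sl ≡ ((inject₁ j , x) , (suc j , P)) → Route j x (x ∷ []) (sl ∷ [])
    hop  : ∀ {x y xs sls} sl → ends j sl ≡ ((inject₁ j , x) , (inject₁ j , y)) →
           Route j y xs sls → Route j x (x ∷ xs) (sl ∷ sls)

  joins : ∀ j sl {u v} → ends j sl ≡ (u , v) → Joins (index j sl) (node u) (node v)
  joins j sl refl rewrite lookup-edge j sl = inj₁ (refl , refl)

  walk : ∀ {j x xs sls} → Route j x xs sls → Walk (node (inject₁ j , x)) (node (suc j , P))
  walk {j} (last sl eq)  = step (index j sl) (joins j sl eq) stop
  walk {j} (hop sl eq r) = step (index j sl) (joins j sl eq) (walk r)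

  inits-walk : ∀ {j x xs sls} (r : Route j x xs sls) → inits (walk r) ≡ List.map (λ y → node (inject₁ j , y)) xs
  inits-walk (last sl eq)  = refl
  inits-walk (hop sl eq r) = cong (_ ∷_) (inits-walk r)

  used-walk : ∀ {j x xs sls} (r : Route j x xs sls) → used (walk r) ≡ List.map (index j) sls
  used-walk (last sl eq)  = refl
  used-walk (hop sl eq r) = cong (_ ∷_) (used-walk r)

-- The largest set whose neighbourhood is contained in `mask`.
inner : ∀ {m n} → Vec (Subset n) m → Subset n → Subset m
inner adj mask = tabulate (λ w → lookup adj w ⊆ᵇ mask)

neighbours-inner : ∀ {m n} (adj : Vec (Subset n) m) mask i →
                   lookup (neighbours adj (inner adj mask)) i ≡ true → lookup mask i ≡ true
neighbours-inner adj mask i ni with neighbour⁻¹ adj (inner adj mask) i ni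
... | w , w∈ , wi = ⊆ᵇ-sound (lookup adj w) mask (trans (sym (Vecₚ.lookup∘tabulate _ w)) w∈) i wi

-- A large set from a cut of finite cost

module Lower (Q : Square) (F : Subset (Construction.size-E Q)) where

  open Construction Q
  open Walks Q

  chunk : Fin (suc n) → Fin n → Subset N
  chunk j i = tabulate (λ c → lookup F (index j (bundle i c)))

  left : Fin (suc n) → Fin n → ℕ
  left j i = ∣ ∁ (chunk j i) ∣

  -- The threshold is n because at most n paths, one for each left vertex, will have to leave the
  -- block through the bundle of a given right vertex.
  mask closed : Fin (suc n) → Subset n
  mask j   = tabulate (λ i → (toℕ i ≡ᵇ toℕ j) ∨ (suc (left j i) ≤ᵇ n))
  closed j = inner adj (mask j)

  module Count (j : Fin (suc n)) where

    scarce : Subset n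
    scarce = tabulate (λ i → suc (left j i) ≤ᵇ n)

    ∣mask∣≤ : ∣ mask j ∣ ≤ suc ∣ scarce ∣
    -- The elements are compared as numbers, since the number of the last block is not that of a
    -- right vertex.
    ∣mask∣≤ = covered⇒≤ (toℕ ∘ enum (mask j)) h (enum-injective (mask j) ∘ Finₚ.toℕ-injective)
                (λ x → cover (enum (mask j) x) (lookup-enum (mask j) x))
      where
      h : Fin (suc ∣ scarce ∣) → ℕ
      h zero    = toℕ j
      h (suc x) = toℕ (enum scarce x)
      cover : ∀ i → lookup (mask j) i ≡ true → ∃[ x ] h x ≡ toℕ i
      cover i mi with toℕ i ≡ᵇ toℕ j in eq | trans (sym (Vecₚ.lookup∘tabulate _ i)) mi
      ... | true  | _  = zero , sym (≡ᵇ-true eq)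
      ... | false | lt = let (x , ex) = enum-surjective scarce i (trans (Vecₚ.lookup∘tabulate _ i) lt)
                         in suc x , cong toℕ ex

    deleted : ∀ i → lookup scarce i ≡ true → N ∸ n ≤ ∣ chunk j i ∣
    deleted i si = begin
      N ∸ n                                    ≤⟨ ∸-monoʳ-≤ N (≤-trans (n≤1+n _) left<n) ⟩
      N ∸ left j i                             ≡⟨ cong (_∸ left j i) (∣∁∣+∣∣ (chunk j i)) ⟨
      (left j i + ∣ chunk j i ∣) ∸ left j i    ≡⟨ m+n∸m≡n (left j i) _ ⟩
      ∣ chunk j i ∣                            ∎
      where
      open ≤-Reasoning
      left<n : suc (left j i) ≤ n
      left<n = ≤ᵇ⇒≤ _ _ (subst T (sym (trans (sym (Vecₚ.lookup∘tabulate _ i)) si)) tt)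

    scarce≤ : ∣ scarce ∣ * (N ∸ n) ≤ ∣ F ∣
    scarce≤ = members⇒≤ F (h ∘ remQuot (N ∸ n))
                (λ {x} {y} eq → trans (sym (Finₚ.combine-remQuot {∣ scarce ∣} (N ∸ n) x))
                  (trans (cong (uncurry combine) (h-injective eq)) (Finₚ.combine-remQuot {∣ scarce ∣} (N ∸ n) y)))
                (h∈ ∘ remQuot (N ∸ n))
      where
      at : (a : Fin ∣ scarce ∣) → Fin (N ∸ n) → Fin N
      at a c = enum (chunk j (enum scarce a)) (inject≤ c (deleted _ (lookup-enum scarce a)))
      h : Fin ∣ scarce ∣ × Fin (N ∸ n) → Fin size-E
      h (a , c) = index j (bundle (enum scarce a) (at a c))
      bundle-injective : ∀ {i c i′ c′} → bundle {n} {N} i c ≡ bundle i′ c′ → i ≡ i′ × c ≡ c′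
      bundle-injective refl = refl , refl
      h-injective : ∀ {x y} → h x ≡ h y → x ≡ y
      h-injective {a , c} {a′ , c′} eq =
        let (i≡ , c≡) = bundle-injective (cong proj₂ (index-injective {j} {_} {j} eq))
        in meet (enum-injective scarce i≡) c≡
        where
        meet : ∀ {a a′ c c′} → a ≡ a′ → at a c ≡ at a′ c′ → (a , c) ≡ (a′ , c′)
        meet {a} {c = c} {c′} refl c≡ =
          cong (a ,_) (Finₚ.inject≤-injective _ _ c c′ (enum-injective (chunk j (enum scarce a)) c≡))
      h∈ : ∀ x → lookup F (h x) ≡ true
      h∈ (a , c) = trans (sym (Vecₚ.lookup∘tabulate _ (at a c))) (lookup-enum (chunk j (enum scarce a)) _)

    -- Among the neighbours only the one left out in block `j` may be free of charge. Every other
    -- one is scarce and has lost at least N - n edges of its bundle to `F`.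
    neighbours≤ : (∣ neighbours adj (closed j) ∣ ∸ 1) * (N ∸ n) ≤ ∣ F ∣
    neighbours≤ = ≤-trans (*-monoˡ-≤ (N ∸ n) (∸-monoˡ-≤ 1
      (≤-trans (∣∣-mono (neighbours adj (closed j)) (mask j) (neighbours-inner adj (mask j))) ∣mask∣≤))) scarce≤

  module Paths (cheap : ∀ j sl → lookup F (index j sl) ≡ true → costOf sl ≡ [ 1ℚ ])
               (small : ∀ j → suc ∣ closed j ∣ ≤ ∣ direct ∣) where

    dear : ∀ j sl → costOf sl ≡ ⊤⁺ → lookup F (index j sl) ≡ false
    dear j sl eq with lookup F (index j sl) in e
    ... | false = refl
    ... | true with () ← trans (sym eq) (cheap j sl e)

    Exit : Fin (suc n) → Fin n → Fin n → Set
    Exit j w i = active j w i ≡ true × n ≤ left j i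

    exit : ∀ j w → lookup (closed j) w ≡ true ⊎ Σ[ i ∈ Fin n ] Exit j w i
    exit j w with lookup adj w ⊆ᵇ mask j in eq
    ... | true  = inj₁ (trans (Vecₚ.lookup∘tabulate _ w) eq)
    ... | false with ⊈ᵇ-witness (lookup adj w) (mask j) eq
    ... | i , wi , mi with toℕ i ≡ᵇ toℕ j in i≡ | suc (left j i) ≤ᵇ n in lt | trans (sym (Vecₚ.lookup∘tabulate _ i)) mi
    ... | false | false | _ = inj₂ (i , ∧-intro wi (cong not i≡) , ≮⇒≥ (λ l → subst T lt (≤⇒≤ᵇ l)))

    -- The edge of the bundle reserved for `w`: different vertices with the same exit receive
    -- different edges. The inequality is irrelevant so that the edge does not depend on its proof.
    select : ∀ j i → .(n ≤ left j i) → Fin n → Fin N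
    select j i le w = enum (∁ (chunk j i)) (inject≤ w le)

    select-kept : ∀ j i le w → lookup F (index j (bundle i (select j i le w))) ≡ false
    select-kept j i le w = trans (sym (Vecₚ.lookup∘tabulate _ c))
      (not-true (trans (sym (lookup-∁ (chunk j i) c)) (lookup-enum (∁ (chunk j i)) _)))
      where c = select j i le w

    -- The paths through one block: one for each pair, each left vertex outside `closed j` and each
    -- direct edge. As `closed j` is too small, there are at least `suc routes` of them, which is
    -- `enough`.
    data Kind : Set where
      kpair : Fin n → Fin n → Kind
      kunit : Fin n → Kind
      kslot : Fin n → Kind

    Valid : Fin (suc n) → Kind → Set
    Valid j (kpair w i) = ⊤
    Valid j (kunit w)   = lookup (closed j) w ≡ false
    Valid j (kslot w)   = lookup direct w ≡ true

    Chosen : Fin (suc n) → Fin n → Fin n → Set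
    Chosen j w i = Σ[ x ∈ Exit j w i ] exit j w ≡ inj₂ (i , x)

    chosen? : ∀ j w i → Chosen j w i ⊎ ¬ Chosen j w i
    chosen? j w i with exit j w
    ... | inj₁ _ = inj₂ λ ()
    ... | inj₂ (i′ , x) with i′ Finₚ.≟ i
    ... | yes refl = inj₁ (x , refl)
    ... | no  i′≢i = inj₂ λ { (_ , refl) → i′≢i refl }

    -- If w has the exit i, then the path of the pair (w , i) gives up its last
    -- edge to the path of w, and uses an edge of the bundle of i instead.

    data Owns (j : Fin (suc n)) : Kind → Slot n N → Set where
      own-unit   : ∀ {w} → Owns j (kunit w) (unit w)
      own-slot   : ∀ {w} → Owns j (kslot w) (slot w)
      own-first  : ∀ {w i} → Owns j (kpair w i) (pair w i zero)
      own-second : ∀ {w i} → Owns j (kpair w i) (pair w i (suc zero))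
      own-third  : ∀ {w i} → ¬ Chosen j w i → Owns j (kpair w i) (pair w i (suc (suc zero)))
      give-third : ∀ {w i} → Chosen j w i → Owns j (kunit w) (pair w i (suc (suc zero)))
      own-bundle : ∀ {w i} (le : n ≤ left j i) → Owns j (kpair w i) (bundle i (select j i le w))

    select-injective : ∀ j i {le le′ : n ≤ left j i} {w w′} → select j i le w ≡ select j i le′ w′ → w ≡ w′
    select-injective j i eq = Finₚ.inject≤-injective _ _ _ _ (enum-injective (∁ (chunk j i)) eq)

    -- This gives disjointness within a block. The contested third edge of a pair goes to one of two
    -- paths according to `Chosen`, and the edges of a bundle are told apart by `select-injective`.
    owner-unique : ∀ {j κ κ′ sl sl′} → Owns j κ sl → Owns j κ′ sl′ → sl ≡ sl′ → κ ≡ κ′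
    owner-unique own-unit        own-unit        refl = refl
    owner-unique own-slot        own-slot        refl = refl
    owner-unique own-first       own-first       refl = refl
    owner-unique own-second      own-second      refl = refl
    owner-unique (own-third _)   (own-third _)   refl = refl
    owner-unique (own-third ¬c)  (give-third c)  refl = contradiction c ¬c
    owner-unique (give-third c)  (own-third ¬c)  refl = contradiction c ¬c
    owner-unique (give-third _)  (give-third _)  refl = refl
    owner-unique {j} (own-bundle {w} {i} le) (own-bundle {w′} {i′} le′) eq with bundle-injective eq
      where
      bundle-injective : ∀ {i c i′ c′} → bundle {n} {N} i c ≡ bundle i′ c′ → i ≡ i′ × c ≡ c′
      bundle-injective refl = refl , refl
    ... | refl , c≡ = cong (λ v → kpair v i) (select-injective j i {le} {le′} c≡)

    record Segment (j : Fin (suc n)) (κ : Kind) : Set where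
      field
        {locals} : List (Local n)
        {sls}    : List (Slot n N)
        route    : Route j P locals sls
        simple   : Unique locals
        owned    : All (Owns j κ) sls
        kept     : All (λ sl → lookup F (index j sl) ≡ false) sls

    ends-active : ∀ {j w i} c {b} → active j w i ≡ b → ends j (pair w i c) ≡ endsPair b w i c j
    ends-active {j} {w} {i} c eq = cong (λ b → endsPair b w i c j) eq

    whole : ∀ {j} w i b → active j w i ≡ b → ¬ Chosen j w i → Segment j (kpair w i)
    whole {j} w i b act ¬c = split b act
      where
      owned₃ : All (Owns j (kpair w i)) (pair w i zero ∷ pair w i (suc zero) ∷ pair w i (suc (suc zero)) ∷ [])
      owned₃ = own-first ∷ own-second ∷ own-third ¬c ∷ []
      kept₃ : All (λ sl → lookup F (index j sl) ≡ false) (pair w i zero ∷ pair w i (suc zero) 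
                                                                ∷ pair w i (suc (suc zero)) ∷ [])
      kept₃ = dear j (pair w i zero) refl ∷ dear j (pair w i (suc zero)) refl 
              ∷ dear j (pair w i (suc (suc zero))) refl ∷ []
      split : ∀ b → active j w i ≡ b → Segment j (kpair w i)
      split true act = record
        { route  = hop (pair w i zero) (ends-active zero act) (hop (pair w i (suc zero)) (ends-active (suc zero) act)
                     (last (pair w i (suc (suc zero))) (ends-active (suc (suc zero)) act)))
        ; simple = ((λ ()) ∷ (λ ()) ∷ []) ∷ ((λ ()) ∷ []) ∷ [] ∷ []
        ; owned  = owned₃ ; kept = kept₃ }
      -- The same slots in the same order. Only the inferred inner nodes differ: `Z₂` and `Z₁`
      -- instead of `R i` and `L w`.
      split false act = record
        { route  = hop (pair w i zero) (ends-active zero act) (hop (pair w i (suc zero)) (ends-active (suc zero) act)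
                     (last (pair w i (suc (suc zero))) (ends-active (suc (suc zero)) act)))
        ; simple = ((λ ()) ∷ (λ ()) ∷ []) ∷ ((λ ()) ∷ []) ∷ [] ∷ []
        ; owned  = owned₃ ; kept = kept₃ }

    segment : ∀ j κ → Valid j κ → Segment j κ
    segment j (kslot w) dw = record
      { route  = last (slot w) (cong (λ b → endsSlot b j) dw)
      ; simple = [] ∷ [] ; owned = own-slot ∷ [] ; kept = dear j (slot w) refl ∷ [] }
    segment j (kunit w) w∉ with exit j w in eq
    ... | inj₁ w∈           = ⊥-elim (true≢false w∈ w∉)
    ... | inj₂ (i , x@(act , _)) = record
      { route  = hop (unit w) refl (last (pair w i (suc (suc zero))) (ends-active (suc (suc zero)) act))
      ; simple = ((λ ()) ∷ []) ∷ [] ∷ []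
      ; owned  = own-unit ∷ give-third (x , eq) ∷ []
      ; kept   = dear j (unit w) refl ∷ dear j (pair w i (suc (suc zero))) refl ∷ [] }
    segment j (kpair w i) _ with chosen? j w i
    ... | inj₁ ((act , le) , _) = record
      { route  = hop (pair w i zero) (ends-active zero act) (last (bundle i (select j i le w)) refl)
      ; simple = ((λ ()) ∷ []) ∷ [] ∷ []
      ; owned  = own-first ∷ own-bundle le ∷ []
      ; kept   = dear j (pair w i zero) refl ∷ select-kept j i le w ∷ [] }
    ... | inj₂ ¬c = whole w i (active j w i) refl ¬c

    enough : ∀ j → suc routes ≤ n * n + (∣ ∁ (closed j) ∣ + ∣ direct ∣)
    enough j = begin
      suc (n * n + n)                                    ≡⟨ +-suc (n * n) n ⟨
      n * n + suc n                                      ≡⟨ cong (λ x → n * n + suc x) (∣∁∣+∣∣ (closed j)) ⟨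
      n * n + suc (∣ ∁ (closed j) ∣ + ∣ closed j ∣)      ≡⟨ cong (n * n +_) (+-suc ∣ ∁ (closed j) ∣ ∣ closed j ∣) ⟨
      n * n + (∣ ∁ (closed j) ∣ + suc ∣ closed j ∣)      ≤⟨ +-monoʳ-≤ (n * n) (+-monoʳ-≤ ∣ ∁ (closed j) ∣ (small j)) ⟩
      n * n + (∣ ∁ (closed j) ∣ + ∣ direct ∣)            ∎
      where open ≤-Reasoning

    Codes : Fin (suc n) → Set
    Codes j = Fin (n * n) ⊎ Fin (∣ ∁ (closed j) ∣ + ∣ direct ∣)

    kind′ : ∀ j → Fin ∣ ∁ (closed j) ∣ ⊎ Fin ∣ direct ∣ → Kind
    kind′ j (inj₁ x) = kunit (enum (∁ (closed j)) x)
    kind′ j (inj₂ x) = kslot (enum direct x)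

    kind″ : ∀ j → Codes j → Kind
    kind″ j (inj₁ x) = let (w , i) = remQuot n x in kpair w i
    kind″ j (inj₂ x) = kind′ j (splitAt ∣ ∁ (closed j) ∣ x)

    -- The path with number `r` takes the `r`-th kind in each block. Since blocks share no edges, it
    -- does not matter which local paths are joined.
    kind : ∀ j → Fin (suc routes) → Kind
    kind j r = kind″ j (splitAt (n * n) (inject≤ r (enough j)))

    kind-valid : ∀ j r → Valid j (kind j r)
    kind-valid j r = valid″ (splitAt (n * n) (inject≤ r (enough j)))
      where
      valid′ : ∀ x → Valid j (kind′ j x)
      valid′ (inj₁ x) = not-true (trans (sym (lookup-∁ (closed j) _)) (lookup-enum (∁ (closed j)) x))
      valid′ (inj₂ x) = lookup-enum direct x
      valid″ : ∀ x → Valid j (kind″ j x)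
      valid″ (inj₁ x) = tt
      valid″ (inj₂ x) = valid′ (splitAt ∣ ∁ (closed j) ∣ x)

    splitAt-injective : ∀ m {m′} → Injective _≡_ _≡_ (splitAt m {m′})
    splitAt-injective m {m′} {x} {y} eq =
      trans (sym (Finₚ.join-splitAt m m′ x)) (trans (cong (Fin.join m m′) eq) (Finₚ.join-splitAt m m′ y))

    kind-injective : ∀ j → Injective _≡_ _≡_ (kind j)
    kind-injective j eq = Finₚ.inject≤-injective _ _ _ _ (splitAt-injective (n * n) (inj″ _ _ eq))
      where
      inj′ : ∀ x y → kind′ j x ≡ kind′ j y → x ≡ y
      inj′ (inj₁ x) (inj₁ y) eq = cong inj₁ (enum-injective (∁ (closed j)) (kunit-injective eq))
        where kunit-injective : ∀ {w w′} → kunit w ≡ kunit w′ → w ≡ w′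
              kunit-injective refl = refl
      inj′ (inj₂ x) (inj₂ y) eq = cong inj₂ (enum-injective direct (kslot-injective eq))
        where kslot-injective : ∀ {w w′} → kslot w ≡ kslot w′ → w ≡ w′
              kslot-injective refl = refl
      disjoint′ : ∀ w i x → kpair w i ≢ kind′ j x
      disjoint′ w i (inj₁ _) ()
      disjoint′ w i (inj₂ _) ()
      kpair-injective : ∀ {w i w′ i′} → kpair w i ≡ kpair w′ i′ → (w , i) ≡ (w′ , i′)
      kpair-injective refl = refl
      inj″ : ∀ x y → kind″ j x ≡ kind″ j y → x ≡ y
      inj″ (inj₁ x) (inj₁ y) eq = cong inj₁ (trans (sym (Finₚ.combine-remQuot {n} n x))
        (trans (cong (uncurry combine) (kpair-injective eq)) (Finₚ.combine-remQuot {n} n y)))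
      inj″ (inj₁ x) (inj₂ y) eq = contradiction eq (disjoint′ _ _ (splitAt ∣ ∁ (closed j) ∣ y))
      inj″ (inj₂ x) (inj₁ y) eq = contradiction (sym eq) (disjoint′ _ _ (splitAt ∣ ∁ (closed j) ∣ x))
      inj″ (inj₂ x) (inj₂ y) eq = cong inj₂ (splitAt-injective ∣ ∁ (closed j) ∣ (inj′ _ _ eq))

    segmentOf : ∀ r j → Segment j (kind j r)
    segmentOf r j = segment j (kind j r) (kind-valid j r)

    stretch : ∀ r j → Walk (node (inject₁ j , P)) (node (suc j , P))
    stretch r j = walk (Segment.route (segmentOf r j))

    routeOf : ∀ r → Walk (node (zero , P)) (node (fromℕ (suc n) , P))
    routeOf r = chain (suc n) (λ b → node (b , P)) (stretch r)

    used-stretch : ∀ r j {e} → e List∈.∈ used (stretch r j) →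
                   ∃[ sl ] e ≡ index j sl × Owns j (kind j r) sl × lookup F (index j sl) ≡ false
    used-stretch r j {e} e∈
      with List∈ₚ.∈-map⁻ (index j) (subst (e List∈.∈_) (used-walk (Segment.route (segmentOf r j))) e∈)
    ... | sl , sl∈ , eq = sl , eq , All.lookup (Segment.owned (segmentOf r j)) sl∈
                             , All.lookup (Segment.kept (segmentOf r j)) sl∈

    disjointPaths : EdgeDisjointPaths F (suc routes)
    disjointPaths = record
      { path = routeOf ; isPath = simple
      ; avoids = λ r → All.tabulate λ e∈ e∈F → kept r e∈ (∈⇒lookup e∈F)
      ; disjoint = λ r≢r′ (e∈ , e∈′) → r≢r′ (same _ _ e∈ e∈′) }
      where
      Via : Fin (suc routes) → Fin size-E → Set
      Via r e = ∃[ j ] ∃[ sl ] e ≡ index j sl × Owns j (kind j r) sl × lookup F (index j sl) ≡ false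
      via : ∀ r {e} → e List∈.∈ used (routeOf r) → Via r e
      via r e∈ = let (j , e∈j) = used-chain (suc n) (λ b → node (b , P)) (stretch r) e∈
                 in j , used-stretch r j e∈j
      kept : ∀ r {e} → e List∈.∈ used (routeOf r) → lookup F e ≢ true
      kept r e∈ eq = let (j , sl , e≡ , _ , out) = via r e∈
                     in true≢false {lookup F (index j sl)} (trans (cong (lookup F) (sym e≡)) eq) out
      via-unique : ∀ {r r′ e} → Via r e → Via r′ e → r ≡ r′
      via-unique {r} {r′} (j , sl , eq , own , _) (j′ , sl′ , eq′ , own′ , _) =
        meet (index-injective {j} {sl} {j′} {sl′} (trans (sym eq) eq′)) own own′
        where
        meet : ∀ {j j′ sl sl′} → (j , sl) ≡ (j′ , sl′) → Owns j (kind j r) sl → Owns j′ (kind j′ r′) sl′ → r ≡ r′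
        meet {j} refl own own′ = kind-injective j (owner-unique own own′ refl)
      same : ∀ r r′ {e} → e List∈.∈ used (routeOf r) → e List∈.∈ used (routeOf r′) → r ≡ r′
      same r r′ e∈ e∈′ = via-unique (via r e∈) (via r′ e∈′)
      simple : ∀ r → IsPath (routeOf r)
      simple r = proj₁ (chain-simple (suc n) (λ b → node (b , P)) (stretch r) 0 uniq level
        (trans (cong (toℕ ∘ proj₁) (unnode-node (fromℕ (suc n) , P))) (Finₚ.toℕ-fromℕ (suc n))))
        where
        uniq : ∀ j → Unique (inits (stretch r j))
        uniq j = subst Unique (sym (inits-walk (Segment.route (segmentOf r j))))
          (Uniqueₚ.map⁺ (λ {x} {y} eq → cong proj₂ (node-injective {inject₁ j , x} {inject₁ j , y} eq))
              (Segment.simple (segmentOf r j)))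
        level : ∀ j → All (λ v → height v ≡ toℕ j) (inits (stretch r j))
        level j = subst (All _) (sym (inits-walk (Segment.route (segmentOf r j))))
          (Allₚ.map⁺ (All.universal (λ y → trans (cong (toℕ ∘ proj₁) (unnode-node (inject₁ j , y)))
              (Finₚ.toℕ-inject₁ j)) _))

  -- If `closed j` were too small in all blocks, joining their local paths would give `suc routes`
  -- disjoint paths that avoid `F`.
  large-block : (∀ j sl → lookup F (index j sl) ≡ true → costOf sl ≡ [ 1ℚ ]) → IsKRouteCut F →
                ∃[ j ] ∣ direct ∣ ≤ ∣ closed j ∣
  large-block cheap isCut with Finₚ.any? (λ j → ∣ direct ∣ ≤? ∣ closed j ∣)
  ... | yes found = found
  ... | no  none  = contradiction (isCut (suc routes) (Paths.disjointPaths cheap (λ j → ≰⇒> (λ le → none (j , le)))))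
                                  (<⇒≱ ≤-refl)

-- Costs and ratios

private
  wholeᵘ : ℕ → ℚᵘ.ℚᵘ
  wholeᵘ n = ℚᵘ.mkℚᵘ (pos n) 0

-- Calculations are carried out with unnormalised fractions, which avoids reasoning about greatest
-- common divisors.
toℚᵘ-ℕtoℚ : ∀ n → ℚ.toℚᵘ (ℕtoℚ n) ℚᵘ.≃ wholeᵘ n
toℚᵘ-ℕtoℚ n = ℚₚ.toℚᵘ-fromℚᵘ (wholeᵘ n)

ℕtoℚ-mono : ∀ {m n} → m ≤ n → ℕtoℚ m ℚ.≤ ℕtoℚ n
ℕtoℚ-mono {m} {n} m≤n = ℚₚ.toℚᵘ-cancel-≤ (begin
  ℚ.toℚᵘ (ℕtoℚ m)   ≃⟨ toℚᵘ-ℕtoℚ m ⟩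
  wholeᵘ m          ≤⟨ ℚᵘ.*≤* (ℤₚ.*-monoʳ-≤-nonNeg (pos 1) (ℤ.+≤+ m≤n)) ⟩
  wholeᵘ n          ≃⟨ toℚᵘ-ℕtoℚ n ⟨
  ℚ.toℚᵘ (ℕtoℚ n)   ∎)
  where open ℚᵘₚ.≤-Reasoning

ℕtoℚ-cancel : ∀ {m n} → ℕtoℚ m ℚ.≤ ℕtoℚ n → m ≤ n
ℕtoℚ-cancel {m} {n} le with begin
    wholeᵘ m          ≃⟨ toℚᵘ-ℕtoℚ m ⟨
    ℚ.toℚᵘ (ℕtoℚ m)   ≤⟨ ℚₚ.toℚᵘ-mono-≤ le ⟩
    ℚ.toℚᵘ (ℕtoℚ n)   ≃⟨ toℚᵘ-ℕtoℚ n ⟩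
    wholeᵘ n          ∎
  where open ℚᵘₚ.≤-Reasoning
... | ℚᵘ.*≤* le′ = ℤₚ.drop‿+≤+ (subst₂ ℤ._≤_ (ℤₚ.*-identityʳ (pos m)) (ℤₚ.*-identityʳ (pos n)) le′)

ℕtoℚ-* : ∀ m n → ℕtoℚ (m * n) ≡ ℕtoℚ m ℚ.* ℕtoℚ n
ℕtoℚ-* m n = ℚₚ.toℚᵘ-injective (begin
  ℚ.toℚᵘ (ℕtoℚ (m * n))                   ≈⟨ toℚᵘ-ℕtoℚ (m * n) ⟩
  wholeᵘ (m * n)                          ≈⟨ ℚᵘ.*≡* (cong (ℤ._* (pos 1)) (ℤₚ.pos-* m n)) ⟩
  wholeᵘ m ℚᵘ.* wholeᵘ n                  ≈⟨ ℚᵘₚ.*-cong (toℚᵘ-ℕtoℚ m) (toℚᵘ-ℕtoℚ n) ⟨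
  ℚ.toℚᵘ (ℕtoℚ m) ℚᵘ.* ℚ.toℚᵘ (ℕtoℚ n)    ≈⟨ ℚₚ.toℚᵘ-homo-* (ℕtoℚ m) (ℕtoℚ n) ⟨
  ℚ.toℚᵘ (ℕtoℚ m ℚ.* ℕtoℚ n)              ∎)
  where open import Relation.Binary.Reasoning.Setoid ℚᵘₚ.≃-setoid

ℕtoℚ-suc : ∀ n → 1ℚ ℚ.+ ℕtoℚ n ≡ ℕtoℚ (suc n)
ℕtoℚ-suc n = ℚₚ.toℚᵘ-injective (begin
  ℚ.toℚᵘ (1ℚ ℚ.+ ℕtoℚ n)             ≈⟨ ℚₚ.toℚᵘ-homo-+ 1ℚ (ℕtoℚ n) ⟩
  ℚ.toℚᵘ 1ℚ ℚᵘ.+ ℚ.toℚᵘ (ℕtoℚ n)     ≈⟨ ℚᵘₚ.+-congʳ (wholeᵘ 1) (toℚᵘ-ℕtoℚ n) ⟩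
  wholeᵘ 1 ℚᵘ.+ wholeᵘ n             ≈⟨ ℚᵘ.*≡* (cong (λ z → ((pos 1) ℤ.+ z) ℤ.* (pos 1)) (ℤₚ.*-identityʳ (pos n))) ⟩
  wholeᵘ (suc n)                     ≈⟨ toℚᵘ-ℕtoℚ (suc n) ⟨
  ℚ.toℚᵘ (ℕtoℚ (suc n))              ∎)
  where open import Relation.Binary.Reasoning.Setoid ℚᵘₚ.≃-setoid

ℕtoℚ-nonNeg : ∀ n → ℚ.NonNegative (ℕtoℚ n)
ℕtoℚ-nonNeg n = ℚ.nonNegative (ℕtoℚ-mono {0} {n} z≤n)

ℕtoℚ-pos : ∀ n → ℚ.Positive (ℕtoℚ (suc n))
ℕtoℚ-pos n = ℚ.positive (ℚₚ.<-≤-trans (ℚₚ.positive⁻¹ 1ℚ) (ℕtoℚ-mono {1} {suc n} (s≤s z≤n)))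

scaled≃ : ∀ p d .(c : Coprime p (suc d)) u → ℚ.toℚᵘ (ℚ.mkℚ (pos p) d c ℚ.* ℕtoℚ u) ℚᵘ.≃ ℚᵘ.mkℚᵘ (pos (p * u)) d
scaled≃ p d c u = begin
  ℚ.toℚᵘ (ℚ.mkℚ (pos p) d c ℚ.* ℕtoℚ u)    ≈⟨ ℚₚ.toℚᵘ-homo-* (ℚ.mkℚ (pos p) d c) (ℕtoℚ u) ⟩
  ℚᵘ.mkℚᵘ (pos p) d ℚᵘ.* ℚ.toℚᵘ (ℕtoℚ u)   ≈⟨ ℚᵘₚ.*-congˡ {ℚᵘ.mkℚᵘ (pos p) d} (toℚᵘ-ℕtoℚ u) ⟩
  ℚᵘ.mkℚᵘ (pos p) d ℚᵘ.* wholeᵘ u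
      ≈⟨ ℚᵘ.*≡* (cong₂ ℤ._*_ (sym (ℤₚ.pos-* p u)) (cong (λ x → pos (suc x)) (sym (*-identityʳ d)))) ⟩
  ℚᵘ.mkℚᵘ (pos (p * u)) d                  ∎
  where open import Relation.Binary.Reasoning.Setoid ℚᵘₚ.≃-setoid

-- The denominator is cleared. Positivity of α enters because only the absolute value of the
-- numerator is encoded.
scaled-≤-to : ∀ α → 0ℚ ℚ.< α → ∀ {u s} → α ℚ.* ℕtoℚ u ℚ.≤ ℕtoℚ s → ℤ.∣ ℚ.↥ α ∣ * u ≤ ℚ.↧ₙ α * s
scaled-≤-to (ℚ.mkℚ (ℤ.-[1+ _ ]) d c) (ℚ.*<* ())
scaled-≤-to (ℚ.mkℚ (pos p) d c) _ {u} {s} le with begin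
    ℚᵘ.mkℚᵘ (pos (p * u)) d                   ≃⟨ scaled≃ p d c u ⟨
    ℚ.toℚᵘ (ℚ.mkℚ (pos p) d c ℚ.* ℕtoℚ u)     ≤⟨ ℚₚ.toℚᵘ-mono-≤ le ⟩
    ℚ.toℚᵘ (ℕtoℚ s)                         ≃⟨ toℚᵘ-ℕtoℚ s ⟩
    wholeᵘ s                                ∎
  where open ℚᵘₚ.≤-Reasoning
... | ℚᵘ.*≤* le′ = ℤₚ.drop‿+≤+ (subst₂ ℤ._≤_ (ℤₚ.*-identityʳ (pos (p * u)))
  (trans (sym (ℤₚ.pos-* s (suc d))) (cong pos (*-comm s (suc d)))) le′)

scaled-≤-from : ∀ α → 0ℚ ℚ.< α → ∀ {u s} → ℤ.∣ ℚ.↥ α ∣ * u ≤ ℚ.↧ₙ α * s → α ℚ.* ℕtoℚ u ℚ.≤ ℕtoℚ s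
scaled-≤-from (ℚ.mkℚ (ℤ.-[1+ _ ]) d c) (ℚ.*<* ())
scaled-≤-from (ℚ.mkℚ (pos p) d c) _ {u} {s} le = ℚₚ.toℚᵘ-cancel-≤ (begin
  ℚ.toℚᵘ (ℚ.mkℚ (pos p) d c ℚ.* ℕtoℚ u)     ≃⟨ scaled≃ p d c u ⟩
  ℚᵘ.mkℚᵘ (pos (p * u)) d                   ≤⟨ ℚᵘ.*≤* (subst₂ ℤ._≤_ (sym (ℤₚ.*-identityʳ (pos (p * u))))
                                              (trans (cong pos (*-comm (suc d) s)) (ℤₚ.pos-* s (suc d))) (ℤ.+≤+ le)) ⟩
  wholeᵘ s                                ≃⟨ toℚᵘ-ℕtoℚ s ⟨
  ℚ.toℚᵘ (ℕtoℚ s)                         ∎)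
  where open ℚᵘₚ.≤-Reasoning

module Costs {n : ℕ} (cost : Fin n → ℚ ⁺) (F : Subset n) where

  total : ℚ ⁺
  total = List.foldr _+∞_ [ 0ℚ ] (List.map cost (List.filter (Subsetₚ._∈? F) (List.allFin n)))

  private
    member : Fin n → Set
    member e = lookup F e ≡ true

    members : List (Fin n)
    members = List.filter (Subsetₚ._∈? F) (List.allFin n)

    length-filter : ∀ {m} (f : Fin m → Fin n) (p : Subset m) → (∀ i → lookup p i ≡ lookup F (f i)) →
                    List.length (List.filter (Subsetₚ._∈? F) (List.tabulate f)) ≡ ∣ p ∣
    length-filter {zero}  f []      h = refl
    length-filter {suc m} f (b ∷ p) h with f zero Subsetₚ.∈? F | b
    ... | yes _  | true  = cong suc (length-filter (f ∘ suc) p (h ∘ suc))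
    ... | no _   | false = length-filter (f ∘ suc) p (h ∘ suc)
    ... | yes ∈F | false = ⊥-elim (true≢false (∈⇒lookup ∈F) (sym (h zero)))
    ... | no ∉F  | true  = contradiction (lookup⇒∈ (sym (h zero))) ∉F

    length-members : List.length members ≡ ∣ F ∣
    length-members = length-filter id F (λ _ → refl)

    total-unit : ∀ es → (∀ e → e List∈.∈ es → cost e ≡ [ 1ℚ ]) →
                 List.foldr _+∞_ [ 0ℚ ] (List.map cost es) ≡ [ ℕtoℚ (List.length es) ]
    total-unit []       h = refl
    total-unit (e ∷ es) h rewrite h e (here refl) | total-unit es (λ e′ e′∈ → h e′ (there e′∈)) =
      cong [_] (ℕtoℚ-suc (List.length es))

    total-finite : (∀ e → cost e ≡ [ 1ℚ ] ⊎ cost e ≡ ⊤⁺) → ∀ es {x} → List.foldr _+∞_ [ 0ℚ ] (List.map cost es) ≡ [ x ] →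
                   ∀ e → e List∈.∈ es → cost e ≡ [ 1ℚ ]
    total-finite h (e ∷ es) eq e′ e′∈ with h e
    ... | inj₂ c rewrite c with () ← eq
    ... | inj₁ c rewrite c with List.foldr _+∞_ [ 0ℚ ] (List.map cost es) in eq′ | e′∈
    ... | [ y ] | here refl  = c
    ... | [ y ] | there e′∈′ = total-finite h es eq′ e′ e′∈′

  total≡ : (∀ e → member e → cost e ≡ [ 1ℚ ]) → total ≡ [ ℕtoℚ ∣ F ∣ ]
  total≡ h = trans (total-unit members λ e e∈ → h e (∈⇒lookup (proj₂ (List∈ₚ.∈-filter⁻
      (Subsetₚ._∈? F) {xs = List.allFin n} e∈))))
                   (cong (λ m → [ ℕtoℚ m ]) length-members)

  -- A single summand ∞ makes the sum ∞, so a finite total excludes it.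
  finite⇒unit : (∀ e → cost e ≡ [ 1ℚ ] ⊎ cost e ≡ ⊤⁺) → ∀ {x} → total ≡ [ x ] → ∀ e → member e → cost e ≡ [ 1ℚ ]
  finite⇒unit h eq e e∈ = total-finite h members eq e
    (List∈ₚ.∈-filter⁺ (Subsetₚ._∈? F) (List∈ₚ.∈-allFin e) (lookup⇒∈ e∈))

-- (γ - 1) / (o - 1) exceeds γ / o by more than the error of n in each bundle.

n+n≤n³ : ∀ {n} → 2 ≤ n → n + n ≤ n ^ 3
n+n≤n³ {n@(suc _)} 2≤n = begin
  n + n               ≡⟨ cong (n +_) (+-identityʳ n) ⟨
  2 * n               ≤⟨ *-monoˡ-≤ n 2≤n ⟩
  n * n               ≤⟨ *-monoʳ-≤ n (≤-trans (≤-reflexive (sym (*-identityʳ n))) (m≤m*n (n * 1) n)) ⟩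
  n * (n * 1 * n)     ≡⟨ cong (n *_) (*-comm (n * 1) n) ⟩
  n ^ 3               ∎
  where open ≤-Reasoning

-- Put D = n³ - n. Apart from the common term o g D, the right side is g D, at least D + o D, and
-- the left side is o D plus the error (g + 1) o n. The error is at most D, since g + 1 ≤ n and o +
-- 1 ≤ n give n + (g + 1) o n ≤ n (o + 1) n ≤ n³. This is the origin of the exponent 3.
amplify : ∀ n o g → o < g → suc g ≤ n → suc g * (n ^ 3 * o) ≤ suc o * (g * (n ^ 3 ∸ n))
amplify n o g o<g g<n = begin
  suc g * (n ^ 3 * o)                      ≡⟨ cong (λ N → suc g * (N * o)) N≡ ⟩
  suc g * ((n + D) * o)                    ≡⟨ lemma g n D o ⟩
  suc g * o * n + (o * D + o * (g * D))    ≤⟨ +-monoˡ-≤ _ error≤ ⟩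
  D + (o * D + o * (g * D))                ≡⟨ +-assoc D (o * D) _ ⟨
  suc o * D + o * (g * D)                  ≤⟨ +-monoˡ-≤ (o * (g * D)) (*-monoˡ-≤ D o<g) ⟩
  suc o * (g * D)                          ∎
  where
  open ≤-Reasoning
  D = n ^ 3 ∸ n
  2≤n : 2 ≤ n
  2≤n = ≤-trans (s≤s (≤-trans (s≤s z≤n) o<g)) g<n
  N≡ : n ^ 3 ≡ n + D
  N≡ = sym (m+[n∸m]≡n (≤-trans (m≤m+n n n) (n+n≤n³ 2≤n)))
  lemma : ∀ g n D o → suc g * ((n + D) * o) ≡ suc g * o * n + (o * D + o * (g * D))
  lemma = solve-∀
  lemma′ : ∀ n o → n * o * n + n * n ≡ n * (suc o * n)
  lemma′ = solve-∀
  error≤ : suc g * o * n ≤ D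
  error≤ = +-cancelˡ-≤ n _ _ (begin
    n + suc g * o * n        ≤⟨ +-mono-≤ (≤-trans (≤-reflexive (sym (*-identityʳ n)))
        (*-monoʳ-≤ n (≤-trans (s≤s z≤n) 2≤n)))
                                         (*-monoˡ-≤ n (*-monoˡ-≤ o g<n)) ⟩
    n * n + n * o * n        ≡⟨ +-comm (n * n) _ ⟩
    n * o * n + n * n        ≡⟨ lemma′ n o ⟩
    n * (suc o * n)          ≤⟨ *-monoʳ-≤ n (*-monoˡ-≤ n (≤-trans o<g (≤-trans (n≤1+n g) g<n))) ⟩
    n * (n * n)              ≡⟨ cong (λ x → n * (n * x)) (*-identityʳ n) ⟨
    n ^ 3                    ≡⟨ N≡ ⟩
    n + D                    ∎)

-- In the application `x` is the number of edges of the cut, and `suc g` and `suc o` are the sizes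
-- of the neighbourhood found and of one to compare it with.
ratio : ∀ n o g x q → 1ℚ ℚ.≤ q → suc g ≤ n → g * (n ^ 3 ∸ n) ≤ x →
        ℕtoℚ x ℚ.≤ q ℚ.* ℕtoℚ (n ^ 3 * o) → ℕtoℚ (suc g) ℚ.≤ q ℚ.* ℕtoℚ (suc o)
ratio n o g x q 1≤q g<n lower upper with g ≤? o
... | yes g≤o = begin
  ℕtoℚ (suc g)             ≤⟨ ℕtoℚ-mono (s≤s g≤o) ⟩
  ℕtoℚ (suc o)             ≡⟨ ℚₚ.*-identityˡ (ℕtoℚ (suc o)) ⟨
  1ℚ ℚ.* ℕtoℚ (suc o)      ≤⟨ ℚₚ.*-monoʳ-≤-nonNeg (ℕtoℚ (suc o)) ⦃ ℕtoℚ-nonNeg (suc o) ⦄ 1≤q ⟩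
  q ℚ.* ℕtoℚ (suc o)       ∎
  where open ℚₚ.≤-Reasoning
... | no g≰o with n ^ 3 * o in M≡
-- A factor 0 cannot be cancelled, but it forces `x` to vanish, whereas `g * (n ^ 3 ∸ n)` is
-- positive.
... | zero = contradiction (≤-trans lower (ℕtoℚ-cancel {x} {0} (ℚₚ.≤-trans upper (ℚₚ.≤-reflexive (ℚₚ.*-zeroʳ q)))))
                           (<⇒≱ (*-mono-≤ (≤-trans (s≤s z≤n) o<g) D>0))
  where
  o<g = ≰⇒> g≰o
  2≤n : 2 ≤ n
  2≤n = ≤-trans (s≤s (≤-trans (s≤s z≤n) o<g)) g<n
  D>0 : 1 ≤ n ^ 3 ∸ n
  D>0 = m<n⇒0<n∸m (≤-trans (≤-trans (≤-reflexive (+-comm 1 n)) (+-monoʳ-≤ n (≤-trans (s≤s z≤n) 2≤n))) (n+n≤n³ 2≤n))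
... | suc m = ℚₚ.*-cancelʳ-≤-pos (ℕtoℚ (suc m)) ⦃ ℕtoℚ-pos m ⦄ (begin
  ℕtoℚ (suc g) ℚ.* M                ≡⟨ ℕtoℚ-* (suc g) (suc m) ⟨
  ℕtoℚ (suc g * suc m)              ≤⟨ ℕtoℚ-mono (≤-trans (subst (λ M → suc g * M ≤ suc o * (g * (n ^ 3 ∸ n)))
      M≡ (amplify n o g (≰⇒> g≰o) g<n)) (*-monoʳ-≤ (suc o) lower)) ⟩
  ℕtoℚ (suc o * x)                  ≡⟨ ℕtoℚ-* (suc o) x ⟩
  ℕtoℚ (suc o) ℚ.* ℕtoℚ x           ≤⟨ ℚₚ.*-monoˡ-≤-nonNeg (ℕtoℚ (suc o)) ⦃ ℕtoℚ-nonNeg (suc o) ⦄ upper ⟩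
  ℕtoℚ (suc o) ℚ.* (q ℚ.* M)        ≡⟨ ℚₚ.*-assoc (ℕtoℚ (suc o)) q M ⟨
  (ℕtoℚ (suc o) ℚ.* q) ℚ.* M        ≡⟨ cong (ℚ._* M) (ℚₚ.*-comm (ℕtoℚ (suc o)) q) ⟩
  (q ℚ.* ℕtoℚ (suc o)) ℚ.* M        ∎)
  where
  open ℚₚ.≤-Reasoning
  M = ℕtoℚ (suc m)

·∞-mono : ∀ q {x y} → 0ℚ ℚ.≤ q → x ≤∞ y → q ·∞ x ≤∞ q ·∞ y
·∞-mono q 0≤q Supₚ.[ x≤y ]   = Supₚ.[ ℚₚ.*-monoˡ-≤-nonNeg q ⦃ ℚ.nonNegative 0≤q ⦄ x≤y ]
·∞-mono q 0≤q (x Supₚ.≤⊤⁺)   = (q ·∞ x) Supₚ.≤⊤⁺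

0≤1 : 0ℚ ℚ.≤ 1ℚ
0≤1 = ℚₚ.nonNegative⁻¹ 1ℚ

-- Conversion of cuts and preservation of ratios

module Core (Q : Square) where

  open Construction Q

  empty full : Subset n
  empty = Vec.replicate n false
  full  = Vec.replicate n true

  large : Subset n → Bool
  large S = ∣ direct ∣ ≤ᵇ ∣ S ∣

  large-sound : ∀ {S} → large S ≡ true → ∣ direct ∣ ≤ ∣ S ∣
  large-sound {S} eq = ≤ᵇ⇒≤ _ _ (subst T (sym eq) tt)

  large-complete : ∀ {S} → ∣ direct ∣ ≤ ∣ S ∣ → large S ≡ true
  large-complete le = Equivalence.to T-≡ (≤⇒≤ᵇ le)

  choose : Subset n → Subset n → Subset n
  choose S S′ = if large S then S else S′

  choose-large : ∀ S {S′} → ∣ direct ∣ ≤ ∣ S′ ∣ → ∣ direct ∣ ≤ ∣ choose S S′ ∣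
  choose-large S le with large S in eq
  ... | true  = large-sound {S} eq
  ... | false = le

  -- The largest set without neighbours. It is large enough if and only if the optimum is 0, the
  -- case in which there is no neighbour to be guessed.
  isolated : Subset n
  isolated = inner adj empty

  module _ (F : Subset size-E) where

    open Lower Q F

    -- The default `full` is always large enough, so even a cut of infinite cost is converted to a
    -- solution. For finite cost, `large-block` and `firstLarge-closed` provide a set of the form
    -- `closed j`.
    firstLarge : List (Fin (suc n)) → Subset n
    firstLarge = List.foldr (λ j → choose (closed j)) full

    convertSquare : Subset n
    convertSquare = choose isolated (firstLarge (List.allFin (suc n)))

    firstLarge-large : ∀ js → ∣ direct ∣ ≤ ∣ firstLarge js ∣
    firstLarge-large []       = ≤-trans (Subsetₚ.∣p∣≤n direct) (≤-reflexive (sym (Subsetₚ.∣⊤∣≡n n)))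
    firstLarge-large (j ∷ js) = choose-large (closed j) (firstLarge-large js)

    convertSquare-large : ∣ direct ∣ ≤ ∣ convertSquare ∣
    convertSquare-large = choose-large isolated (firstLarge-large (List.allFin (suc n)))

    firstLarge-closed : ∀ js {j} → j List∈.∈ js → ∣ direct ∣ ≤ ∣ closed j ∣ → ∃[ j′ ] firstLarge js ≡ closed j′
    firstLarge-closed (j ∷ js) j∈ le with large (closed j) in eq
    ... | true = j , refl
    firstLarge-closed (j ∷ js) (here refl) le | false = ⊥-elim (true≢false (large-complete {closed j} le) eq)
    firstLarge-closed (j ∷ js) (there j∈)  le | false = firstLarge-closed js j∈ le

  cost-shape : ∀ e → Edge.cost (lookup (KRouteInstance.edge instance′) e) ≡ [ 1ℚ ]
                   ⊎ Edge.cost (lookup (KRouteInstance.edge instance′) e) ≡ ⊤⁺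
  cost-shape e rewrite Vecₚ.lookup∘tabulate (edgeAt ∘ unindex) e = shape (proj₂ (unindex e))
    where
    shape : ∀ sl → costOf sl ≡ [ 1ℚ ] ⊎ costOf sl ≡ ⊤⁺
    shape (bundle _ _) = inj₁ refl
    shape (unit _)     = inj₂ refl
    shape (slot _)     = inj₂ refl
    shape (pair _ _ _) = inj₂ refl

  Cheap : Subset size-E → Set
  Cheap F = ∀ j sl → lookup F (index j sl) ≡ true → costOf sl ≡ [ 1ℚ ]

  cheap⇒cost : ∀ F → Cheap F → totalCost F ≡ [ ℕtoℚ ∣ F ∣ ]
  cheap⇒cost F cheap = Costs.total≡ _ F λ e e∈ → at (indexed e) e∈
    where
    at : ∀ {e} → ∃[ j ] ∃[ sl ] index j sl ≡ e → lookup F e ≡ true →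
         Edge.cost (lookup (KRouteInstance.edge instance′) e) ≡ [ 1ℚ ]
    at (j , sl , refl) e∈ = trans (cong Edge.cost (lookup-edge j sl)) (cheap j sl e∈)

  cost⇒cheap : ∀ F {x} → totalCost F ≡ [ x ] → Cheap F
  cost⇒cheap F eq j sl e∈ = trans (sym (cong Edge.cost (lookup-edge j sl)))
    (Costs.finite⇒unit _ F cost-shape eq (index j sl) e∈)

  -- The guess of one neighbour saves its bundle, whence the factor `o` and not `suc o`.
  upper : ∀ S → ∣ direct ∣ ≤ ∣ S ∣ → ∀ o → ∣ neighbours adj S ∣ ≡ suc o →
          Σ[ F ∈ Subset size-E ] IsKRouteCut F × totalCost F ≤∞ [ ℕtoℚ (N * o) ]
  upper S le o eq = cut , cut-isCut , subst (_≤∞ [ ℕtoℚ (N * o) ]) (sym (cheap⇒cost cut cut-cheap))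
    Supₚ.[ ℕtoℚ-mono (≤-trans ∣cut∣≤ (≤-trans (*-monoˡ-≤ N (≤-pred (subst (suc ∣ rest ∣ ≤_) eq ∣rest∣<)))
        (≤-reflexive (*-comm o N)))) ]
    where
    first : ∃[ v ] lookup (neighbours adj S) v ≡ true
    first = enum (neighbours adj S) (subst Fin (sym eq) zero) , lookup-enum (neighbours adj S) _
    open Upper Q S le (proj₁ first) (proj₂ first)

  no-neighbours : ∀ S → ∣ direct ∣ ≤ ∣ S ∣ → ∣ neighbours adj S ∣ ≡ 0 → large isolated ≡ true
  no-neighbours S le eq = large-complete {isolated} (≤-trans le (∣∣-mono S isolated λ w w∈ →
    trans (Vecₚ.lookup∘tabulate _ w) (⊆ᵇ-complete (lookup adj w) empty λ i wi →
      contradiction (subst (1 ≤_) eq (members⇒≤ (neighbours adj S) (λ (_ : Fin 1) → i)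
        (λ { {zero} {zero} _ → refl }) (λ _ → neighbour adj S w i w∈ wi))) λ ())))

  isolated-neighbours : ∣ neighbours adj isolated ∣ ≡ 0
  isolated-neighbours = n≤0⇒n≡0 (members≤ (neighbours adj isolated) (λ ()) λ i ni →
    ⊥-elim (true≢false (neighbours-inner adj empty i ni) (Vecₚ.lookup-replicate i false)))

  -- Formulated for one rational bound `q` of the ratio and an arbitrary large set `S`, which later
  -- is the extension of an optimal solution of SSVE.
  module Preserve (F : Subset size-E) (isCut : IsKRouteCut F) (q : ℚ) (1≤q : 1ℚ ℚ.≤ q) (o′ : ℚ ⁺)
    (minimal : ∀ F′ → IsKRouteCut F′ → o′ ≤∞ totalCost F′) (near : totalCost F ≤∞ q ·∞ o′)
    (S : Subset n) (S-large : ∣ direct ∣ ≤ ∣ S ∣) where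

    private
      0≤q : 0ℚ ℚ.≤ q
      0≤q = ℚₚ.≤-trans 0≤1 1≤q

      zero≤ : ∀ m → ℕtoℚ 0 ℚ.≤ q ℚ.* ℕtoℚ m
      zero≤ m = ℚₚ.≤-trans (ℚₚ.≤-reflexive (sym (ℚₚ.*-zeroʳ q)))
        (ℚₚ.*-monoˡ-≤-nonNeg q ⦃ ℚ.nonNegative 0≤q ⦄ (ℕtoℚ-mono {0} {m} z≤n))

      bound : ∀ o γ → γ ≤ n → (γ ∸ 1) * (N ∸ n) ≤ ∣ F ∣ → ℕtoℚ ∣ F ∣ ℚ.≤ q ℚ.* ℕtoℚ (N * o) →
              ℕtoℚ γ ℚ.≤ q ℚ.* ℕtoℚ (suc o)
      bound o zero    _   _     _     = zero≤ (suc o)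
      bound o (suc g) g<n lower upper = ratio n o g ∣ F ∣ q 1≤q g<n lower upper

      γ≤ : ∀ o → ∣ neighbours adj S ∣ ≡ suc o →
           ℕtoℚ ∣ neighbours adj (firstLarge F (List.allFin (suc n))) ∣ ℚ.≤ q ℚ.* ℕtoℚ (suc o)
      γ≤ o eq = finite (totalCost F) refl
        (Supₚ.≤⁺-trans ℚₚ.≤-trans near (·∞-mono q 0≤q
          (Supₚ.≤⁺-trans ℚₚ.≤-trans (minimal (proj₁ U) (proj₁ (proj₂ U))) (proj₂ (proj₂ U)))))
        where
        U = upper S S-large o eq
        unit-cost : ∀ {x y z} → totalCost F ≡ [ x ] → totalCost F ≡ [ y ] → x ℚ.≤ z → y ℚ.≤ z
        unit-cost {z = z} x≡ y≡ x≤ = Supₚ.[≤]-injective (subst (_≤∞ [ z ]) (trans (sym x≡) y≡) Supₚ.[ x≤ ])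
        found : ∀ {j} → firstLarge F (List.allFin (suc n)) ≡ Lower.closed Q F j → ℕtoℚ ∣ F ∣ ℚ.≤ q ℚ.* ℕtoℚ (N * o) →
                ℕtoℚ ∣ neighbours adj (firstLarge F (List.allFin (suc n))) ∣ ℚ.≤ q ℚ.* ℕtoℚ (suc o)
        found {j} eq′ F≤ = subst (λ S′ → ℕtoℚ ∣ neighbours adj S′ ∣ ℚ.≤ q ℚ.* ℕtoℚ (suc o)) (sym eq′)
          (bound o _ (Subsetₚ.∣p∣≤n (neighbours adj (Lower.closed Q F j))) (Lower.Count.neighbours≤ Q F j) F≤)
        finite : ∀ c → totalCost F ≡ c → c ≤∞ [ q ℚ.* ℕtoℚ (N * o) ] →
                 ℕtoℚ ∣ neighbours adj (firstLarge F (List.allFin (suc n))) ∣ ℚ.≤ q ℚ.* ℕtoℚ (suc o)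
        -- The cost cannot be ∞, because it is bounded by a finite number.
        finite [ x ] x≡ Supₚ.[ x≤ ] =
          let cheap = cost⇒cheap F x≡
              (j , j-large) = Lower.large-block Q F cheap isCut
          in found (proj₂ (firstLarge-closed F (List.allFin (suc n)) (List∈ₚ.∈-allFin j) j-large))
                   (unit-cost x≡ (cheap⇒cost F cheap) x≤)

    preserved : ℕtoℚ ∣ neighbours adj (convertSquare F) ∣ ℚ.≤ q ℚ.* ℕtoℚ ∣ neighbours adj S ∣
    preserved = split (large isolated) refl ∣ neighbours adj S ∣ refl
      where
      split : ∀ b → large isolated ≡ b → ∀ m → ∣ neighbours adj S ∣ ≡ m →
              ℕtoℚ ∣ neighbours adj (if b then isolated else firstLarge F (List.allFin (suc n))) ∣ ℚ.≤ q ℚ.* ℕtoℚ m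
      split true  iso m       eq = subst (λ x → ℕtoℚ x ℚ.≤ q ℚ.* ℕtoℚ m) (sym isolated-neighbours) (zero≤ m)
      split false iso zero    eq = ⊥-elim (true≢false (no-neighbours S S-large eq) iso)
      split false iso (suc o) eq = γ≤ o eq

  private
    Cut : Set
    Cut = Σ (Subset size-E) IsKRouteCut

    price : Cut → ℚ ⁺
    price (F , _) = totalCost F

  -- This solution takes the part of the optimum if no cut has finite cost.
  all-edges-cut : IsKRouteCut (Vec.replicate size-E true)
  all-edges-cut r D = ≤-trans (Crossing.paths≤cut Q σ refl refl _ {0} (λ ())
    (λ j sl out _ → ⊥-elim (true≢false (Vecₚ.lookup-replicate (index j sl) true) out)) D) z≤n
    where
    σ : Nd → Bool
    σ (zero  , _) = true
    σ (suc _ , _) = false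

  -- Values are natural numbers or ∞, so a solution that cannot be improved
  -- exists by well-foundedness; finding it would require deciding IsKRouteCut.

  ¬¬optimum : ¬ ¬ (∃[ o ] MinProblem.IsOptimum KRouteCut instance′ o)
  ¬¬optimum none = none (⊤⁺ , (all , price-all) , λ S → ⊤≤ S (price S) refl)
    where
    descend : ∀ m (S : Cut) → Cheap (proj₁ S) → ∣ proj₁ S ∣ ≤ m → ⊥
    descend m S cheap ≤m = none (price S , (S , refl) , λ S′ → smaller S′ (price S′) refl)
      where
      price≡ : price S ≡ [ ℕtoℚ ∣ proj₁ S ∣ ]
      price≡ = cheap⇒cost (proj₁ S) cheap
      below : ∀ m (S′ : Cut) → Cheap (proj₁ S′) → ∣ proj₁ S ∣ ≤ m → ∣ proj₁ S′ ∣ < ∣ proj₁ S ∣ → ⊥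
      below zero    S′ cheap′ ≤m lt = contradiction (≤-trans lt ≤m) λ ()
      below (suc m) S′ cheap′ ≤m lt = descend′ (≤-pred (≤-trans lt ≤m))
        where descend′ : ∣ proj₁ S′ ∣ ≤ m → ⊥
              descend′ = descend m S′ cheap′
      smaller : ∀ S′ c → price S′ ≡ c → price S ≤∞ price S′
      smaller S′ ⊤⁺    eq = subst (price S ≤∞_) (sym eq) (price S Supₚ.≤⊤⁺)
      smaller S′ [ x ] eq with ∣ proj₁ S ∣ ≤? ∣ proj₁ S′ ∣
      ... | yes le = subst₂ _≤∞_ (sym price≡) (sym (cheap⇒cost (proj₁ S′) (cost⇒cheap (proj₁ S′) eq)))
          Supₚ.[ ℕtoℚ-mono le ]
      ... | no ≰   = ⊥-elim (below m S′ (cost⇒cheap (proj₁ S′) eq) ≤m (≰⇒> ≰))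
    all : Cut
    all = Vec.replicate size-E true , all-edges-cut
    infinite : ∀ (S : Cut) c → price S ≡ c → c ≡ ⊤⁺
    infinite S ⊤⁺    eq = refl
    infinite S [ x ] eq = ⊥-elim (descend ∣ proj₁ S ∣ S (cost⇒cheap (proj₁ S) eq) ≤-refl)
    price-all : price all ≡ ⊤⁺
    price-all = infinite all (price all) refl
    ⊤≤ : ∀ S c → price S ≡ c → ⊤⁺ ≤∞ price S
    ⊤≤ S c eq = subst (⊤⁺ ≤∞_) (sym (infinite S (price S) refl)) (⊤⁺ Supₚ.≤⊤⁺)

-- Vectors as lists

applyUpTo≡tabulate : {X : Set} (g : ℕ → X) → ∀ m → List.applyUpTo g m ≡ List.tabulate {n = m} (g ∘ toℕ)
applyUpTo≡tabulate g zero    = refl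
applyUpTo≡tabulate g (suc m) = cong (g 0 ∷_) (applyUpTo≡tabulate (g ∘ suc) m)

upTo≡allFin : ∀ m → List.upTo m ≡ List.map toℕ (List.allFin m)
upTo≡allFin m = trans (applyUpTo≡tabulate id m) (sym (Listₚ.map-tabulate id toℕ))

tabulate≡map-upTo : {X : Set} {m : ℕ} (h : Fin m → X) (g : ℕ → X) → (∀ x → h x ≡ g (toℕ x)) →
                    List.tabulate h ≡ List.map g (List.upTo m)
tabulate≡map-upTo {m = m} h g eq = begin
  List.tabulate h                          ≡⟨ Listₚ.tabulate-cong eq ⟩
  List.tabulate (g ∘ toℕ)                  ≡⟨ applyUpTo≡tabulate g m ⟨
  List.applyUpTo g m                       ≡⟨ Listₚ.map-applyUpTo id g m ⟨
  List.map g (List.upTo m)                 ∎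
  where open ≡-Reasoning

concat-tabulate : {X : Set} {m : ℕ} (h : Fin m → List X) (g : ℕ → List X) → (∀ x → h x ≡ g (toℕ x)) →
                  List.concat (List.tabulate h) ≡ List.concatMap g (List.upTo m)
concat-tabulate h g eq = cong List.concat (tabulate≡map-upTo h g eq)

tabulate-+ : {X : Set} → ∀ m {k} (f : Fin (m + k) → X) →
             List.tabulate f ≡ List.tabulate (f ∘ (_↑ˡ k)) ++ List.tabulate (f ∘ (m ↑ʳ_))
tabulate-+ zero    f = refl
tabulate-+ (suc m) f = cong (f zero ∷_) (tabulate-+ m (f ∘ suc))

tabulate-* : {X : Set} → ∀ m {k} (f : Fin (m * k) → X) →
             List.tabulate f ≡ List.concat (List.tabulate λ i → List.tabulate λ j → f (combine {m} i j))
tabulate-* zero        f = refl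
tabulate-* (suc m) {k} f = trans (tabulate-+ k f)
  (cong (List.tabulate (f ∘ (_↑ˡ (m * k))) ++_) (tabulate-* m (f ∘ (k ↑ʳ_))))

encVec≡ : {X : Set} (ex : X → Tree) → ∀ {m} (v : Vec X m) → encVec ex v ≡ encList ex (Vec.toList v)
encVec≡ ex []      = refl
encVec≡ ex (x ∷ v) = cong (ex x ∙_) (encVec≡ ex v)

encVec-tabulate : {X : Set} (ex : X → Tree) → ∀ {m} (f : Fin m → X) →
                  encVec ex (tabulate f) ≡ encList tree (List.tabulate (ex ∘ f))
encVec-tabulate ex {zero}  f = refl
encVec-tabulate ex {suc m} f = cong (ex (f zero) ∙_) (encVec-tabulate ex (f ∘ suc))

nth-toList : {X : Set} (d : X) → ∀ {m} (v : Vec X m) x → nth d (Vec.toList v) (toℕ x) ≡ lookup v x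
nth-toList d (y ∷ v) zero    = refl
nth-toList d (y ∷ v) (suc x) = nth-toList d v x

rows : ∀ {m k} → Vec (Subset k) m → List (List Bool)
rows v = List.map Vec.toList (Vec.toList v)

nth-rows : ∀ {m k} (v : Vec (Subset k) m) w → nth [] (rows v) (toℕ w) ≡ Vec.toList (lookup v w)
nth-rows (r ∷ v) zero    = refl
nth-rows (r ∷ v) (suc w) = nth-rows v w

encRows : ∀ {m k} (v : Vec (Subset k) m) → encVec encSubset v ≡ encList (encList encBool) (rows v)
encRows []      = refl
encRows (r ∷ v) = cong₂ _∙_ (encVec≡ encBool r) (encRows v)

toList-tabulate : {X : Set} → ∀ {m} (h : Fin m → X) (g : ℕ → X) → (∀ x → h x ≡ g (toℕ x)) →
                  Vec.toList (tabulate h) ≡ List.map g (List.upTo m)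
toList-tabulate h g eq = trans (toList-tab h) (tabulate≡map-upTo h g eq)
  where
  toList-tab : {X : Set} → ∀ {m} (h : Fin m → X) → Vec.toList (tabulate h) ≡ List.tabulate h
  toList-tab {m = zero}  h = refl
  toList-tab {m = suc m} h = cong (h zero ∷_) (toList-tab (h ∘ suc))

downTo≡foldr : {S : Set} (st : ℕ → S → S) → ∀ m s → downTo st m s ≡ List.foldr st s (List.upTo m)
downTo≡foldr st zero    s = refl
downTo≡foldr st (suc m) s = begin
  downTo st m (st m s)                          ≡⟨ downTo≡foldr st m (st m s) ⟩
  List.foldr st (st m s) (List.upTo m)          ≡⟨ Listₚ.foldr-++ st s (List.upTo m) (m ∷ []) ⟨
  List.foldr st s (List.upTo m List.∷ʳ m)       ≡⟨ cong (List.foldr st s) (Listₚ.upTo-∷ʳ m) ⟩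
  List.foldr st s (List.upTo (suc m))           ∎
  where open ≡-Reasoning

downTo≡foldr-allFin : {S : Set} (st : ℕ → S → S) → ∀ m s → downTo st m s ≡ List.foldr (st ∘ toℕ) s (List.allFin m)
downTo≡foldr-allFin st m s = trans (downTo≡foldr st m s) (trans (cong (List.foldr st s) (upTo≡allFin m))
  (foldr-map (List.allFin m)))
  where
  foldr-map : ∀ xs → List.foldr st s (List.map toℕ xs) ≡ List.foldr (st ∘ toℕ) s xs
  foldr-map []       = refl
  foldr-map (x ∷ xs) = cong (st (toℕ x)) (foldr-map xs)

count : (ℕ → Bool) → ℕ → ℕ
count f m = downTo (λ c s → if f c then suc s else s) m 0

count≡ : ∀ {m} (f : ℕ → Bool) (p : Subset m) → (∀ x → f (toℕ x) ≡ lookup p x) → count f m ≡ ∣ p ∣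
count≡ {m} f p eq = trans (downTo≡foldr-allFin _ m 0) (go id p eq)
  where
  go : ∀ {k} (h : Fin k → Fin m) (p : Subset k) → (∀ x → f (toℕ (h x)) ≡ lookup p x) →
       List.foldr (λ x s → if f (toℕ x) then suc s else s) 0 (List.tabulate h) ≡ ∣ p ∣
  go h []          eq = refl
  go h (true  ∷ p) eq rewrite eq zero = cong suc (go (h ∘ suc) p (eq ∘ suc))
  go h (false ∷ p) eq rewrite eq zero = go (h ∘ suc) p (eq ∘ suc)

forAll : (ℕ → Bool) → ℕ → Bool
forAll f m = downTo (λ c s → f c ∧ s) m true

forAll≡ : ∀ {m} (f : ℕ → Bool) (p q : Subset m) → (∀ x → f (toℕ x) ≡ not (lookup p x) ∨ lookup q x) →
          forAll f m ≡ p ⊆ᵇ q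
forAll≡ {m} f p q eq = trans (downTo≡foldr-allFin _ m true) (go id p q eq)
  where
  go : ∀ {k} (h : Fin k → Fin m) (p q : Subset k) → (∀ x → f (toℕ (h x)) ≡ not (lookup p x) ∨ lookup q x) →
       List.foldr (λ x s → f (toℕ x) ∧ s) true (List.tabulate h) ≡ p ⊆ᵇ q
  go h []      []      eq = refl
  go h (x ∷ p) (y ∷ q) eq = cong₂ _∧_ (eq zero) (go (h ∘ suc) p q (eq ∘ suc))

module _ {A : Set} {i : A → Tree} where

  countP : {n : A → ℕ} {f : A × ℕ → Bool} → Poly i unary n → Poly (λ (a , m) → unary m ∙ i a) encBool f →
           Poly i unary (λ a → count (λ m → f (a , m)) (n a))
  countP {f = f} nP p = downToP (ifP (outsideP p) (sucP accP) accP) (pb-const 2)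
      (λ a m s → grow (f (a , m)) s) nP (constP 0)
    where
    grow : ∀ b s → size (unary (if b then suc s else s)) ≤ size (unary s) + 2
    grow false s = m≤m+n _ 2
    grow true  s = ≤-reflexive (+-comm 2 (size (unary s)))

  forAllP : {n : A → ℕ} {f : A × ℕ → Bool} → Poly i unary n → Poly (λ (a , m) → unary m ∙ i a) encBool f →
            Poly i encBool (λ a → forAll (λ m → f (a , m)) (n a))
  forAllP {f = f} nP p = downToP {g = const 3} (andP (outsideP p) accP) (pb-const 3)
    (λ a m s → ≤-trans (size-encBool≤ (f (a , m) ∧ s)) (m≤n+m 3 _)) nP (constP true)

-- The constructed instance as a tree

edgeTree : Bool → ℕ → ℕ → Tree
edgeTree cheap a b = unary a ∙ (unary b ∙ (if cheap then encℚ∞ [ 1ℚ ] else nil))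

-- The number that `combine` assigns to the local node `x` of block `b`, since each block number
-- comprises 3 + 2n nodes.
nodeNumber : ℕ → ℕ → ℕ → ℕ
nodeNumber n b x = (3 + (n + n)) * b + x

bundleTree unitTree : ℕ → ℕ → ℕ → Tree
bundleTree n j i = edgeTree true (nodeNumber n j (3 + (n + i))) (nodeNumber n (suc j) 0)
unitTree n j w   = edgeTree false (nodeNumber n j 0) (nodeNumber n j (3 + w))

slotTree : ℕ → List Bool → ℕ → ℕ → Tree
slotTree n ds j w = if nth false ds w then edgeTree false (nodeNumber n j 0) (nodeNumber n (suc j) 0)
                                      else edgeTree false (nodeNumber n j 1) (nodeNumber n j 2)

adjacent : List (List Bool) → ℕ → ℕ → Bool
adjacent rs w i = nth false (nth [] rs w) i

pairTrees : ℕ → List (List Bool) → ℕ → ℕ → ℕ → List Tree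
pairTrees n rs j w i = if adjacent rs w i ∧ not (i ≡ᵇ j)
  then edgeTree false (at 0) (at (3 + (n + i))) ∷ edgeTree false (at (3 + (n + i))) (at (3 + w))
       ∷ edgeTree false (at (3 + w)) next ∷ []
  else edgeTree false (at 0) (at 2) ∷ edgeTree false (at 2) (at 1) ∷ edgeTree false (at 1) next ∷ []
  where
  at = nodeNumber n j
  next = nodeNumber n (suc j) 0

-- The four lists stand in the order in which `encodeSlot` numbers the slots.
blockTrees : ℕ → List (List Bool) → List Bool → ℕ → List Tree
blockTrees n rs ds j =
  List.concatMap (λ i → List.map (λ c → bundleTree n j i) (List.upTo (n ^ 3))) (List.upTo n) ++
  (List.map (unitTree n j) (List.upTo n) ++ (List.map (slotTree n ds j) (List.upTo n) ++
   List.concatMap (λ w → List.concatMap (pairTrees n rs j w) (List.upTo n)) (List.upTo n)))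

instanceTree : ℕ → List (List Bool) → List Bool → Tree
instanceTree n rs ds =
  unary ((2 + n) * (3 + (n + n))) ∙ (encList tree (List.concatMap (blockTrees n rs ds) (List.upTo (suc n)))
  ∙ (unary 0 ∙ (unary (nodeNumber n (suc n) 0) ∙ binary (suc (n * n + n)))))

encBits₂ : List Bool → Tree
encBits₂ = encList encBool

encRows₂ : List (List Bool) → Tree
encRows₂ = encList encBits₂

module _ {A : Set} {i : A → Tree} where

  edgeTreeP : (c : Bool) {a b : A → ℕ} → Poly i unary a → Poly i unary b → Poly i tree (λ x → edgeTree c (a x) (b x))
  edgeTreeP c p q = recode (λ _ → refl) (p ⊙ q ⊙ constP {e = tree} (if c then encℚ∞ [ 1ℚ ] else nil))

  plusP : ∀ k {f : A → ℕ} → Poly i unary f → Poly i unary (λ x → k + f x)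
  plusP k p = addP (constP k) p

  nodeNumberP : {n b x : A → ℕ} → Poly i unary n → Poly i unary b → Poly i unary x →
                Poly i unary (λ a → nodeNumber (n a) (b a) (x a))
  nodeNumberP n b x = addP (mulP (plusP 3 (addP n n)) b) x

  adjacentP : {rs : A → List (List Bool)} {w v : A → ℕ} → Poly i encRows₂ rs → Poly i unary w → Poly i unary v →
              Poly i encBool (λ a → adjacent (rs a) (w a) (v a))
  adjacentP rs w v = nthP false refl (nthP [] refl rs w) v

  cubeP : {n : A → ℕ} → Poly i unary n → Poly i unary (λ a → n a ^ 3)
  cubeP n = mulP n (mulP n (mulP n (constP 1)))

module _ {A : Set} {i : A → Tree} {n : A → ℕ} {rs : A → List (List Bool)} {ds : A → List Bool}
         (nP : Poly i unary n) (rsP : Poly i encRows₂ rs) (dsP : Poly i encBits₂ ds) where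

  private
    i₁ : A × ℕ → Tree
    i₁ (a , j) = unary j ∙ i a
    i₂ : (A × ℕ) × ℕ → Tree
    i₂ (a , w) = unary w ∙ i₁ a
    i₃ : ((A × ℕ) × ℕ) × ℕ → Tree
    i₃ (a , v) = unary v ∙ i₂ a

    up : {B : Set} {e : B → Tree} {f : A → B} → Poly i e f → Poly i₁ e (f ∘ proj₁)
    up = weakenP
    up₁ : {B : Set} {e : B → Tree} {f : A × ℕ → B} → Poly i₁ e f → Poly i₂ e (f ∘ proj₁)
    up₁ = weakenP
    up₂ : {B : Set} {e : B → Tree} {f : (A × ℕ) × ℕ → B} → Poly i₂ e f → Poly i₃ e (f ∘ proj₁)
    up₂ = weakenP

    j₁ : Poly i₁ unary proj₂
    j₁ = topP
    n₂ : Poly i₂ unary (n ∘ proj₁ ∘ proj₁)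
    n₂ = up₁ (up nP)
    j₂ : Poly i₂ unary (proj₂ ∘ proj₁)
    j₂ = up₁ j₁
    w₂ : Poly i₂ unary proj₂
    w₂ = topP

    bundleP : Poly i₁ (encList tree) (λ (a , j) →
      List.concatMap (λ i → List.map (λ c → bundleTree (n a) j i) (List.upTo (n a ^ 3))) (List.upTo (n a)))
    bundleP = concatUpToP {f = λ ((a , j) , i) → List.map (λ c → bundleTree (n a) j i) (List.upTo (n a ^ 3))} (up nP)
      (mapUpToP {f = λ (((a , j) , i) , c) → bundleTree (n a) j i} (cubeP n₂) (up₂
        (edgeTreeP true (nodeNumberP n₂ j₂ (plusP 3 (addP n₂ w₂))) (nodeNumberP n₂ (sucP j₂) (constP 0)))))

    unitP : Poly i₁ (encList tree) (λ (a , j) → List.map (unitTree (n a) j) (List.upTo (n a)))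
    unitP = mapUpToP {f = λ ((a , j) , w) → unitTree (n a) j w} (up nP)
      (edgeTreeP false (nodeNumberP n₂ j₂ (constP 0)) (nodeNumberP n₂ j₂ (plusP 3 w₂)))

    slotP : Poly i₁ (encList tree) (λ (a , j) → List.map (slotTree (n a) (ds a) j) (List.upTo (n a)))
    slotP = mapUpToP {f = λ ((a , j) , w) → slotTree (n a) (ds a) j w} (up nP)
      (ifP (nthP false refl (up₁ (up dsP)) w₂)
        (edgeTreeP false (nodeNumberP n₂ j₂ (constP 0)) (nodeNumberP n₂ (sucP j₂) (constP 0)))
        (edgeTreeP false (nodeNumberP n₂ j₂ (constP 1)) (nodeNumberP n₂ j₂ (constP 2))))

    pairP₃ : Poly i₃ (encList tree) (λ (((a , j) , w) , v) → pairTrees (n a) (rs a) j w v)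
    pairP₃ = ifP (andP (adjacentP (up₂ (up₁ (up rsP))) w₃ v₃) (notP (eqP v₃ (up₂ j₂))))
      (consP (edgeTreeP false (at (constP 0)) (at right)) (consP (edgeTreeP false (at right) (at (plusP 3 w₃)))
        (consP (edgeTreeP false (at (plusP 3 w₃)) next) (constP []))))
      (consP (edgeTreeP false (at (constP 0)) (at (constP 2))) (consP (edgeTreeP false (at (constP 2)) (at (constP 1)))
        (consP (edgeTreeP false (at (constP 1)) next) (constP []))))
      where
      n₃ = up₂ n₂
      w₃ = up₂ w₂
      v₃ : Poly i₃ unary proj₂
      v₃ = topP
      right = plusP 3 (addP n₃ v₃)
      at : {f : ((A × ℕ) × ℕ) × ℕ → ℕ} → Poly i₃ unary f → Poly i₃ unary
          (λ (((a , j) , w) , v) → nodeNumber (n a) j (f (((a , j) , w) , v)))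
      at = nodeNumberP n₃ (up₂ j₂)
      next = nodeNumberP n₃ (sucP (up₂ j₂)) (constP 0)

    pairsP : Poly i₁ (encList tree) (λ (a , j) →
      List.concatMap (λ w → List.concatMap (pairTrees (n a) (rs a) j w) (List.upTo (n a))) (List.upTo (n a)))
    pairsP = concatUpToP {f = λ ((a , j) , w) → List.concatMap (pairTrees (n a) (rs a) j w) (List.upTo (n a))} (up nP)
      (concatUpToP {f = λ (((a , j) , w) , v) → pairTrees (n a) (rs a) j w v} n₂ pairP₃)

  instanceTreeP : Poly i tree (λ a → instanceTree (n a) (rs a) (ds a))
  instanceTreeP = recode (λ _ → refl)
    (mulP (plusP 2 nP) (plusP 3 (addP nP nP))
     ⊙ concatUpToP {f = λ (a , j) → blockTrees (n a) (rs a) (ds a) j} (sucP nP)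
         (appendP bundleP (appendP unitP (appendP slotP pairsP)))
     ⊙ constP {e = unary} 0 ⊙ nodeNumberP nP (sucP nP) (constP 0) ⊙ binaryP (sucP (addP (mulP nP nP) nP)))

encSquare : Square → Tree
encSquare Q = unary n ∙ (encVec encSubset adj ∙ encSubset direct)
  where open Square Q

module _ where

  open Square

  sizeP : Poly encSquare unary n
  sizeP = recode (λ _ → refl) (hdP idP)

  rowsP : Poly encSquare encRows₂ (rows ∘ adj)
  rowsP = recode (λ Q → encRows (adj Q)) (hdP (tlP idP))

  directP : Poly encSquare encBits₂ (Vec.toList ∘ direct)
  directP = recode (λ Q → encVec≡ encBool (direct Q)) (tlP (tlP idP))

module Encoding (Q : Square) where

  open Construction Q

  toℕ-node : ∀ b x → toℕ (node (b , x)) ≡ nodeNumber n (toℕ b) (toℕ (encodeLocal x))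
  toℕ-node b x = Finₚ.toℕ-combine b (encodeLocal x)

  toℕ-here : ∀ j x → toℕ (node (inject₁ j , x)) ≡ nodeNumber n (toℕ j) (toℕ (encodeLocal x))
  toℕ-here j x = trans (toℕ-node (inject₁ j) x) (cong (λ b → nodeNumber n b (toℕ (encodeLocal x))) (Finₚ.toℕ-inject₁ j))

  toℕ-L : ∀ j w → toℕ (node (inject₁ j , L w)) ≡ nodeNumber n (toℕ j) (3 + toℕ w)
  toℕ-L j w = trans (toℕ-here j (L w)) (cong (λ x → nodeNumber n (toℕ j) (3 + x)) (Finₚ.toℕ-↑ˡ w n))

  toℕ-R : ∀ j i → toℕ (node (inject₁ j , R i)) ≡ nodeNumber n (toℕ j) (3 + (n + toℕ i))
  toℕ-R j i = trans (toℕ-here j (R i)) (cong (λ x → nodeNumber n (toℕ j) (3 + x)) (Finₚ.toℕ-↑ʳ n i))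

  toℕ-next : ∀ j → toℕ (node (suc j , P)) ≡ nodeNumber n (suc (toℕ j)) 0
  toℕ-next j = toℕ-node (suc j) P

  edgeTree≡ : ∀ c {a b x y} → a ≡ x → b ≡ y → edgeTree c a b ≡ edgeTree c x y
  edgeTree≡ c = cong₂ (edgeTree c)

  slotTreeOf : Fin (suc n) → Slot n N → Tree
  slotTreeOf j sl = encEdge (edgeAt (j , sl))

  rs = rows adj
  ds = Vec.toList direct

  lookup-rows : ∀ w i → adjacent rs (toℕ w) (toℕ i) ≡ lookup (lookup adj w) i
  lookup-rows w i = trans (cong (λ r → nth false r (toℕ i)) (nth-rows adj w)) (nth-toList false (lookup adj w) i)

  unit≡ : ∀ j w → slotTreeOf j (unit w) ≡ unitTree n (toℕ j) (toℕ w)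
  unit≡ j w = edgeTree≡ false (toℕ-here j P) (toℕ-L j w)

  bundle≡ : ∀ j i c → slotTreeOf j (bundle i c) ≡ bundleTree n (toℕ j) (toℕ i)
  bundle≡ j i c = edgeTree≡ true (toℕ-R j i) (toℕ-next j)

  slot≡ : ∀ j w → slotTreeOf j (slot w) ≡ slotTree n ds (toℕ j) (toℕ w)
  slot≡ j w rewrite nth-toList false direct w with lookup direct w
  ... | true  = edgeTree≡ false (toℕ-here j P) (toℕ-next j)
  ... | false = edgeTree≡ false (toℕ-here j Z₁) (toℕ-here j Z₂)

  pair≡ : ∀ j w i → List.tabulate (λ c → slotTreeOf j (pair w i c)) ≡ pairTrees n rs (toℕ j) (toℕ w) (toℕ i)
  pair≡ j w i rewrite lookup-rows w i with active j w i
  ... | true  = cong₂ _∷_ (edgeTree≡ false (toℕ-here j P) (toℕ-R j i))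
                  (cong₂ _∷_ (edgeTree≡ false (toℕ-R j i) (toℕ-L j w))
                  (cong (_∷ []) (edgeTree≡ false (toℕ-L j w) (toℕ-next j))))
  ... | false = cong₂ _∷_ (edgeTree≡ false (toℕ-here j P) (toℕ-here j Z₂))
                  (cong₂ _∷_ (edgeTree≡ false (toℕ-here j Z₂) (toℕ-here j Z₁))
                  (cong (_∷ []) (edgeTree≡ false (toℕ-here j Z₁) (toℕ-next j))))

  -- With `f` arbitrary, the index range is split first, and its pieces are literally values of
  -- `encodeSlot`. Decoding is left to the premise.
  block≡ : ∀ j (f : Fin (slots n N) → Tree) → (∀ sl → f (encodeSlot sl) ≡ slotTreeOf j sl) →
           List.tabulate f ≡ blockTrees n rs ds (toℕ j)
  block≡ j f eq = trans (tabulate-+ (n * N) f) (cong₂ _++_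
    (trans (tabulate-* n _) (concat-tabulate _ _ λ i → tabulate≡map-upTo _ _ λ c →
        trans (eq (bundle i c)) (bundle≡ j i c)))
    (trans (tabulate-+ n _) (cong₂ _++_
      (tabulate≡map-upTo _ _ λ w → trans (eq (unit w)) (unit≡ j w))
      (trans (tabulate-+ n _) (cong₂ _++_
        (tabulate≡map-upTo _ _ λ w → trans (eq (slot w)) (slot≡ j w))
        (trans (tabulate-* n _) (concat-tabulate _ _ λ w →
          trans (tabulate-* n _) (concat-tabulate _ _ λ i →
            trans (Listₚ.tabulate-cong (λ c → eq (pair w i c))) (pair≡ j w i)))))))))

  edges≡ : List.tabulate (encEdge ∘ edgeAt ∘ unindex) ≡ List.concatMap (blockTrees n rs ds) (List.upTo (suc n))
  edges≡ = trans (tabulate-* (suc n) _) (concat-tabulate _ _ λ j →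
    block≡ j (λ x → encEdge (edgeAt (unindex (combine j x)))) λ sl → cong (encEdge ∘ edgeAt) (unindex-index j sl))

  instance≡ : instanceTree n rs ds ≡ MinProblem.encI KRouteCut instance′
  instance≡ = cong (unary ((2 + n) * (3 + (n + n))) ∙_) (cong₂ _∙_
    (trans (cong (encList tree) (sym edges≡)) (sym (encVec-tabulate encEdge (edgeAt ∘ unindex))))
    (cong₂ _∙_ (cong unary (sym (trans (toℕ-node zero P) (trans (+-identityʳ _) (*-zeroʳ (3 + (n + n)))))))
    (cong (λ t → unary t ∙ binary (suc routes)) (sym (trans (toℕ-node (fromℕ (suc n)) P)
      (cong (λ b → nodeNumber n b 0) (Finₚ.toℕ-fromℕ (suc n))))))))

reduceSquareP : Poly encSquare tree (λ Q → MinProblem.encI KRouteCut (Construction.instance′ Q))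
reduceSquareP = recode Encoding.instance≡ (instanceTreeP sizeP rowsP directP)

-- The conversion as a computation with lists

keptEdge : ℕ → List Bool → ℕ → ℕ → ℕ → Bool
keptEdge n Fs j i c = not (nth false Fs (slots n (n ^ 3) * j + (n ^ 3 * i + c)))

leftEdges : ℕ → List Bool → ℕ → ℕ → ℕ
leftEdges n Fs j i = count (keptEdge n Fs j i) (n ^ 3)

maskList : ℕ → List Bool → ℕ → List Bool
maskList n Fs j = List.map (λ i → (i ≡ᵇ j) ∨ (suc (leftEdges n Fs j i) ≤ᵇ n)) (List.upTo n)

innerList : ℕ → List (List Bool) → List Bool → List Bool
innerList n rs m = List.map (λ w → forAll (λ i → not (adjacent rs w i) ∨ nth false m i) n) (List.upTo n)

constList : Bool → ℕ → List Bool
constList b n = List.map (const b) (List.upTo n)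

chooseList : ℕ → List Bool → List Bool → List Bool → List Bool
chooseList n ds S S′ = if count (nth false ds) n ≤ᵇ count (nth false S) n then S else S′

convertList : ℕ → List (List Bool) → List Bool → List Bool → List Bool
convertList n rs ds Fs = chooseList n ds (innerList n rs (constList false n))
  (downTo (λ j → chooseList n ds (innerList n rs (maskList n Fs j))) (suc n) (constList true n))

module _ {A : Set} {i : A → Tree} {n : A → ℕ} (nP : Poly i unary n) where

  private
    i₁ : A × ℕ → Tree
    i₁ (a , j) = unary j ∙ i a
    i₂ : (A × ℕ) × ℕ → Tree
    i₂ (a , w) = unary w ∙ i₁ a

  constListP : ∀ b → Poly i encBits₂ (λ a → constList b (n a))
  constListP b = mapUpToP {f = const b} nP (constP b)

  innerListP : {rs : A → List (List Bool)} {m : A → List Bool} → Poly i encRows₂ rs → Poly i encBits₂ m →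
               Poly i encBits₂ (λ a → innerList (n a) (rs a) (m a))
  innerListP {rs} {m} rsP mP = mapUpToP {f = λ (a , w) → forAll (λ i → not (adjacent (rs a) w i) ∨ nth false (m a) i)
                                                   (n a)} nP
    (forAllP {f = λ ((a , w) , i) → not (adjacent (rs a) w i) ∨ nth false (m a) i} (weakenP nP)
      (orP (notP (adjacentP (weakenP {i = i₁} (weakenP rsP)) (weakenP {i = i₁} topP) topP))
           (nthP false refl (weakenP {i = i₁} (weakenP mP)) topP)))

  chooseListP : {ds S S′ : A → List Bool} → Poly i encBits₂ ds → Poly i encBits₂ S → Poly i encBits₂ S′ →
                Poly i encBits₂ (λ a → chooseList (n a) (ds a) (S a) (S′ a))
  chooseListP {ds} {S} dsP SP S′P = ifP
    (leqP (countP {f = λ (a , m) → nth false (ds a) m} nP (nthP false refl (weakenP dsP) topP))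
          (countP {f = λ (a , m) → nth false (S a) m} nP (nthP false refl (weakenP SP) topP))) SP S′P

  maskListP : {Fs : A → List Bool} {j : A → ℕ} → Poly i encBits₂ Fs → Poly i unary j →
              Poly i encBits₂ (λ a → maskList (n a) (Fs a) (j a))
  maskListP {Fs} {j} FsP jP = mapUpToP {f = λ (a , i) → (i ≡ᵇ j a) ∨ (suc (leftEdges (n a) (Fs a) (j a) i) ≤ᵇ n a)} nP
    (orP (eqP topP (weakenP jP)) (leqP (sucP (countP {f = λ ((a , i) , c) → keptEdge (n a) (Fs a) (j a) i c}
        (cubeP (weakenP nP))
      (notP (nthP false refl (weakenP {i = i₁} (weakenP FsP))
        (addP (mulP slotsP (weakenP {i = i₁} (weakenP jP))) (addP (mulP (cubeP n₂) (weakenP {i = i₁} topP))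
            topP)))))) (weakenP nP)))
    where
    n₂ : Poly i₂ unary (n ∘ proj₁ ∘ proj₁)
    n₂ = weakenP {i = i₁} (weakenP nP)
    slotsP : Poly i₂ unary (λ ((a , _) , _) → slots (n a) (n a ^ 3))
    slotsP = addP (mulP n₂ (cubeP n₂)) (addP n₂ (addP n₂ (mulP n₂ (mulP n₂ (constP 3)))))

module _ {A : Set} {i : A → Tree} {n : A → ℕ} {rs : A → List (List Bool)} {ds Fs : A → List Bool}
         (nP : Poly i unary n) (rsP : Poly i encRows₂ rs) (dsP : Poly i encBits₂ ds) (FsP : Poly i encBits₂ Fs) where

  private
    closedP : Poly (λ (a , j) → unary j ∙ i a) encBits₂ (λ (a , j) → innerList (n a) (rs a) (maskList (n a) (Fs a) j))
    closedP = innerListP (weakenP nP) (weakenP rsP) (maskListP (weakenP nP) (weakenP FsP) topP)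

    grow : ∀ n ds S S′ → size (encBits₂ (chooseList n ds S S′)) ≤ size (encBits₂ S′) + size (encBits₂ S)
    grow n ds S S′ with count (nth false ds) n ≤ᵇ count (nth false S) n
    ... | true  = m≤n+m _ _
    ... | false = m≤m+n _ _

  convertListP : Poly i encBits₂ (λ a → convertList (n a) (rs a) (ds a) (Fs a))
  convertListP = chooseListP nP dsP (innerListP nP rsP (constListP nP false))
    (downToP {st = λ a j → chooseList (n a) (ds a) (innerList (n a) (rs a) (maskList (n a) (Fs a) j))}
      (chooseListP (outsideP (weakenP nP)) (outsideP (weakenP dsP)) (outsideP closedP) accP)
      (sizePB closedP) (λ a j s → grow (n a) (ds a) _ s) (sucP nP) (constListP nP true))

constList≡ : ∀ b n → constList b n ≡ Vec.toList (Vec.replicate n b)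
constList≡ b n = trans (sym (toList-tabulate {m = n} (const b) (const b) (λ _ → refl))) (cong Vec.toList
  (trans (Vecₚ.tabulate-cong (λ i → sym (Vecₚ.lookup-replicate i b))) (Vecₚ.tabulate∘lookup (Vec.replicate n b))))

module Converting (Q : Square) (F : Subset (Construction.size-E Q)) where

  open Construction Q
  open Core Q
  open Lower Q F

  private
    rs = rows adj
    ds = Vec.toList direct
    Fs = Vec.toList F

  toℕ-bundle : ∀ j i c → toℕ (index j (bundle i c)) ≡ slots n N * toℕ j + (N * toℕ i + toℕ c)
  toℕ-bundle j i c = trans (Finₚ.toℕ-combine j (encodeSlot (bundle i c)))
    (cong (_ +_) (trans (Finₚ.toℕ-↑ˡ (combine i c) _) (Finₚ.toℕ-combine i c)))

  left≡ : ∀ j i → leftEdges n Fs (toℕ j) (toℕ i) ≡ left j i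
  left≡ j i = count≡ (keptEdge n Fs (toℕ j) (toℕ i)) (∁ (chunk j i)) λ c →
    trans (cong not (trans (cong (nth false Fs) (sym (toℕ-bundle j i c))) (nth-toList false F (index j (bundle i c)))))
          (sym (trans (lookup-∁ (chunk j i) c) (cong not (Vecₚ.lookup∘tabulate _ c))))

  mask≡ : ∀ j → maskList n Fs (toℕ j) ≡ Vec.toList (mask j)
  mask≡ j = sym (toList-tabulate _ _ λ i → cong (λ l → (toℕ i ≡ᵇ toℕ j) ∨ (suc l ≤ᵇ n)) (sym (left≡ j i)))

  inner≡ : ∀ m → innerList n rs (Vec.toList m) ≡ Vec.toList (inner adj m)
  inner≡ m = sym (toList-tabulate _ _ λ w → sym (forAll≡ _ (lookup adj w) m λ i →
    cong₂ _∨_ (cong not (Encoding.lookup-rows Q w i)) (nth-toList false m i)))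

  choose≡ : ∀ S S′ → chooseList n ds (Vec.toList S) (Vec.toList S′) ≡ Vec.toList (choose S S′)
  choose≡ S S′ rewrite count≡ (nth false ds) direct (nth-toList false direct)
                     | count≡ (nth false (Vec.toList S)) S (nth-toList false S) with large S
  ... | true  = refl
  ... | false = refl

  closed≡ : ∀ j → innerList n rs (maskList n Fs (toℕ j)) ≡ Vec.toList (closed j)
  closed≡ j = trans (cong (innerList n rs) (mask≡ j)) (inner≡ (mask j))

  firstLarge≡ : ∀ js → List.foldr (λ j → chooseList n ds (innerList n rs (maskList n Fs (toℕ j)))) (constList true n) js
                       ≡ Vec.toList (firstLarge F js)
  firstLarge≡ []       = constList≡ true n
  firstLarge≡ (j ∷ js) = trans (cong₂ (chooseList n ds) (closed≡ j) (firstLarge≡ js))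
      (choose≡ (closed j) (firstLarge F js))

  convert≡ : convertList n rs ds Fs ≡ Vec.toList (convertSquare F)
  convert≡ = trans (cong₂ (chooseList n ds)
      (trans (cong (innerList n rs) (constList≡ false n)) (inner≡ empty))
      (trans (downTo≡foldr-allFin (λ j → chooseList n ds (innerList n rs (maskList n Fs j))) (suc n) (constList true n))
             (firstLarge≡ (List.allFin (suc n)))))
    (choose≡ isolated (firstLarge F (List.allFin (suc n))))

convertSquareP : Poly {A = Σ[ Q ∈ Square ] Subset (Construction.size-E Q)} (λ (Q , F) → encSquare Q ∙ encSubset F)
                      tree (λ (Q , F) → encSubset (Core.convertSquare Q F))
convertSquareP = recode (λ (Q , F) → trans (cong encBits₂ (Converting.convert≡ Q F))
    (sym (encVec≡ encBool (Core.convertSquare Q F))))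
  (convertListP (fromSquare sizeP) (fromSquare rowsP) (fromSquare directP)
    (recode (λ (Q , F) → encVec≡ encBool F) (tlP idP)))
  where
  fromSquare : {B : Set} {e : B → Tree} {f : Square → B} → Poly encSquare e f →
               Poly {A = Σ[ Q ∈ Square ] Subset (Construction.size-E Q)}
                   (λ (Q , F) → encSquare Q ∙ encSubset F) e (f ∘ proj₁)
  fromSquare p = compP (recode {e′ = encSquare} {g = proj₁} (λ _ → refl) (hdP idP)) (reindex proj₁ p)

-- From SSVE to square instances

∣++∣ : ∀ {m k} (p : Subset m) (q : Subset k) → ∣ p Vec.++ q ∣ ≡ ∣ p ∣ + ∣ q ∣
∣++∣ []          q = refl
∣++∣ (true  ∷ p) q = cong suc (∣++∣ p q)
∣++∣ (false ∷ p) q = ∣++∣ p q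

module Squared (I : SSVEInstance) where

  open SSVEInstance I renaming (∣U∣ to u; ∣V∣ to v)

  ps qs : List Bool
  ps = bits (ℕᵇ.fromℕ ℤ.∣ ℚ.↥ α ∣)
  qs = bits (ℕᵇ.fromℕ (ℚ.↧ₙ α))

  -- Decides α |U| ≤ s. The numerator and denominator may be exponential in the size of the
  -- instance, which is why `compare` works on their digits.
  reached : ℕ → Bool
  reached s = compare u s ps qs

  reached-sound : ∀ {s} → reached s ≡ true → α ℚ.* ℕtoℚ u ℚ.≤ ℕtoℚ s
  reached-sound {s} eq = scaled-≤-from α 0<α
    (subst₂ (λ p q → p * u ≤ q * s) (value-binary ℤ.∣ ℚ.↥ α ∣) (value-binary (ℚ.↧ₙ α)) (compare-sound u s ps qs eq))

  reached-complete : ∀ {s} → α ℚ.* ℕtoℚ u ℚ.≤ ℕtoℚ s → reached s ≡ true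
  reached-complete {s} le = compare-complete u s ps qs
    (subst₂ (λ p q → p * u ≤ q * s) (sym (value-binary ℤ.∣ ℚ.↥ α ∣)) (sym (value-binary (ℚ.↧ₙ α))) (scaled-≤-to α 0<α le))

  reached-mono : ∀ {s s′} → s ≤ s′ → reached s ≡ true → reached s′ ≡ true
  reached-mono s≤ eq = reached-complete (ℚₚ.≤-trans (reached-sound eq) (ℕtoℚ-mono s≤))

  reached-u : reached u ≡ true
  reached-u = reached-complete (ℚₚ.≤-trans (ℚₚ.*-monoʳ-≤-nonNeg (ℕtoℚ u) ⦃ ℕtoℚ-nonNeg u ⦄ α≤1)
                                           (ℚₚ.≤-reflexive (ℚₚ.*-identityˡ (ℕtoℚ u))))

  -- The number of elements of short is ⌈ α |U| ⌉.
  short : Subset u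
  short = tabulate (λ i → not (reached (toℕ i)))

  short-≤ : ∀ {s} → reached s ≡ true → ∣ short ∣ ≤ s
  short-≤ {s} r = covered⇒≤ (toℕ ∘ enum short) (toℕ {s}) (enum-injective short ∘ Finₚ.toℕ-injective) λ x →
    let lt = below (enum short x) (lookup-enum short x) in Fin.fromℕ< lt , Finₚ.toℕ-fromℕ< lt
    where
    below : ∀ i → lookup short i ≡ true → toℕ i < s
    below i i∈ = ≰⇒> λ s≤i → true≢false (reached-mono s≤i r) (not-true (trans (sym (Vecₚ.lookup∘tabulate _ i)) i∈))

  -- If `s` were not reached, then by monotonicity none of 0, ..., s would be, and `short` would
  -- have s + 1 elements. For s = |U| there is no element s, and α ≤ 1 is used instead.
  short-reached : ∀ {s} → s ≤ u → ∣ short ∣ ≤ s → reached s ≡ true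
  short-reached {s} s≤u le with reached s in r | m≤n⇒m<n∨m≡n s≤u
  ... | true  | _         = refl
  ... | false | inj₂ refl = ⊥-elim (true≢false reached-u r)
  ... | false | inj₁ s<u  = contradiction (≤-trans (members⇒≤ short (λ x → inject≤ x s<u)
      (λ {x} {y} → Finₚ.inject≤-injective s<u s<u x y) inside) le) (<⇒≱ ≤-refl)
    where
    inside : ∀ x → lookup short (inject≤ x s<u) ≡ true
    inside x = trans (Vecₚ.lookup∘tabulate (λ i → not (reached (toℕ i))) (inject≤ x s<u)) (cong not
      (¬-not λ r′ → true≢false (reached-mono (≤-trans (≤-reflexive (Finₚ.toℕ-inject≤ x s<u))
          (≤-pred (Finₚ.toℕ<n x))) r′) r))

  padded : Fin u → Subset (u + v)
  padded w = Vec.replicate u false Vec.++ lookup adjacency w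

  -- The elements of V are added to U as isolated vertices, which every set may
  -- contain, and those of U to V.
  square : Square
  square = record
    { n      = u + v
    ; adj    = tabulate padded Vec.++ tabulate (λ (_ : Fin v) → Vec.replicate (u + v) false)
    ; direct = short Vec.++ Vec.replicate v true }

  open Square square using (adj; direct)

  adj-U : ∀ w → lookup adj (w ↑ˡ v) ≡ padded w
  adj-U w = trans (Vecₚ.lookup-++ˡ (tabulate padded) _ w) (Vecₚ.lookup∘tabulate padded w)

  adj-V : ∀ (w : Fin v) i → lookup (lookup adj (u ↑ʳ w)) i ≡ false
  adj-V w i = trans (cong (λ r → lookup r i) (trans (Vecₚ.lookup-++ʳ (tabulate padded) _ w)
    (Vecₚ.lookup∘tabulate (λ _ → Vec.replicate (u + v) false) w))) (Vecₚ.lookup-replicate i false)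

  padded-U : ∀ w i → lookup (padded w) (i ↑ˡ v) ≡ false
  padded-U w i = trans (Vecₚ.lookup-++ˡ (Vec.replicate u false) _ i) (Vecₚ.lookup-replicate i false)

  padded-V : ∀ w i → lookup (padded w) (u ↑ʳ i) ≡ lookup (lookup adjacency w) i
  padded-V w i = Vecₚ.lookup-++ʳ (Vec.replicate u false) _ i

  ∣direct∣ : ∣ direct ∣ ≡ ∣ short ∣ + v
  ∣direct∣ = trans (∣++∣ short (Vec.replicate v true)) (cong (∣ short ∣ +_) (Subsetₚ.∣⊤∣≡n v))

  extend : Subset u → Subset (u + v)
  extend S = S Vec.++ Vec.replicate v true

  extend-large : ∀ S → LargeEnough S → ∣ direct ∣ ≤ ∣ extend S ∣
  extend-large S le = ≤-trans (≤-reflexive ∣direct∣) (≤-trans (+-monoˡ-≤ v (short-≤ (reached-complete le)))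
    (≤-reflexive (sym (trans (∣++∣ S (Vec.replicate v true)) (cong (∣ S ∣ +_) (Subsetₚ.∣⊤∣≡n v))))))

  extend-neighbours : ∀ S → ∣ neighbours adj (extend S) ∣ ≤ ∣ Γ S ∣
  extend-neighbours S = members≤ (neighbours adj (extend S)) (λ x → u ↑ʳ enum (Γ S) x) λ i ni →
    let (w , w∈ , wi) = neighbour⁻¹ adj (extend S) i ni in found w i w∈ wi
    where
    found : ∀ w i → lookup (extend S) w ≡ true → lookup (lookup adj w) i ≡ true → ∃[ x ] u ↑ʳ enum (Γ S) x ≡ i
    found w i w∈ wi with splitAt u w | Finₚ.join-splitAt u v w | splitAt u i | Finₚ.join-splitAt u v i
    ... | inj₂ w′ | refl | _       | _    = ⊥-elim (true≢false wi (adj-V w′ i))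
    ... | inj₁ w′ | refl | inj₁ i′ | refl = ⊥-elim (true≢false (trans (cong (λ r → lookup r (i′ ↑ˡ v))
        (sym (adj-U w′))) wi) (padded-U w′ i′))
    ... | inj₁ w′ | refl | inj₂ i′ | refl =
      let (x , eq) = enum-surjective (Γ S) i′ (neighbour adjacency S w′ i′
                       (trans (sym (Vecₚ.lookup-++ˡ S _ w′)) w∈)
                       (trans (sym (padded-V w′ i′)) (trans (cong (λ r → lookup r (u ↑ʳ i′)) (sym (adj-U w′))) wi)))
      in x , cong (u ↑ʳ_) eq

  restrict : Subset (u + v) → Subset u
  restrict = Vec.take u

  lookup-restrict : ∀ S w → lookup (restrict S) w ≡ lookup S (w ↑ˡ v)
  lookup-restrict S w = trans (sym (Vecₚ.lookup-++ˡ (Vec.take u S) (Vec.drop u S) w))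
    (cong (λ S → lookup S (w ↑ˡ v)) (Vecₚ.take++drop≡id u S))

  -- The added vertices contribute at most |V| to a set, and |V| is exactly the amount by which
  -- `direct` exceeds `short`.
  restrict-large : ∀ S → ∣ direct ∣ ≤ ∣ S ∣ → LargeEnough (restrict S)
  restrict-large S le = reached-sound (short-reached (Subsetₚ.∣p∣≤n (restrict S)) (+-cancelʳ-≤ v _ _ (begin
    ∣ short ∣ + v                           ≡⟨ ∣direct∣ ⟨
    ∣ direct ∣                              ≤⟨ le ⟩
    ∣ S ∣                                   ≡⟨ cong (λ S → ∣ S ∣) (Vecₚ.take++drop≡id u S) ⟨
    ∣ Vec.take u S Vec.++ Vec.drop u S ∣    ≡⟨ ∣++∣ (Vec.take u S) (Vec.drop u S) ⟩
    ∣ restrict S ∣ + ∣ Vec.drop u S ∣       ≤⟨ +-monoʳ-≤ ∣ restrict S ∣ (Subsetₚ.∣p∣≤n (Vec.drop u S)) ⟩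
    ∣ restrict S ∣ + v                      ∎)))
    where open ≤-Reasoning

  restrict-neighbours : ∀ S → ∣ Γ (restrict S) ∣ ≤ ∣ neighbours adj S ∣
  restrict-neighbours S = members⇒≤ (neighbours adj S) (λ x → u ↑ʳ enum (Γ (restrict S)) x)
    (λ {x} {y} eq → enum-injective (Γ (restrict S)) (Finₚ.↑ʳ-injective u _ _ eq)) λ x →
        inside (enum (Γ (restrict S)) x) (lookup-enum (Γ (restrict S)) x)
    where
    inside : ∀ i → lookup (Γ (restrict S)) i ≡ true → lookup (neighbours adj S) (u ↑ʳ i) ≡ true
    inside i ni = let (w , w∈ , wi) = neighbour⁻¹ adjacency (restrict S) i ni in
      neighbour adj S (w ↑ˡ v) (u ↑ʳ i) (trans (sym (lookup-restrict S w)) w∈)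
        (trans (cong (λ r → lookup r (u ↑ʳ i)) (adj-U w)) (trans (padded-V w i) wi))

open Squared using (square; restrict)

module _ where

  open SSVEInstance

  private
    encI : SSVEInstance → Tree
    encI = MinProblem.encI SSVE
    i₁ : SSVEInstance × ℕ → Tree
    i₁ (I , w) = unary w ∙ encI I

    uP : Poly encI unary ∣U∣
    uP = recode (λ _ → refl) (hdP (tlP idP))

    vP : Poly encI unary ∣V∣
    vP = recode (λ _ → refl) (hdP (tlP (tlP idP)))

    adjacencyP : Poly encI encRows₂ (rows ∘ adjacency)
    adjacencyP = recode (λ I → encRows (adjacency I)) (tlP (tlP (tlP idP)))

    psP : Poly encI encBits₂ Squared.ps
    psP = recode (λ I → binary-bits ℤ.∣ ℚ.↥ α I ∣) (hdP (hdP idP))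

    qsP : Poly encI encBits₂ Squared.qs
    qsP = recode (λ I → binary-bits (ℚ.↧ₙ α I)) (tlP (hdP idP))

    rowList : SSVEInstance → List (List Bool)
    rowList I = List.map (λ w → constList false (∣U∣ I) ++ nth [] (rows (adjacency I)) w) (List.upTo (∣U∣ I))
                ++ List.map (λ _ → constList false (∣U∣ I + ∣V∣ I)) (List.upTo (∣V∣ I))

    directList : SSVEInstance → List Bool
    directList I = List.map (λ s → not (Squared.reached I s)) (List.upTo (∣U∣ I)) ++ constList true (∣V∣ I)

    rowListP : Poly encI encRows₂ rowList
    rowListP = appendP
      (mapUpToP {f = λ (I , w) → constList false (∣U∣ I) ++ nth [] (rows (adjacency I)) w} uP
        (appendP (weakenP (constListP uP false)) (nthP [] refl (weakenP adjacencyP) topP)))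
      (mapUpToP {f = λ (I , _) → constList false (∣U∣ I + ∣V∣ I)} vP (weakenP (constListP (addP uP vP) false)))

    directListP : Poly encI encBits₂ directList
    directListP = appendP (mapUpToP {f = λ (I , s) → not (Squared.reached I s)} uP
      (notP (compareP (weakenP uP) topP (weakenP psP) (weakenP qsP)))) (constListP vP true)

    rows-++ : ∀ {m m′ k} (p : Vec (Subset k) m) (q : Vec (Subset k) m′) → rows (p Vec.++ q) ≡ rows p ++ rows q
    rows-++ []      q = refl
    rows-++ (r ∷ p) q = cong (Vec.toList r ∷_) (rows-++ p q)

    rows-tabulate : ∀ {m k} (h : Fin m → Subset k) (g : ℕ → List Bool) → (∀ x → Vec.toList (h x) ≡ g (toℕ x)) →
                    rows (tabulate h) ≡ List.map g (List.upTo m)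
    rows-tabulate h g eq = trans (rows-tab h) (tabulate≡map-upTo (Vec.toList ∘ h) g eq)
      where
      rows-tab : ∀ {m k} (h : Fin m → Subset k) → rows (tabulate h) ≡ List.tabulate (Vec.toList ∘ h)
      rows-tab {zero}  h = refl
      rows-tab {suc m} h = cong (Vec.toList (h zero) ∷_) (rows-tab (h ∘ suc))

    rowList≡ : ∀ I → rowList I ≡ rows (Square.adj (square I))
    rowList≡ I = sym (trans (rows-++ (tabulate (Squared.padded I)) _) (cong₂ _++_
      (rows-tabulate (Squared.padded I) _ λ w → trans (Vecₚ.toList-++ (Vec.replicate (∣U∣ I) false)
          (lookup (adjacency I) w))
        (cong₂ _++_ (sym (constList≡ false (∣U∣ I))) (sym (nth-rows (adjacency I) w))))
      (rows-tabulate {∣V∣ I} _ _ λ _ → sym (constList≡ false (∣U∣ I + ∣V∣ I)))))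

    directList≡ : ∀ I → directList I ≡ Vec.toList (Square.direct (square I))
    directList≡ I = sym (trans (Vecₚ.toList-++ (Squared.short I) (Vec.replicate (∣V∣ I) true))
      (cong₂ _++_ (toList-tabulate _ _ λ _ → refl) (sym (constList≡ true (∣V∣ I)))))

  squareP : Poly encI encSquare square
  squareP = recode (λ I → cong (unary (∣U∣ I + ∣V∣ I) ∙_) (cong₂ _∙_
      (trans (cong encRows₂ (rowList≡ I)) (sym (encRows (Square.adj (square I)))))
      (trans (cong encBits₂ (directList≡ I)) (sym (encVec≡ encBool (Square.direct (square I)))))))
    (addP uP vP ⊙ rowListP ⊙ directListP)

  restrictP : {A : Set} {i : A → Tree} (I : A → SSVEInstance) (S : ∀ a → Subset (∣U∣ (I a) + ∣V∣ (I a))) →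
              Poly i encI I → Poly i tree (λ a → encSubset (S a)) → Poly i tree (λ a → encSubset (restrict (I a) (S a)))
  restrictP {i = i} I S IP SP = recode (λ a → trans (cong encBits₂ (restrict≡ (I a) (S a)))
      (sym (encVec≡ encBool (restrict (I a) (S a)))))
    (mapUpToP {f = λ (a , w) → nth false (Vec.toList (S a)) w} (compP IP (reindex I uP))
      (nthP false refl (weakenP (recode (λ a → encVec≡ encBool (S a)) SP)) topP))
    where
    restrict≡ : ∀ I S → List.map (nth false (Vec.toList S)) (List.upTo (∣U∣ I)) ≡ Vec.toList (restrict I S)
    restrict≡ I S = trans (sym (toList-tabulate _ _ λ w →
        trans (Squared.lookup-restrict I S w) (trans (sym (nth-toList false S (w ↑ˡ ∣V∣ I)))
          (cong (nth false (Vec.toList S)) (Finₚ.toℕ-↑ˡ w (∣V∣ I))))))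
      (cong Vec.toList (Vecₚ.tabulate∘lookup (restrict I S)))

-- The reduction

reduction : ApproximationPreservingReduction SSVE KRouteCut
reduction = record
  { reduce = reduce ; reducePolyTime = toPolyTime reduceP
  ; convert = convert ; convertPolyTime = toPolyTime convertP
  ; preserves = preserves }
  where
  module P = MinProblem SSVE
  module Q = MinProblem KRouteCut

  reduce : SSVEInstance → KRouteInstance
  reduce I = Construction.instance′ (square I)

  reduceP : Poly P.encI tree (Q.encI ∘ reduce)
  reduceP = compP squareP (reindex square reduceSquareP)

  convert : ∀ I → Q.Solution (reduce I) → P.Solution I
  convert I (F , _) = restrict I (Core.convertSquare (square I) F)
                    , Squared.restrict-large I _ (Core.convertSquare-large (square I) F)

  Input : Set
  Input = Σ[ I ∈ SSVEInstance ] Q.Solution (reduce I)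

  input : Input → Tree
  input (I , F) = P.encI I ∙ Q.encS {reduce I} F

  convertP : Poly input tree (λ (I , F) → P.encS {I} (convert I F))
  convertP = restrictP proj₁ (λ (I , F , _) → Core.convertSquare (square I) F) instanceP
    (compP (recode {e′ = λ ((Q , F) : Σ[ Q ∈ Square ] Subset (Construction.size-E Q)) →
        encSquare Q ∙ encSubset F} {g = λ (I , F , _) → square I , F} (λ _ → refl)
             (compP instanceP (reindex proj₁ squareP) ⊙ tlP {e = input} idP))
           (reindex (λ (I , F , _) → square I , F) convertSquareP))
    where
    instanceP : Poly input P.encI proj₁
    instanceP = recode (λ _ → refl) (hdP {e = input} idP)

  preserves : ∀ (ρ : Ratio) I o o′ → P.IsOptimum I o → Q.IsOptimum (reduce I) o′ →
              ∀ F → Q.value {reduce I} F ≤[ ρ ]· o′ → P.value {I} (convert I F) ≤[ ρ ]· o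
  preserves ρ I _ o′ (((S , S-large) , refl) , _) (_ , minimal) (F , isCut) near q above = Supₚ.[ begin
    ℕtoℚ ∣ Γ (restrict I T′) ∣               ≤⟨ ℕtoℚ-mono (restrict-neighbours T′) ⟩
    ℕtoℚ ∣ neighbours adj T′ ∣               ≤⟨ Core.Preserve.preserved (square I) F isCut q 1≤q o′
                                                 (λ F′ isCut′ → minimal (F′ , isCut′)) (near q above)
                                                 (extend S) (extend-large S S-large) ⟩
    q ℚ.* ℕtoℚ ∣ neighbours adj (extend S) ∣ ≤⟨ ℚₚ.*-monoˡ-≤-nonNeg q ⦃ ℚ.nonNegative (ℚₚ.≤-trans 0≤1 1≤q) ⦄
                                                 (ℕtoℚ-mono (extend-neighbours S)) ⟩
    q ℚ.* ℕtoℚ ∣ Γ S ∣                       ∎ ]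
    where
    open Squared I using (restrict-neighbours; extend; extend-large; extend-neighbours)
    open SSVEInstance I using (Γ)
    open Square (square I) using (adj)
    open ℚₚ.≤-Reasoning
    T′ = Core.convertSquare (square I) F
    1≤q = Ratio.≥1 ρ above

-- Parameters of the constructed instance

κ μ ν : ℕ × ℕ → ℕ
κ (n , m) = suc (n * n + n)
μ (n , m) = suc n * slots n (n ^ 3)
ν (n , m) = (2 + n) * (3 + (n + n))

positive-*0 : ∀ {k} m → 1 ≤ m * 0 + k → 1 ≤ k
positive-*0 {k} m le = subst (λ x → 1 ≤ x + k) (*-zeroʳ m) le

-- Where m n² is positive, both m and n are at least 1. Then 1 and n are at most n², and the factor
-- m only enlarges the bound.
κ∈O : κ ∈O (λ (n , m) → m * n ^ 2)
κ∈O = 3 , λ { (n , m) 1≤ → bound n m 1≤ }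
  where
  open ≤-Reasoning
  bound : ∀ n m → 1 ≤ m * n ^ 2 → suc (n * n + n) ≤ 3 * (m * n ^ 2)
  bound zero    m       1≤ with () ← positive-*0 {0} m (≤-trans 1≤ (≤-reflexive (sym (+-identityʳ (m * 0)))))
  bound (suc n) (suc m) _   = begin
    suc (suc n * suc n + suc n)     ≤⟨ m≤m+n _ (n * n + (n * n + (n + (n + n)))  ) ⟩
    suc (suc n * suc n + suc n) + (n * n + (n * n + (n + (n + n))))  ≡⟨ lemma n ⟩
    3 * (suc n ^ 2)                 ≤⟨ *-monoʳ-≤ 3 (m≤m+n (suc n ^ 2) (m * suc n ^ 2)) ⟩
    3 * (suc m * suc n ^ 2)         ∎
    where
    lemma : ∀ n → suc (suc n * suc n + suc n) + (n * n + (n * n + (n + (n + n)))) ≡ 3 * (suc n * (suc n * 1))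
    lemma = solve-∀

μ∈O : μ ∈O (λ (n , m) → m * n ^ 2 + n ^ 5)
-- For n ≥ 1 there are n + 1 ≤ 2n blocks, and each has n⁴ + n + n + 3n² ≤ 6n⁴ edges.
μ∈O = 12 , λ { (n , m) 1≤ → bound n m 1≤ }
  where
  open ≤-Reasoning
  slots≤ : ∀ n → slots (suc n) (suc n ^ 3) ≤ 6 * suc n ^ 4
  slots≤ n = begin
    t * t ^ 3 + (t + (t + t * (t * 3)))                     ≡⟨ lemma t ⟩
    t ^ 4 + (t ^ 1 + (t ^ 1 + 3 * t ^ 2))
        ≤⟨ +-monoʳ-≤ (t ^ 4) (+-mono-≤ (up 1 3) (+-mono-≤ (up 1 3) (*-monoʳ-≤ 3 (up 2 2)))) ⟩
    t ^ 4 + (t ^ 4 + (t ^ 4 + 3 * t ^ 4))                   ≡⟨ six (t ^ 4) ⟩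
    6 * t ^ 4                                               ∎
    where
    t = suc n
    up : ∀ a b → t ^ a ≤ t ^ (a + b)
    up a b = ^-monoʳ-≤ t (m≤m+n a b)
    lemma : ∀ t → t * (t * (t * (t * 1))) + (t + (t + t * (t * 3))) 
            ≡ t * (t * (t * (t * 1))) + (t * 1 + (t * 1 + 3 * (t * (t * 1))))
    lemma = solve-∀
    six : ∀ x → x + (x + (x + 3 * x)) ≡ 6 * x
    six = solve-∀
  poly : ∀ n → suc (suc n) * slots (suc n) (suc n ^ 3) ≤ 12 * suc n ^ 5
  poly n = begin
    suc (suc n) * slots (suc n) (suc n ^ 3)    ≤⟨ *-mono-≤ (s≤s (m≤n+m (suc n) n)) (slots≤ n) ⟩
    (suc n + suc n) * (6 * suc n ^ 4)          ≡⟨ lemma (suc n) (suc n ^ 4) ⟩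
    12 * suc n ^ 5                             ∎
    where
    lemma : ∀ t x → (t + t) * (6 * x) ≡ 12 * (t * x)
    lemma = solve-∀
  bound : ∀ n m → 1 ≤ m * n ^ 2 + n ^ 5 → suc n * slots n (n ^ 3) ≤ 12 * (m * n ^ 2 + n ^ 5)
  bound zero    m 1≤ with () ← positive-*0 {0} m 1≤
  bound (suc n) m _   = ≤-trans (poly n) (*-monoʳ-≤ 12 (m≤n+m (suc n ^ 5) (m * suc n ^ 2)))

ν∈O : ν ∈O (λ (n , m) → n ^ 3)
-- For n ≥ 1 the factors are at most 3n and 5n.
ν∈O = 15 , λ { (n , m) 1≤ → bound n 1≤ }
  where
  bound : ∀ n → 1 ≤ n ^ 3 → (2 + n) * (3 + (n + n)) ≤ 15 * n ^ 3
  bound (suc n) _ = begin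
    (3 + n) * (3 + (suc n + suc n))
        ≤⟨ *-mono-≤ (m≤m+n (3 + n) (n + n)) (m≤m+n (3 + (suc n + suc n)) (n + (n + n))) ⟩
    (3 + n + (n + n)) * (3 + (suc n + suc n) + (n + (n + n)))   ≡⟨ lemma n ⟩
    15 * (suc n ^ 2)                         ≤⟨ *-monoʳ-≤ 15 (^-monoʳ-≤ (suc n) {2} {3} (n≤1+n 2)) ⟩
    15 * (suc n ^ 3)                         ∎
    where
    open ≤-Reasoning
    lemma : ∀ n → (3 + n + (n + n)) * (3 + (suc n + suc n) + (n + (n + n))) ≡ 15 * (suc n * (suc n * 1))
    lemma = solve-∀

reindexO : {A B : Set} {f g : A → ℕ} (h : B → A) → f ∈O g → (f ∘ h) ∈O (g ∘ h)
reindexO h (C , bound) = C , bound ∘ h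

solveSSVE : (ρ : KRouteInstance → Ratio) → ApproximationAlgorithm KRouteCut ρ →
            ApproximationAlgorithm SSVE (ρ ∘ ApproximationPreservingReduction.reduce reduction)
solveSSVE ρ A = record
  { solve     = λ I → convert I (A.solve (reduce I))
  -- The SSVE instance is kept beside the cut, because the conversion reads both.
  ; polyTime  = toPolyTime (compP
      (recode {e′ = λ ((I , F) : Σ[ I ∈ SSVEInstance ] Q.Solution (reduce I)) → P.encI I ∙ Q.encS {reduce I} F}
          {g = λ I → I , A.solve (reduce I)} (λ _ → refl)
        (idP ⊙ compP (fromPolyTime reducePolyTime) (reindex reduce (fromPolyTime A.polyTime))))
      (reindex (λ I → I , A.solve (reduce I)) (fromPolyTime convertPolyTime)))
  -- The inequality to be proved is decidable, hence stable under double negation, so it is enough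
  -- that an optimal cut cannot fail to exist.
  ; guarantee = λ I o opt q above → decidable-stable (Supₚ.≤⁺-dec ℚₚ._≤?_ _ _) λ far →
      Core.¬¬optimum (square I) λ (o′ , opt′) →
        far (preserves (ρ (reduce I)) I o o′ opt opt′ (A.solve (reduce I)) (A.guarantee (reduce I) o′ opt′) q above) }
  where
  open ApproximationPreservingReduction reduction
  module A = ApproximationAlgorithm A
  module P = MinProblem SSVE
  module Q = MinProblem KRouteCut

theorem4p2 :
  (Σ[ R ∈ ApproximationPreservingReduction SSVE KRouteCut ]
    let open ApproximationPreservingReduction R
        n = SSVEInstance.nodes
        m = SSVEInstance.edges
    in
    (λ I → KRouteInstance.nodes (reduce I)) ∈O (λ I → n I ^ 3)
    × (λ I → KRouteInstance.edges (reduce I)) ∈O (λ I → m I * n I ^ 2 + n I ^ 5)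
    × (λ I → KRouteInstance.k (reduce I)) ∈O (λ I → m I * n I ^ 2))
  ×
  (∃[ κ ] ∃[ μ ] ∃[ ν ]
    κ ∈O (λ ((n , m) : ℕ × ℕ) → m * n ^ 2)
    × μ ∈O (λ ((n , m) : ℕ × ℕ) → m * n ^ 2 + n ^ 5)
    × ν ∈O (λ ((n , m) : ℕ × ℕ) → n ^ 3)
    × (∀ (ρ : ℕ → ℕ → ℕ → Ratio) →
        ApproximationAlgorithm KRouteCut
          (λ J → let open KRouteInstance J in ρ k edges nodes) →
        ApproximationAlgorithm SSVE
          (λ I → let open SSVEInstance I in
            ρ (κ (nodes , edges)) (μ (nodes , edges)) (ν (nodes , edges)))))
theorem4p2 =
  (reduction , reindexO parameters ν∈O , reindexO parameters μ∈O , reindexO parameters κ∈O) ,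
  κ , μ , ν , κ∈O , μ∈O , ν∈O ,
  -- At the numbers of nodes and edges of an SSVE instance, `κ`, `μ` and `ν` are by computation the
  -- parameters of the reduced instance, so the types agree.
  λ ρ → solveSSVE (λ J → let open KRouteInstance J in ρ k edges nodes)
  where
  parameters : SSVEInstance → ℕ × ℕ
  parameters I = SSVEInstance.nodes I , SSVEInstance.edges I
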